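{- For $\lambda\vdash n$, \[ \widetilde{s}_\lambda(1,q,q^2,\dots;t,tq,tq^2,\dots)=\frac{1}{(q;q)_n}\sum_{\mathcal{T}\in\mathrm{SYT}_\pm(\lambda)}q^{\operatorname{comaj}(\mathcal{T})}t^{\operatorname{neg}(\mathcal{T})}=\frac{1}{(q;q)_n}\sum_{\mathcal{T}\in\mathrm{SYT}_\pm(\lambda)}q^{\operatorname{maj}(\mathcal{T})}t^{\operatorname{neg}(\mathcal{T})}, \] where the left side is the specialization $x_i=q^{i-1}$, $y_i=tq^{i-1}$ and $(q;q)_n=(1-q)\cdots(1-q^n)$.
   Context: Alphabet $\mathcal{A}=\{1<\bar1<2<\bar2<\cdots\}$, $\mathcal{A}_+=\{1,2,\dots\}$, $\mathcal{A}_-=\{\bar1,\bar2,\dots\}$; $z_a=x_a$ for $a\in\mathcal{A}_+$, $z_{\bar b}=y_b$. For $D\subseteq[n-1]$, $\widetilde{Q}_{n,D}(\mathbf{x};\mathbf{y})=\sum z_{a_1}\cdots z_{a_n}$ over weakly increasing $a_1\le\cdots\le a_n$ in $\mathcal{A}$ with $a_i=a_{i+1}\in\mathcal{A}_+\Rightarrow i\notin D$ and $a_i=a_{i+1}\in\mathcal{A}_-\Rightarrow i\in D$. The super Schur function is $\widetilde{s}_\lambda(\mathbf{x};\mathbf{y})=\sum_{T\in\mathrm{SYT}(\lambda)}\widetilde{Q}_{n,\mathrm{Des}(T)}(\mathbf{x};\mathbf{y})$, where for a standard Young tableau $T$ (English notation), $\mathrm{Des}(T)$ is the set of $i\in[n-1]$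 such that $i+1$ is in a strictly lower row than $i$. $\mathrm{SYT}_\pm(\lambda)$ is the set of fillings $\mathcal{T}:\lambda\to\mathcal{A}$ strictly increasing along rows and columns and containing exactly one of $i,\bar i$ for each $i\in[n]$; $\mathcal{T}_+\in\mathrm{SYT}(\lambda)$ is obtained by replacing each $\bar i$ by $i$; $\mathrm{Neg}(\mathcal{T})=\{i:\bar i\in\mathcal{T}\}$, $\operatorname{neg}(\mathcal{T})=|\mathrm{Neg}(\mathcal{T})|$. The super descent set $\mathrm{Des}(\mathcal{T})$ is the set of $i\in[n-1]$ with either ($i\in\mathrm{Des}(\mathcal{T}_+)$ and $i+1\notin\mathrm{Neg}(\mathcal{T})$) or ($i\notin\mathrm{Des}(\mathcal{T}_+)$ and $i\in\mathrm{Neg}(\mathcal{T})$); $\operatorname{maj}(\mathcal{T})=\sum_{i\in\mathrm{Des}(\mathcal{T})}i$ and $\operatorname{comaj}(\mathcal{T})=\sum_{i\in\mathrm{Des}(\mathcal{T})}(n-i)$. -}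

module Defs where

open import Data.Empty using (⊥)
open import Data.Fin using (Fin; zero; suc; toℕ)
import Data.Fin as Fin
import Data.Fin.Properties as Fin
open import Data.Integer using (ℤ; 0ℤ; 1ℤ)
import Data.Integer as ℤ
open import Data.List
  using (List; []; _∷_; [_]; map; foldr; filter; length; upTo; cartesianProductWith; concatMap)
import Data.List as List
open import Data.List.Membership.Propositional using () renaming (_∈_ to _∈ˡ_)
open import Data.List.Relation.Unary.All using (All; []; _∷_)
open import Data.List.Relation.Unary.Linked using (Linked)
open import Data.List.Relation.Unary.Unique.Propositional using (Unique)
open import Data.Nat using (ℕ; zero; suc; _*_; _∸_; _≤_; _<_; _≥_; _≟_; _<?_)
open import Data.Nat.ListAction using (sum)
open import Data.Product using (Σ-syntax; ∃; ∃-syntax; ∃!; _×_; _,_; curry; uncurry)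
import Data.Product.Properties as Product
open import Data.Sum using (_⊎_)
open import Data.Vec using (Vec; []; _∷_)
import Data.Vec as Vec
open import Function using (_on_)
open import Level using (0ℓ)
open import Relation.Binary using (Rel; DecidableEquality)
import Relation.Binary as B
open import Relation.Binary.PropositionalEquality using (_≡_; refl; cong)
open import Relation.Nullary using (¬_; Dec; yes; no)
open import Relation.Nullary.Decidable using (map′; _×-dec_; _⊎-dec_; _→-dec_; ¬?)
open import Relation.Unary using (Pred; Decidable; _∈_; _∉_)

-- The ring ℤ[[q,t]]: f m k is the coefficient of qᵐ tᵏ.
Series : Set
Series = ℕ → ℕ → ℤ

infix  4 _≈_
infixl 6 _⊕_ _⊖_
infixl 7 _⊗_

_≈_ : Rel Series 0ℓ
f ≈ g = ∀ m k → f m k ≡ g m k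

sumℤ : List ℤ → ℤ
sumℤ = foldr ℤ._+_ 0ℤ

q^_t^_ : ℕ → ℕ → Series
(q^ a t^ b) m k with a ≟ m | b ≟ k
... | yes _ | yes _ = 1ℤ
... | _     | _     = 0ℤ

𝟘 𝟙 : Series
𝟘 m k = 0ℤ
𝟙 = q^ 0 t^ 0

_⊕_ _⊖_ _⊗_ : Series → Series → Series
(f ⊕ g) m k = f m k ℤ.+ g m k
(f ⊖ g) m k = f m k ℤ.- g m k
(f ⊗ g) m k =
  sumℤ (map (λ i → sumℤ (map (λ j → f i j ℤ.* g (m ∸ i) (k ∸ j)) (upTo (suc k)))) (upTo (suc m)))

∑ : {I : Set} → List I → (I → Series) → Series
∑ is f = foldr _⊕_ 𝟘 (map f is)

⟦1⋯_⟧ : ℕ → List ℕ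
⟦1⋯ n ⟧ = map suc (upTo n)

-- (q;q)ₙ = (1 - q) ⋯ (1 - qⁿ)
qPochhammer : ℕ → Series
qPochhammer n = foldr _⊗_ 𝟙 (map (λ i → 𝟙 ⊖ q^ i t^ 0) ⟦1⋯ n ⟧)

-- F is the sum of the possibly infinite family (f i), i ∈ P: for each monomial
-- only finitely many members have a nonzero coefficient, and these add up to
-- the coefficient of F.  Such an F is unique up to _≈_.
HasSum : {I : Set} → Pred I 0ℓ → (I → Series) → Series → Set
HasSum {I} P f F = ∀ m k →
  ∃[ is ] Unique is × All P is
        × (∀ {i} → i ∈ P → ¬ (f i m k ≡ 0ℤ) → i ∈ˡ is)
        × sumℤ (map (λ i → f i m k) is) ≡ F m k

-- To avoid a spurious letter 0, pos k is the letter k+1 and neg k is its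
-- barred version, with variables x₍ₖ₊₁₎ and y₍ₖ₊₁₎; the order is
-- 1 < 1̄ < 2 < 2̄ < ⋯.
data Letter : Set where
  pos neg : ℕ → Letter

value : Letter → ℕ
value (pos k) = suc k
value (neg k) = suc k

rank : Letter → ℕ
rank (pos k) = 2 * k
rank (neg k) = suc (2 * k)

_≤ᴸ_ _<ᴸ_ : Rel Letter 0ℓ
_≤ᴸ_ = _≤_ on rank
_<ᴸ_ = _<_ on rank

𝒜₊ 𝒜₋ : Pred Letter 0ℓ
𝒜₊ a = ∃[ k ] a ≡ pos k
𝒜₋ a = ∃[ k ] a ≡ neg k

_≟ᴸ_ : DecidableEquality Letter
pos i ≟ᴸ pos j = map′ (cong pos) (λ { refl → refl }) (i ≟ j)
pos i ≟ᴸ neg j = no λ ()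
neg i ≟ᴸ pos j = no λ ()
neg i ≟ᴸ neg j = map′ (cong neg) (λ { refl → refl }) (i ≟ j)

-- The variables z; x k and y k are the values of x₍ₖ₊₁₎ and y₍ₖ₊₁₎.
z : (x y : ℕ → Series) → Letter → Series
z x y (pos k) = x k
z x y (neg k) = y k

-- D is a subset of {1, …, n-1}, while Fin n starts at 0: the entry at i is the
-- (toℕ i + 1)-st letter of the word.
Admissible : ∀ {n} → Pred ℕ 0ℓ → Pred (Vec Letter n) 0ℓ
Admissible {n} D a = ∀ (i j : Fin n) → toℕ j ≡ suc (toℕ i) →
    Vec.lookup a i ≤ᴸ Vec.lookup a j
  × (Vec.lookup a i ≡ Vec.lookup a j → Vec.lookup a i ∈ 𝒜₊ → suc (toℕ i) ∉ D)
  × (Vec.lookup a i ≡ Vec.lookup a j → Vec.lookup a i ∈ 𝒜₋ → suc (toℕ i) ∈ D)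

-- F is the value of Q̃ₙ,D(x;y).
Q̃[_,_]⟨_,_⟩⇓_ : (n : ℕ) → Pred ℕ 0ℓ → (x y : ℕ → Series) → Series → Set
Q̃[ n , D ]⟨ x , y ⟩⇓ F =
  HasSum (Admissible {n} D) (λ a → Vec.foldr′ _⊗_ 𝟙 (Vec.map (z x y) a)) F

record Partition (n : ℕ) : Set where
  field
    parts      : List ℕ
    positive   : All (0 <_) parts
    decreasing : Linked _≥_ parts
    size       : sum parts ≡ n

open Partition public

-- English notation: a row index, counted from the top, and a column index.
Cell : List ℕ → Set
Cell s = Σ[ r ∈ Fin (length s) ] Fin (List.lookup s r)

Filling : Set → List ℕ → Set
Filling A s = All (Vec A) s

row : ∀ {A s} → Filling A s → (r : Fin (length s)) → Vec A (List.lookup s r)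
row (v ∷ T) zero    = v
row (v ∷ T) (suc r) = row T r

entry : ∀ {A s} → Filling A s → Cell s → A
entry T (r , c) = Vec.lookup (row T r) c

mapFilling : ∀ {A B s} → (A → B) → Filling A s → Filling B s
mapFilling f []      = []
mapFilling f (v ∷ T) = Vec.map f v ∷ mapFilling f T

_occursIn_ : ∀ {A s} → A → Filling A s → Set
a occursIn T = ∃[ c ] entry T c ≡ a

Increasing : ∀ {A s} → Rel A 0ℓ → Pred (Filling A s) 0ℓ
Increasing {s = s} _≺_ T =
    (∀ r (c d : Fin (List.lookup s r)) → c Fin.< d → entry T (r , c) ≺ entry T (r , d))
  × (∀ ((r , c) (r′ , c′) : Cell s) → r Fin.< r′ → toℕ c ≡ toℕ c′ →
       entry T (r , c) ≺ entry T (r′ , c′))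

Des : ∀ {s} → Filling ℕ s → Pred ℕ 0ℓ
Des T i = ∃[ r ] ∃[ c ] ∃[ r′ ] ∃[ c′ ]
  entry T (r , c) ≡ i × entry T (r′ , c′) ≡ suc i × r Fin.< r′

IsSYT : ∀ {s} → ℕ → Pred (Filling ℕ s) 0ℓ
IsSYT n T = Increasing _<_ T × (∀ (i : Fin n) → ∃! _≡_ (λ c → entry T c ≡ suc (toℕ i)))

IsSYT± : ∀ {s} → ℕ → Pred (Filling Letter s) 0ℓ
IsSYT± n 𝒯 = Increasing _<ᴸ_ 𝒯 × (∀ (i : Fin n) →
    (pos (toℕ i) occursIn 𝒯 × ¬ (neg (toℕ i) occursIn 𝒯))
  ⊎ (¬ (pos (toℕ i) occursIn 𝒯) × neg (toℕ i) occursIn 𝒯))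

_₊ : ∀ {s} → Filling Letter s → Filling ℕ s
_₊ = mapFilling value

Neg : ∀ {s} → Filling Letter s → Pred ℕ 0ℓ
Neg 𝒯 zero    = ⊥
Neg 𝒯 (suc k) = neg k occursIn 𝒯

Des± : ∀ {s} → Filling Letter s → Pred ℕ 0ℓ
Des± 𝒯 i = (i ∈ Des (𝒯 ₊) × suc i ∉ Neg 𝒯) ⊎ (i ∉ Des (𝒯 ₊) × i ∈ Neg 𝒯)

anyCell? : ∀ s {P : Pred (Cell s) 0ℓ} → Decidable P → Dec (∃ P)
anyCell? s P? = map′ (λ (r , c , p) → (r , c) , p) (λ ((r , c) , p) → r , c , p)
                   (Fin.any? λ r → Fin.any? λ c → P? (r , c))

allCells? : ∀ s {P : Pred (Cell s) 0ℓ} → Decidable P → Dec (∀ c → P c)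
allCells? s P? = map′ uncurry curry (Fin.all? λ r → Fin.all? λ c → P? (r , c))

_≟ᶜ_ : ∀ {s} → DecidableEquality (Cell s)
_≟ᶜ_ = Product.≡-dec Fin._≟_ Fin._≟_

occursIn? : ∀ {A s} → DecidableEquality A → (a : A) (T : Filling A s) → Dec (a occursIn T)
occursIn? {s = s} _≟_ a T = anyCell? s λ c → entry T c ≟ a

occursOnce? : ∀ {A s} → DecidableEquality A → (a : A) (T : Filling A s) →
              Dec (∃! _≡_ (λ c → entry T c ≡ a))
occursOnce? {s = s} _≟_ a T = anyCell? s λ c → (entry T c ≟ a) ×-dec
  map′ (λ f {d} → f d) (λ f d → f {d}) (allCells? s λ d → (entry T d ≟ a) →-dec (_≟ᶜ_ {s} c d))

increasing? : ∀ {A s} {_≺_ : Rel A 0ℓ} → B.Decidable _≺_ → Decidable (Increasing {A} {s} _≺_)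
increasing? {s = s} _≺?_ T =
  (Fin.all? λ r → Fin.all? λ c → Fin.all? λ d →
     (c Fin.<? d) →-dec (entry T (r , c) ≺? entry T (r , d)))
  ×-dec
  (allCells? s λ (r , c) → allCells? s λ (r′ , c′) →
     (r Fin.<? r′) →-dec ((toℕ c ≟ toℕ c′) →-dec (entry T (r , c) ≺? entry T (r′ , c′))))

isSYT? : ∀ {s} n → Decidable (IsSYT {s} n)
isSYT? n T = increasing? _<?_ T ×-dec Fin.all? λ i → occursOnce? _≟_ (suc (toℕ i)) T

isSYT±? : ∀ {s} n → Decidable (IsSYT± {s} n)
isSYT±? n 𝒯 = increasing? (λ a b → rank a <? rank b) 𝒯 ×-dec Fin.all? λ i →
  let p? = occursIn? _≟ᴸ_ (pos (toℕ i)) 𝒯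
      n? = occursIn? _≟ᴸ_ (neg (toℕ i)) 𝒯
  in (p? ×-dec ¬? n?) ⊎-dec (¬? p? ×-dec n?)

des? : ∀ {s} (T : Filling ℕ s) → Decidable (Des T)
des? T i = Fin.any? λ r → Fin.any? λ c → Fin.any? λ r′ → Fin.any? λ c′ →
  (entry T (r , c) ≟ i) ×-dec ((entry T (r′ , c′) ≟ suc i) ×-dec (r Fin.<? r′))

neg? : ∀ {s} (𝒯 : Filling Letter s) → Decidable (Neg 𝒯)
neg? 𝒯 zero    = no λ ()
neg? 𝒯 (suc k) = occursIn? _≟ᴸ_ (neg k) 𝒯

des±? : ∀ {s} (𝒯 : Filling Letter s) → Decidable (Des± 𝒯)
des±? 𝒯 i = (des? (𝒯 ₊) i ×-dec ¬? (neg? 𝒯 (suc i))) ⊎-dec (¬? (des? (𝒯 ₊) i) ×-dec neg? 𝒯 i)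

vecs : {A : Set} → List A → (k : ℕ) → List (Vec A k)
vecs as zero    = [ [] ]
vecs as (suc k) = cartesianProductWith _∷_ as (vecs as k)

fillings : {A : Set} → List A → (s : List ℕ) → List (Filling A s)
fillings as []      = [ [] ]
fillings as (k ∷ s) = cartesianProductWith _∷_ (vecs as k) (fillings as s)

letters : ℕ → List Letter
letters n = concatMap (λ k → pos k ∷ neg k ∷ []) (upTo n)

-- As λ has n cells, a filling satisfying IsSYT n (IsSYT± n) has all its
-- entries among 1, …, n (1, 1̄, …, n, n̄), so each list is exhaustive.
SYT : ∀ {n} (λ′ : Partition n) → List (Filling ℕ (parts λ′))
SYT {n} λ′ = filter (isSYT? n) (fillings ⟦1⋯ n ⟧ (parts λ′))

SYT± : ∀ {n} (λ′ : Partition n) → List (Filling Letter (parts λ′))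
SYT± {n} λ′ = filter (isSYT±? n) (fillings (letters n) (parts λ′))

desList : ∀ {s} → ℕ → Filling Letter s → List ℕ
desList n 𝒯 = filter (des±? 𝒯) ⟦1⋯ n ∸ 1 ⟧

maj comaj #neg : ∀ {s} → ℕ → Filling Letter s → ℕ
maj   n 𝒯 = sum (desList n 𝒯)
comaj n 𝒯 = sum (map (n ∸_) (desList n 𝒯))
#neg  n 𝒯 = length (filter (neg? 𝒯) ⟦1⋯ n ⟧)

-- F is the value of the super Schur function of λ at x, y: the outer sum over
-- SYT(λ) is finite, and the inner ones over words are infinite.
s̃[_]⟨_,_⟩⇓_ : ∀ {n} → Partition n → (x y : ℕ → Series) → Series → Set
s̃[_]⟨_,_⟩⇓_ {n} λ′ x y F =
  Σ[ Q ∈ (Filling ℕ (parts λ′) → Series) ]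
    (∀ T → T ∈ˡ SYT λ′ → Q̃[ n , Des T ]⟨ x , y ⟩⇓ Q T)
  × F ≈ ∑ (SYT λ′) Q

{-# OPTIONS --safe #-}
module Submission where

-- A standard tableau T of shape λ is the same as a lattice word w, the rows of
-- the cells 1, …, n, and i is a descent of T iff w i < w (i + 1).  Writing an
-- admissible word as a sequence of signs and a sequence of values, the values
-- are weakly increasing, strictly so exactly at the super descents of the
-- signed tableau.  Hence they are P-partitions, with generating function
-- q^comaj / (q;q)ₙ; if the values are to decrease instead, it is q^maj / (q;q)ₙ.
--
-- It remains to see that s̃ does not change when the alphabet is listed with the
-- values in decreasing order.  Reading the letters one after the other, a letter
-- adds a horizontal strip (x) or a vertical strip (y) to the shape.  Let H x and
-- E y be the corresponding operators on functions of shapes.  The matrix entries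
-- of H x ∘ H y are products over the rows which are symmetric in x and y up to
-- telescoping boundary factors, so these operators commute; and E (- x) is
-- inverse to H x, so all the H x and E y commute.
--
-- To avoid infinite sums, only letters with values below M are used, which is
-- enough modulo q^M.

open import Algebra.Bundles using (CommutativeRing)
open import Data.Bool using (Bool; true; false; if_then_else_; not; _∧_; _∨_)
import Data.Bool as Bool
open import Data.Bool.Properties using (∧-assoc; ∧-comm; ∧-identityʳ)
open import Data.Empty using (⊥-elim)
open import Data.Fin as Fin using (Fin; zero; suc; toℕ; _↑ˡ_; _↑ʳ_; splitAt)
import Data.Fin.Properties as Fin
open import Data.List as List using (List; []; _∷_; _++_; length; map; foldr; filter; upTo; downFrom; applyUpTo; allFin; concat; concatMap; cartesianProductWith)
open import Data.List.Membership.Propositional using () renaming (_∈_ to _∈ˡ_)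
open import Data.List.Membership.Propositional.Properties
open import Data.List.Membership.Propositional.Properties.WithK using (unique∧set⇒bag)
open import Data.List.Properties using (applyUpTo-∷ʳ; map-++; map-applyUpTo; map-cong; map-id; map-tabulate; map-upTo; reverse-downFrom)
open import Data.List.Relation.Binary.BagAndSetEquality using (∼bag⇒↭)
import Data.List.Relation.Binary.Permutation.Propositional as ↭
open import Data.List.Relation.Binary.Permutation.Propositional.Properties using (↭-reverse)
open import Data.List.Relation.Unary.All as All using (All; []; _∷_)
import Data.List.Relation.Unary.All.Properties as All
open import Data.List.Relation.Unary.AllPairs as AllPairs using (AllPairs; []; _∷_)
import Data.List.Relation.Unary.AllPairs.Properties as AllPairs
open import Data.List.Relation.Unary.Any using (here; there)
open import Data.List.Relation.Unary.Linked.Properties using (Linked⇒AllPairs)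
open import Data.List.Relation.Unary.Unique.Propositional using (Unique)
import Data.List.Relation.Unary.Unique.Propositional.Properties as Unique
open import Data.Nat as ℕ using (ℕ; zero; suc; _∸_; _⊔_; _⊓_; _<ᵇ_; _≤_; _<_; z≤n; s≤s; _≤?_)
import Data.Nat.Properties as ℕ
open import Data.Nat.Solver using (module +-*-Solver)
open import Data.Product using (_×_; _,_; proj₁; proj₂; ∃-syntax; Σ-syntax)
open import Data.Sum using (_⊎_; inj₁; inj₂)
open import Data.Unit using (⊤; tt)
open import Data.Vec as Vec using (Vec; []; _∷_; _∷ʳ_; zip; reverse; replicate)
import Data.Vec.Properties as Vec
open import Data.Vec.Properties using (reverse-∷)
open import Function using (_∘_; flip; id; mk⇔)
open import Level using (0ℓ)
import Relation.Binary.PropositionalEquality as ≡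
import Relation.Binary.Reasoning.Setoid as SetoidReasoning
open import Relation.Nullary using (¬_; Dec; yes; no; contradiction; does)
open import Relation.Nullary.Decidable using (_→-dec_; _×-dec_; ¬?)
open import Relation.Unary using (Pred; Decidable)
open import Defs using (vecs)
open ↭ using (_↭_)
open ≡ using (_≡_)

-- Finite sums and power series

-- In both orders of the values a barred letter directly follows the unbarred letter of the same
-- value. So the letters of value k act by the same block, H (x k) after E (y k), in both alphabets,
-- and reversing the values only permutes the blocks. For `maj`, a word with decreasing values is
-- read backwards: its values increase, the descent relation is flipped, and position i becomes n -
-- i.
--
-- The bound `c` on the first row keeps every sum over shapes finite, so the operators live over an
-- arbitrary commutative ring and no convergence is involved. Its price is the last boundary factor,
-- a power with the excess of the new first row over `c` as exponent. This excess is zero for all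
-- shapes within the bound.
--
-- The P-partition formula for values below M carries an error term q^M h with an unspecified h. As
-- (q;q)ₙ has constant term 1, it can be divided out, and the error then leaves all coefficients
-- below degree M in q intact. Degree m is read off with M = m + 1.

module FiniteSums (R : CommutativeRing 0ℓ 0ℓ) where
  open CommutativeRing R
  open SetoidReasoning setoid
  open import Algebra.Properties.CommutativeSemigroup +-commutativeSemigroup using (interchange; x∙yz≈y∙xz)

  ∑ᴿ : {I : Set} → List I → (I → Carrier) → Carrier
  ∑ᴿ is f = foldr _+_ 0# (map f is)

  private variable
    I J K : Set

  ∑-cong-∈ : ∀ (is : List I) {f g : I → Carrier} → (∀ i → i ∈ˡ is → f i ≈ g i) → ∑ᴿ is f ≈ ∑ᴿ is g
  ∑-cong-∈ []       f≈g = refl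
  ∑-cong-∈ (i ∷ is) f≈g = +-cong (f≈g i (here ≡.refl)) (∑-cong-∈ is λ j j∈ → f≈g j (there j∈))

  ∑-cong : ∀ (is : List I) {f g : I → Carrier} → (∀ i → f i ≈ g i) → ∑ᴿ is f ≈ ∑ᴿ is g
  ∑-cong is f≈g = ∑-cong-∈ is λ i _ → f≈g i

  ∑-zero : ∀ (is : List I) {f : I → Carrier} → (∀ i → f i ≈ 0#) → ∑ᴿ is f ≈ 0#
  ∑-zero []       f≈0 = refl
  ∑-zero (i ∷ is) f≈0 = trans (+-cong (f≈0 i) (∑-zero is f≈0)) (+-identityˡ 0#)

  ∑-+ : ∀ (is : List I) (f g : I → Carrier) → ∑ᴿ is (λ i → f i + g i) ≈ ∑ᴿ is f + ∑ᴿ is g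
  ∑-+ []       f g = sym (+-identityˡ 0#)
  ∑-+ (i ∷ is) f g = trans (+-congˡ (∑-+ is f g)) (interchange _ _ _ _)

  *-∑ : ∀ (is : List I) x (f : I → Carrier) → x * ∑ᴿ is f ≈ ∑ᴿ is (λ i → x * f i)
  *-∑ []       x f = zeroʳ x
  *-∑ (i ∷ is) x f = trans (distribˡ x _ _) (+-congˡ (*-∑ is x f))

  ∑-* : ∀ (is : List I) x (f : I → Carrier) → ∑ᴿ is f * x ≈ ∑ᴿ is (λ i → f i * x)
  ∑-* []       x f = zeroˡ x
  ∑-* (i ∷ is) x f = trans (distribʳ x _ _) (+-congˡ (∑-* is x f))

  ∑-++ : ∀ (is js : List I) (f : I → Carrier) → ∑ᴿ (is ++ js) f ≈ ∑ᴿ is f + ∑ᴿ js f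
  ∑-++ []       js f = sym (+-identityˡ _)
  ∑-++ (i ∷ is) js f = trans (+-congˡ (∑-++ is js f)) (sym (+-assoc _ _ _))

  ∑-map : ∀ (is : List I) (h : I → J) (f : J → Carrier) → ∑ᴿ (map h is) f ≈ ∑ᴿ is (f ∘ h)
  ∑-map []       h f = refl
  ∑-map (i ∷ is) h f = +-congˡ (∑-map is h f)

  ∑-concatMap : ∀ (is : List I) (h : I → List J) (f : J → Carrier) →
    ∑ᴿ (concatMap h is) f ≈ ∑ᴿ is (λ i → ∑ᴿ (h i) f)
  ∑-concatMap []       h f = refl
  ∑-concatMap (i ∷ is) h f = trans (∑-++ (h i) _ f) (+-congˡ (∑-concatMap is h f))

  ∑-swap : ∀ (is : List I) (js : List J) (f : I → J → Carrier) →
    ∑ᴿ is (λ i → ∑ᴿ js (f i)) ≈ ∑ᴿ js (λ j → ∑ᴿ is (λ i → f i j))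
  ∑-swap []       js f = sym (∑-zero js λ _ → refl)
  ∑-swap (i ∷ is) js f = trans (+-congˡ (∑-swap is js f)) (sym (∑-+ js _ _))

  ∑-↭ : ∀ {is js : List I} (f : I → Carrier) → is ↭ js → ∑ᴿ is f ≈ ∑ᴿ js f
  ∑-↭ f ↭.refl         = refl
  ∑-↭ f (↭.prep x p)   = +-congˡ (∑-↭ f p)
  ∑-↭ f (↭.swap x y p) = trans (+-congˡ (+-congˡ (∑-↭ f p))) (x∙yz≈y∙xz _ _ _)
  ∑-↭ f (↭.trans p q)  = trans (∑-↭ f p) (∑-↭ f q)

  ∑-product : ∀ (h : I → J → K) (is : List I) (js : List J) (f : K → Carrier) →
    ∑ᴿ (cartesianProductWith h is js) f ≈ ∑ᴿ is (λ i → ∑ᴿ js (λ j → f (h i j)))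
  ∑-product h []       js f = refl
  ∑-product h (i ∷ is) js f =
    trans (∑-++ (map (h i) js) _ f) (+-cong (∑-map js (h i) f) (∑-product h is js f))

  ∑-vecs : ∀ (as : List I) n (f : Vec I (suc n) → Carrier) →
    ∑ᴿ (vecs as (suc n)) f ≈ ∑ᴿ as (λ a → ∑ᴿ (vecs as n) (λ v → f (a ∷ v)))
  ∑-vecs as n f = ∑-product _∷_ as (vecs as n) f

  -- The Iverson bracket. Conditions are kept as brackets rather than built into the index lists, so
  -- that sums over independent lists can be interchanged.
  [_]_ : Bool → Carrier → Carrier
  [ b ] x = if b then x else 0#

  infixr 8 [_]_

  []-cong : ∀ b {x y} → x ≈ y → [ b ] x ≈ [ b ] y
  []-cong true  x≈y = x≈y
  []-cong false x≈y = refl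

  ∑-filter : ∀ {P : Pred I 0ℓ} (P? : Decidable P) (is : List I) (f : I → Carrier) →
    ∑ᴿ (filter P? is) f ≈ ∑ᴿ is (λ i → [ does (P? i) ] f i)
  ∑-filter P? []       f = refl
  ∑-filter P? (i ∷ is) f with does (P? i)
  ... | true  = +-congˡ (∑-filter P? is f)
  ... | false = trans (∑-filter P? is f) (sym (+-identityˡ _))

  []-∑ : ∀ b (is : List I) (f : I → Carrier) → [ b ] ∑ᴿ is f ≈ ∑ᴿ is (λ i → [ b ] f i)
  []-∑ true  is f = refl
  []-∑ false is f = sym (∑-zero is λ _ → refl)

  *-[] : ∀ b x y → x * [ b ] y ≈ [ b ] (x * y)
  *-[] true  x y = refl
  *-[] false x y = zeroʳ x

  ∑-upTo : ∀ n (f : ℕ → Carrier) → ∑ᴿ (upTo (suc n)) f ≈ f 0 + ∑ᴿ (upTo n) (f ∘ suc)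
  ∑-upTo n f = +-congˡ (reflexive (≡.cong (foldr _+_ 0#)
    (≡.trans (map-applyUpTo suc f n) (≡.sym (map-applyUpTo id (f ∘ suc) n)))))

module PowerSeries (R : CommutativeRing 0ℓ 0ℓ) where
  open CommutativeRing R
  open SetoidReasoning setoid
  open FiniteSums R
  open import Algebra.Properties.CommutativeSemigroup +-commutativeSemigroup using (interchange; x∙yz≈y∙xz)

  Stream : Set
  Stream = ℕ → Carrier

  -- In this form the tail of a product is by definition `f 0` times the tail of `g` plus the tail
  -- of `f` times `g`, so the ring laws follow by induction on the degree. The usual sum is
  -- recovered in `conv-∑`.
  conv : Stream → Stream → Stream
  conv f g zero    = f 0 * g 0
  conv f g (suc m) = f 0 * g (suc m) + conv (f ∘ suc) g m

  _≗_ : Stream → Stream → Set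
  f ≗ g = ∀ m → f m ≈ g m

  one : Stream
  one zero    = 1#
  one (suc _) = 0#

  conv-cong : ∀ {f f′ g g′} → f ≗ f′ → g ≗ g′ → conv f g ≗ conv f′ g′
  conv-cong p q zero    = *-cong (p 0) (q 0)
  conv-cong p q (suc m) = +-cong (*-cong (p 0) (q (suc m))) (conv-cong (p ∘ suc) q m)

  conv-sucʳ : ∀ f g m → conv f g (suc m) ≈ f (suc m) * g 0 + conv f (g ∘ suc) m
  conv-sucʳ f g zero    = +-comm _ _
  conv-sucʳ f g (suc m) = trans (+-congˡ (conv-sucʳ (f ∘ suc) g m)) (x∙yz≈y∙xz _ _ _)

  conv-comm : ∀ f g → conv f g ≗ conv g f
  conv-comm f g zero    = *-comm _ _
  conv-comm f g (suc m) = trans (conv-sucʳ f g m) (+-cong (*-comm _ _) (conv-comm f (g ∘ suc) m))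

  conv-distribʳ : ∀ h f g → conv (λ m → f m + g m) h ≗ (λ m → conv f h m + conv g h m)
  conv-distribʳ h f g zero    = distribʳ _ _ _
  conv-distribʳ h f g (suc m) =
    trans (+-cong (distribʳ _ _ _) (conv-distribʳ h (f ∘ suc) (g ∘ suc) m)) (interchange _ _ _ _)

  conv-scale : ∀ x f g → conv (λ m → x * f m) g ≗ (λ m → x * conv f g m)
  conv-scale x f g zero    = *-assoc _ _ _
  conv-scale x f g (suc m) =
    trans (+-cong (*-assoc _ _ _) (conv-scale x (f ∘ suc) g m)) (sym (distribˡ _ _ _))

  conv-assoc : ∀ f g h → conv (conv f g) h ≗ conv f (conv g h)
  conv-assoc f g h zero    = *-assoc _ _ _
  conv-assoc f g h (suc m) = begin
    (f 0 * g 0) * h (suc m) + conv (λ i → f 0 * g (suc i) + conv (f ∘ suc) g i) h m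
      ≈⟨ +-cong (*-assoc _ _ _) (conv-distribʳ h _ _ m) ⟩
    f 0 * (g 0 * h (suc m)) + (conv (λ i → f 0 * g (suc i)) h m + conv (conv (f ∘ suc) g) h m)
      ≈⟨ +-congˡ (+-cong (conv-scale _ _ h m) (conv-assoc (f ∘ suc) g h m)) ⟩
    f 0 * (g 0 * h (suc m)) + (f 0 * conv (g ∘ suc) h m + conv (f ∘ suc) (conv g h) m)
      ≈⟨ +-assoc _ _ _ ⟨
    f 0 * (g 0 * h (suc m)) + f 0 * conv (g ∘ suc) h m + conv (f ∘ suc) (conv g h) m
      ≈⟨ +-congʳ (distribˡ _ _ _) ⟨
    f 0 * conv g h (suc m) + conv (f ∘ suc) (conv g h) m ∎

  conv-zeroˡ : ∀ f g → (∀ m → f m ≈ 0#) → ∀ m → conv f g m ≈ 0#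
  conv-zeroˡ f g f≈0 zero    = trans (*-congʳ (f≈0 0)) (zeroˡ _)
  conv-zeroˡ f g f≈0 (suc m) =
    trans (+-cong (trans (*-congʳ (f≈0 0)) (zeroˡ _)) (conv-zeroˡ (f ∘ suc) g (f≈0 ∘ suc) m)) (+-identityˡ 0#)

  conv-identityˡ : ∀ f → conv one f ≗ f
  conv-identityˡ f zero    = *-identityˡ _
  conv-identityˡ f (suc m) =
    trans (+-cong (*-identityˡ _) (conv-zeroˡ (one ∘ suc) f (λ _ → refl) m)) (+-identityʳ _)

  conv-∑ : ∀ f g m → conv f g m ≈ ∑ᴿ (upTo (suc m)) (λ i → f i * g (m ℕ.∸ i))
  conv-∑ f g zero    = sym (+-identityʳ _)
  conv-∑ f g (suc m) = trans (+-congˡ (conv-∑ (f ∘ suc) g m)) (sym (∑-upTo (suc m) _))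

  powerSeries : CommutativeRing 0ℓ 0ℓ
  powerSeries = record
    { Carrier = Stream ; _≈_ = _≗_
    ; _+_ = λ f g m → f m + g m ; _*_ = conv ; -_ = λ f m → - f m ; 0# = λ _ → 0# ; 1# = one
    ; isCommutativeRing = record
      { isRing = record
        { +-isAbelianGroup = record
          { isGroup = record
            { isMonoid = record
              { isSemigroup = record
                { isMagma = record
                  { isEquivalence = record
                    { refl = λ _ → refl ; sym = λ p m → sym (p m) ; trans = λ p q m → trans (p m) (q m) }
                  ; ∙-cong = λ p q m → +-cong (p m) (q m) }
                ; assoc = λ _ _ _ _ → +-assoc _ _ _ }
              ; identity = (λ _ _ → +-identityˡ _) , (λ _ _ → +-identityʳ _) }
            ; inverse = (λ _ _ → -‿inverseˡ _) , (λ _ _ → -‿inverseʳ _)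
            ; ⁻¹-cong = λ p m → -‿cong (p m) }
          ; comm = λ _ _ _ → +-comm _ _ }
        ; *-cong = conv-cong
        ; *-assoc = conv-assoc
        ; *-identity = conv-identityˡ , (λ f m → trans (conv-comm f one m) (conv-identityˡ f m))
        ; distrib = (λ h f g m → trans (conv-comm h _ m) (trans (conv-distribʳ h f g m)
                      (+-cong (conv-comm f h m) (conv-comm g h m)))) , conv-distribʳ }
      ; *-comm = conv-comm } }

  monomial : ℕ → Carrier → Stream
  monomial zero    x zero    = x
  monomial zero    x (suc m) = 0#
  monomial (suc a) x zero    = 0#
  monomial (suc a) x (suc m) = monomial a x m

  monomial-cong : ∀ a {x y} → x ≈ y → monomial a x ≗ monomial a y
  monomial-cong zero    p zero    = p
  monomial-cong zero    p (suc m) = refl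
  monomial-cong (suc a) p zero    = refl
  monomial-cong (suc a) p (suc m) = monomial-cong a p m

  monomial-* : ∀ a b x y → conv (monomial a x) (monomial b y) ≗ monomial (a ℕ.+ b) (x * y)
  monomial-* zero zero    x y zero    = refl
  monomial-* zero (suc b) x y zero    = zeroʳ x
  monomial-* zero zero    x y (suc m) = trans (+-cong (zeroʳ x) (conv-zeroˡ (λ _ → 0#) _ (λ _ → refl) m)) (+-identityˡ 0#)
  monomial-* zero (suc b) x y (suc m) =
    trans (+-congˡ (conv-zeroˡ (λ _ → 0#) _ (λ _ → refl) m)) (trans (+-identityʳ _) (scale b m))
    where
    scale : ∀ b m → x * monomial b y m ≈ monomial b (x * y) m
    scale zero    zero    = refl
    scale zero    (suc m) = zeroʳ x
    scale (suc b) zero    = zeroʳ x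
    scale (suc b) (suc m) = scale b m
  monomial-* (suc a) b x y zero    = zeroˡ _
  monomial-* (suc a) b x y (suc m) = trans (+-congʳ (zeroˡ _)) (trans (+-identityˡ _) (monomial-* a b x y m))

  -- Removes the error terms `q ^ M * h` from all coefficients below degree `M`.
  monomial-low : ∀ {M m} → m ℕ.< M → ∀ x f → conv (monomial M x) f m ≈ 0#
  monomial-low {suc M} {zero}  (ℕ.s≤s _)   x f = zeroˡ _
  monomial-low {suc M} {suc m} (ℕ.s≤s m<M) x f =
    trans (+-cong (zeroˡ _) (monomial-low m<M x f)) (+-identityˡ 0#)

-- Inverses of power series with constant term 1

module Inverse (R : CommutativeRing 0ℓ 0ℓ) where
  open CommutativeRing R hiding (zero)
  open PowerSeries R

  conv-cong-≤ : ∀ f {g g′} m → (∀ i → i ℕ.≤ m → g i ≈ g′ i) → conv f g m ≈ conv f g′ m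
  conv-cong-≤ f zero    e = *-congˡ (e 0 ℕ.z≤n)
  conv-cong-≤ f (suc m) e = +-cong (*-congˡ (e (suc m) ℕ.≤-refl)) (conv-cong-≤ (f ∘ suc) m λ i i≤m → e i (ℕ.m≤n⇒m≤1+n i≤m))

  -- The first j + 1 coefficients of approximation f j are those of 1 / f.
  approximation : Stream → ℕ → Stream
  approximation f j       zero    = 1#
  approximation f zero    (suc m) = 0#
  approximation f (suc j) (suc m) = - conv (f ∘ suc) (approximation f j) m

  approximation-stable : ∀ f i j m → m ℕ.≤ i → m ℕ.≤ j → approximation f i m ≈ approximation f j m
  approximation-stable f i       j       zero    _         _         = refl
  approximation-stable f (suc i) (suc j) (suc m) (ℕ.s≤s m≤i) (ℕ.s≤s m≤j) = -‿cong (conv-cong-≤ (f ∘ suc) m λ l l≤m →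
    approximation-stable f i j l (ℕ.≤-trans l≤m m≤i) (ℕ.≤-trans l≤m m≤j))

  -- The diagonal is taken because stage `m` is the first one whose coefficient `m` is final; by
  -- `approximation-stable` later stages do not change it.
  inverse : Stream → Stream
  inverse f m = approximation f m m

  conv-inverse : ∀ f → f 0 ≈ 1# → conv f (inverse f) ≗ one
  conv-inverse f f₀≈1 zero    = trans (*-identityʳ _) f₀≈1
  conv-inverse f f₀≈1 (suc m) = trans (+-congʳ (trans (*-congʳ f₀≈1) (*-identityˡ _)))
    (trans (+-congˡ (conv-cong-≤ (f ∘ suc) m λ l l≤m → approximation-stable f l m l ℕ.≤-refl l≤m)) (-‿inverseˡ _))

module RingIdentities (R : CommutativeRing 0ℓ 0ℓ) where
  open CommutativeRing R
  open import Algebra.Solver.Ring.NaturalCoefficients.Default commutativeSemiring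

  qx*yz≈qy*xz : ∀ q x y z → (q * x) * (y * z) ≈ (q * y) * (x * z)
  qx*yz≈qy*xz = solve 4 (λ q x y z → (q :* x) :* (y :* z) := (q :* y) :* (x :* z)) refl

  distribute : ∀ a b x c y → a * b * (x + c * y) ≈ b * (a * x) + c * (a * b * y)
  distribute = solve 5 (λ a b x c y → a :* b :* (x :+ c :* y) := b :* (a :* x) :+ c :* (a :* b :* y)) refl

  -- Here `r` will be `1# - q ^ suc n` and `a` will be `q ^ n`, so that `r + q * a` collapses to 1.
  -- With the difference hidden in `r`, this is an identity in a commutative semiring.
  collect : ∀ q a m k x y r →
    r * (k + q * m * x) + q * a * (k + m * y) ≈ (r + q * a) * k + q * m * (r * x + a * y)
  collect = solve 7 (λ q a m k x y r →
    r :* (k :+ q :* m :* x) :+ q :* a :* (k :+ m :* y) :=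
      (r :+ q :* a) :* k :+ q :* m :* (r :* x :+ a :* y)) refl

  scale : ∀ q a k m h → q * a * (k + m * h) ≈ q * a * k + q * m * (a * h)
  scale = solve 5 (λ q a k m h → q :* a :* (k :+ m :* h) := q :* a :* k :+ q :* m :* (a :* h)) refl

  regroup-boundary : ∀ a b s w d → a * (b * s) * w * d ≈ (b * d) * s * (w * a)
  regroup-boundary = solve 5 (λ a b s w d → a :* (b :* s) :* w :* d := (b :* d) :* s :* (w :* a)) refl

-- P-partitions

chain : ∀ {A : Set} {n} → (A → A → Bool) → Vec A n → Bool
chain C []          = true
chain C (a ∷ [])    = true
chain C (a ∷ b ∷ v) = C a b ∧ chain C (b ∷ v)

-- db p p′ asks for a strict ascent with respect to lt.
compatible : {P : Set} → (ℕ → ℕ → Bool) → (P → P → Bool) → P × ℕ → P × ℕ → Bool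
compatible lt db (p , a) (p′ , a′) = if db p p′ then lt a a′ else not (lt a′ a)

-- A descent is weighted by the number of entries after it, which is n - i for a descent at position
-- i of n.
comajor : ∀ {P : Set} {n} → (P → P → Bool) → Vec P n → ℕ
comajor db []                    = 0
comajor db (p ∷ [])              = 0
comajor db (_∷_ {suc n} p (p′ ∷ ps)) = (if db p p′ then suc n else 0) ℕ.+ comajor db (p′ ∷ ps)

module PPartitions (R : CommutativeRing 0ℓ 0ℓ) (q : CommutativeRing.Carrier R) where
  open CommutativeRing R
  open SetoidReasoning setoid
  open FiniteSums R
  open import Algebra.Properties.Semiring.Exp semiring public using (_^_; ^-homo-*)
  open import Algebra.Properties.CommutativeSemigroup *-commutativeSemigroup using (x∙yz≈y∙xz)
  open RingIdentities R

  qPoch : ℕ → Carrier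
  qPoch zero    = 1#
  qPoch (suc n) = qPoch n * (1# - q ^ suc n)

  x-y+y≈x : ∀ x y → (x - y) + y ≈ x
  x-y+y≈x x y = trans (+-assoc _ _ _) (trans (+-congˡ (-‿inverseˡ y)) (+-identityʳ x))

  -- For the case `M = 0` of `qPoch-F`: modulo `q ^ 0` everything is congruent, and the error is the
  -- whole difference.
  modulo-1 : ∀ x y → y ≈ x + 1# * (y - x)
  modulo-1 x y = sym (trans (+-congˡ (*-identityˡ _)) (trans (+-comm _ _) (x-y+y≈x y x)))

  []-∧-* : ∀ b c x y → [ b ∧ c ] (x * y) ≈ [ b ] (x * [ c ] y)
  []-∧-* true  true  x y = refl
  []-∧-* true  false x y = sym (zeroʳ x)
  []-∧-* false c     x y = refl

  module _ {P : Set} (db : P → P → Bool) where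
    private
      C = compatible _<ᵇ_ db

    F : ∀ {n} → ℕ → Vec P n → Carrier
    F {n} M ps = ∑ᴿ (vecs (upTo M) n) λ v → [ chain C (zip ps v) ] q ^ Vec.sum v

    -- The part of F M (p ∷ ps) with first value a, divided by q ^ a.
    Fᶠ : ∀ {n} → ℕ → ℕ → P → Vec P n → Carrier
    Fᶠ {n} M a p ps = ∑ᴿ (vecs (upTo M) n) λ v → [ chain C ((p , a) ∷ zip ps v) ] q ^ Vec.sum v

    F-cons : ∀ {n} M p (ps : Vec P n) → F M (p ∷ ps) ≈ ∑ᴿ (upTo M) λ a → q ^ a * Fᶠ M a p ps
    F-cons {n} M p ps = trans (∑-vecs (upTo M) n _) (∑-cong (upTo M) λ a →
      trans (∑-cong (vecs (upTo M) n) λ v → trans ([]-cong _ (^-homo-* q a (Vec.sum v))) (sym (*-[] _ _ _)))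
            (sym (*-∑ (vecs (upTo M) n) _ _)))

    Fᶠ-cons : ∀ {n} M a p p′ (ps : Vec P n) →
      Fᶠ M a p (p′ ∷ ps) ≈ ∑ᴿ (upTo M) λ b → [ C (p , a) (p′ , b) ] (q ^ b * Fᶠ M b p′ ps)
    Fᶠ-cons {n} M a p p′ ps = trans (∑-vecs (upTo M) n _) (∑-cong (upTo M) λ b →
      trans (∑-cong (vecs (upTo M) n) λ v → trans ([]-cong _ (^-homo-* q b (Vec.sum v))) ([]-∧-* (C (p , a) (p′ , b)) _ _ _))
            (trans (sym ([]-∑ (C (p , a) (p′ , b)) (vecs (upTo M) n) _)) ([]-cong (C (p , a) (p′ , b)) (sym (*-∑ (vecs (upTo M) n) _ _)))))

    -- The values increase weakly, so after a positive first value all `n` later values are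
    -- positive, and lowering them by 1 divides their monomial by `q ^ n`.
    Fᶠ-shift : ∀ {n} M a p (ps : Vec P n) → Fᶠ (suc M) (suc a) p ps ≈ q ^ n * Fᶠ M a p ps
    Fᶠ-shift M a p []        = sym (*-identityˡ _)
    Fᶠ-shift {suc n} M a p (p′ ∷ ps) = begin
      Fᶠ (suc M) (suc a) p (p′ ∷ ps)
        ≈⟨ Fᶠ-cons (suc M) (suc a) p p′ ps ⟩
      _
        ≈⟨ ∑-upTo M _ ⟩
      [ C (p , suc a) (p′ , 0) ] (q ^ 0 * Fᶠ (suc M) 0 p′ ps)
        + ∑ᴿ (upTo M) (λ b → [ C (p , suc a) (p′ , suc b) ] (q ^ suc b * Fᶠ (suc M) (suc b) p′ ps))
        ≈⟨ +-cong (reflexive first) (∑-cong (upTo M) step) ⟩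
      0# + ∑ᴿ (upTo M) (λ b → q ^ suc n * [ C (p , a) (p′ , b) ] (q ^ b * Fᶠ M b p′ ps))
        ≈⟨ +-identityˡ _ ⟩
      _
        ≈⟨ *-∑ (upTo M) _ _ ⟨
      _
        ≈⟨ *-congˡ (Fᶠ-cons M a p p′ ps) ⟨
      q ^ suc n * Fᶠ M a p (p′ ∷ ps) ∎
      where
      first : [ C (p , suc a) (p′ , 0) ] (q ^ 0 * Fᶠ (suc M) 0 p′ ps) ≡ 0#
      first with db p p′
      ... | true  = ≡.refl
      ... | false = ≡.refl
      step : ∀ b → [ C (p , suc a) (p′ , suc b) ] (q ^ suc b * Fᶠ (suc M) (suc b) p′ ps)
                 ≈ q ^ suc n * [ C (p , a) (p′ , b) ] (q ^ b * Fᶠ M b p′ ps)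
      step b = trans ([]-cong (C (p , a) (p′ , b)) (trans (*-congˡ (Fᶠ-shift M b p′ ps)) (qx*yz≈qy*xz q (q ^ b) (q ^ n) _)))
                     (sym (*-[] (C (p , a) (p′ , b)) _ _))

    F-suc : ∀ {n} M p (ps : Vec P n) → F (suc M) (p ∷ ps) ≈ Fᶠ (suc M) 0 p ps + q ^ suc n * F M (p ∷ ps)
    F-suc {n} M p ps = begin
      F (suc M) (p ∷ ps)
        ≈⟨ F-cons (suc M) p ps ⟩
      _
        ≈⟨ ∑-upTo M _ ⟩
      1# * Fᶠ (suc M) 0 p ps + ∑ᴿ (upTo M) (λ a → q ^ suc a * Fᶠ (suc M) (suc a) p ps)
        ≈⟨ +-cong (*-identityˡ _) (∑-cong (upTo M) λ a → trans (*-congˡ (Fᶠ-shift M a p ps)) (qx*yz≈qy*xz q (q ^ a) (q ^ n) _)) ⟩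
      Fᶠ (suc M) 0 p ps + ∑ᴿ (upTo M) (λ a → q ^ suc n * (q ^ a * Fᶠ M a p ps))
        ≈⟨ +-congˡ (*-∑ (upTo M) _ _) ⟨
      _
        ≈⟨ +-congˡ (*-congˡ (F-cons M p ps)) ⟨
      Fᶠ (suc M) 0 p ps + q ^ suc n * F M (p ∷ ps) ∎

    -- A strict ascent from the value 0 makes the remaining `suc n` values positive. Lowering them
    -- by 1 costs `q ^ suc n`, just the contribution of this descent to `comajor`.
    Fᶠ-zero-strict : ∀ {n} M p p′ (ps : Vec P n) → db p p′ ≡ true →
      Fᶠ (suc M) 0 p (p′ ∷ ps) ≈ q ^ suc n * F M (p′ ∷ ps)
    Fᶠ-zero-strict {n} M p p′ ps eq = begin
      Fᶠ (suc M) 0 p (p′ ∷ ps)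
        ≈⟨ Fᶠ-cons (suc M) 0 p p′ ps ⟩
      _
        ≈⟨ ∑-cong (upTo (suc M)) (λ b → reflexive (≡.cong (λ d → [ if d then 0 <ᵇ b else not (b <ᵇ 0) ] (q ^ b * Fᶠ (suc M) b p′ ps)) eq)) ⟩
      ∑ᴿ (upTo (suc M)) (λ b → [ 0 <ᵇ b ] (q ^ b * Fᶠ (suc M) b p′ ps))
        ≈⟨ ∑-upTo M _ ⟩
      0# + ∑ᴿ (upTo M) (λ b → q ^ suc b * Fᶠ (suc M) (suc b) p′ ps)
        ≈⟨ +-identityˡ _ ⟩
      _
        ≈⟨ ∑-cong (upTo M) (λ b → trans (*-congˡ (Fᶠ-shift M b p′ ps)) (qx*yz≈qy*xz q (q ^ b) (q ^ n) _)) ⟩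
      _
        ≈⟨ *-∑ (upTo M) _ _ ⟨
      _
        ≈⟨ *-congˡ (F-cons M p′ ps) ⟨
      q ^ suc n * F M (p′ ∷ ps) ∎

    Fᶠ-zero-weak : ∀ {n} M p p′ (ps : Vec P n) → db p p′ ≡ false → Fᶠ M 0 p (p′ ∷ ps) ≈ F M (p′ ∷ ps)
    Fᶠ-zero-weak {n} M p p′ ps eq = trans (Fᶠ-cons M 0 p p′ ps)
      (trans (∑-cong (upTo M) (λ b → reflexive (≡.cong (λ d → [ if d then 0 <ᵇ b else not (b <ᵇ 0) ] (q ^ b * Fᶠ M b p′ ps)) eq)))
             (sym (F-cons M p′ ps)))

    private
      -- After a strict ascent from 0 the remaining values are lowered by 1, hence the assumption
      -- with bound `M`. In `qPoch-weak` they stay as they are, and the bound is `suc M`.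
      qPoch-strict : ∀ M {n} p p′ (ps : Vec P n) h → db p p′ ≡ true →
        qPoch (suc n) * F M (p′ ∷ ps) ≈ q ^ comajor db (p′ ∷ ps) + q ^ M * h →
        qPoch (suc n) * Fᶠ (suc M) 0 p (p′ ∷ ps)
          ≈ q ^ comajor db (p ∷ p′ ∷ ps) + q ^ suc M * (q ^ n * h)
      qPoch-strict M {n} p p′ ps h eq e = begin
        qPoch (suc n) * Fᶠ (suc M) 0 p (p′ ∷ ps)
          ≈⟨ *-congˡ (Fᶠ-zero-strict M p p′ ps eq) ⟩
        qPoch (suc n) * (q ^ suc n * F M (p′ ∷ ps))
          ≈⟨ x∙yz≈y∙xz _ _ _ ⟩
        q ^ suc n * (qPoch (suc n) * F M (p′ ∷ ps))
          ≈⟨ *-congˡ e ⟩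
        q * q ^ n * (q ^ comajor db (p′ ∷ ps) + q ^ M * h)
          ≈⟨ scale q (q ^ n) _ (q ^ M) h ⟩
        q * q ^ n * q ^ comajor db (p′ ∷ ps) + q * q ^ M * (q ^ n * h)
          ≈⟨ +-congʳ (^-homo-* q (suc n) (comajor db (p′ ∷ ps))) ⟨
        q ^ (suc n ℕ.+ comajor db (p′ ∷ ps)) + q ^ suc M * (q ^ n * h)
          ≈⟨ +-congʳ (reflexive (≡.cong (λ b → q ^ ((if b then suc n else 0) ℕ.+ comajor db (p′ ∷ ps))) eq)) ⟨
        q ^ comajor db (p ∷ p′ ∷ ps) + q ^ suc M * (q ^ n * h) ∎

      qPoch-weak : ∀ M {n} p p′ (ps : Vec P n) h → db p p′ ≡ false →
        qPoch (suc n) * F (suc M) (p′ ∷ ps) ≈ q ^ comajor db (p′ ∷ ps) + q ^ suc M * h →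
        qPoch (suc n) * Fᶠ (suc M) 0 p (p′ ∷ ps) ≈ q ^ comajor db (p ∷ p′ ∷ ps) + q ^ suc M * h
      qPoch-weak M {n} p p′ ps h eq e = trans (*-congˡ (Fᶠ-zero-weak (suc M) p p′ ps eq)) (trans e
        (+-congʳ (reflexive (≡.sym (≡.cong (λ b → q ^ ((if b then suc n else 0) ℕ.+ comajor db (p′ ∷ ps))) eq)))))

    private
      -- After `F-suc` is multiplied by `qPoch (suc n)`, both parts have the same main term, with
      -- the coefficients `1# - q ^ suc n` and `q ^ suc n`, which add up to 1.
      combine : ∀ M {n} p (ps : Vec P n) h₁ h₂ →
        qPoch n * Fᶠ (suc M) 0 p ps ≈ q ^ comajor db (p ∷ ps) + q ^ suc M * h₁ →
        qPoch (suc n) * F M (p ∷ ps) ≈ q ^ comajor db (p ∷ ps) + q ^ M * h₂ →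
        qPoch (suc n) * F (suc M) (p ∷ ps)
          ≈ q ^ comajor db (p ∷ ps) + q ^ suc M * ((1# - q ^ suc n) * h₁ + q ^ n * h₂)
      combine M {n} p ps h₁ h₂ e₁ e₂ = begin
        qPoch n * r * F (suc M) (p ∷ ps)
          ≈⟨ *-congˡ (F-suc M p ps) ⟩
        qPoch n * r * (Fᶠ (suc M) 0 p ps + q ^ suc n * F M (p ∷ ps))
          ≈⟨ distribute (qPoch n) r _ (q ^ suc n) _ ⟩
        r * (qPoch n * Fᶠ (suc M) 0 p ps) + q ^ suc n * (qPoch (suc n) * F M (p ∷ ps))
          ≈⟨ +-cong (*-congˡ e₁) (*-congˡ e₂) ⟩
        r * (K + q * q ^ M * h₁) + q * q ^ n * (K + q ^ M * h₂)
          ≈⟨ collect q (q ^ n) (q ^ M) K h₁ h₂ r ⟩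
        (r + q * q ^ n) * K + q * q ^ M * (r * h₁ + q ^ n * h₂)
          ≈⟨ +-congʳ (trans (*-congʳ (x-y+y≈x 1# (q ^ suc n))) (*-identityˡ K)) ⟩
        K + q * q ^ M * (r * h₁ + q ^ n * h₂) ∎
        where
        K = q ^ comajor db (p ∷ ps)
        r = 1# - q ^ suc n

    -- Lowering all values by 1 if none is 0 relates F (suc M) to F M.  As the
    -- values are bounded by M, the formula only holds modulo q ^ M.
    qPoch-F : ∀ M {n} (ps : Vec P n) → ∃[ h ] qPoch n * F M ps ≈ q ^ comajor db ps + q ^ M * h
    qPoch-Fᶠ : ∀ M {n} p (ps : Vec P n) →
      ∃[ h ] qPoch n * Fᶠ (suc M) 0 p ps ≈ q ^ comajor db (p ∷ ps) + q ^ suc M * h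

    qPoch-F M [] = 0# , trans (*-cong refl (+-identityʳ _)) (trans (*-identityʳ _)
      (sym (trans (+-congˡ (zeroʳ _)) (+-identityʳ _))))
    qPoch-F zero {n} (p ∷ ps) = _ , modulo-1 (q ^ comajor db (p ∷ ps)) (qPoch n * F 0 (p ∷ ps))
    qPoch-F (suc M) (p ∷ ps) = _ , combine M p ps _ _ (proj₂ (qPoch-Fᶠ M p ps)) (proj₂ (qPoch-F M (p ∷ ps)))

    qPoch-Fᶠ M p [] = 0# , trans (*-congˡ (+-identityʳ _)) (trans (*-identityʳ _)
      (sym (trans (+-congˡ (zeroʳ _)) (+-identityʳ _))))
    qPoch-Fᶠ M {suc n} p (p′ ∷ ps) =
      split (db p p′) ≡.refl (qPoch-F M (p′ ∷ ps)) (qPoch-F (suc M) (p′ ∷ ps))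
      where
      split : ∀ b → db p p′ ≡ b →
        (∃[ h ] qPoch (suc n) * F M (p′ ∷ ps) ≈ q ^ comajor db (p′ ∷ ps) + q ^ M * h) →
        (∃[ h ] qPoch (suc n) * F (suc M) (p′ ∷ ps) ≈ q ^ comajor db (p′ ∷ ps) + q ^ suc M * h) →
        ∃[ h ] qPoch (suc n) * Fᶠ (suc M) 0 p (p′ ∷ ps) ≈ q ^ comajor db (p ∷ p′ ∷ ps) + q ^ suc M * h
      split true  eq (h , e) _       = _ , qPoch-strict M p p′ ps h eq e
      split false eq _       (h , e) = _ , qPoch-weak M p p′ ps h eq e

-- Reversal of words: from the comajor to the major index

module ReversedVectors where
  open import Data.Nat using (_+_)
  open import Data.Nat.Properties using (+-identityʳ)
  open ≡ using (refl; sym; trans; cong; cong₂)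
  open ≡.≡-Reasoning
  open +-*-Solver using (solve; _:=_; _:+_; con)

  -- Prepending an entry moves every later descent one position to the right, so the number of
  -- descents has to be carried along with their sum.
  descents major : ∀ {P : Set} {n} → (P → P → Bool) → Vec P n → ℕ
  descents db []            = 0
  descents db (p ∷ [])      = 0
  descents db (p ∷ p′ ∷ ps) = (if db p p′ then 1 else 0) + descents db (p′ ∷ ps)

  major db []            = 0
  major db (p ∷ [])      = 0
  major db (p ∷ p′ ∷ ps) = (if db p p′ then 1 else 0) + descents db (p′ ∷ ps) + major db (p′ ∷ ps)

  if-suc : ∀ b m → (if b then suc m else 0) ≡ (if b then 1 else 0) + (if b then m else 0)
  if-suc true  m = refl
  if-suc false m = refl

  zip-∷ʳ : ∀ {A B : Set} {n} (v : Vec A n) (w : Vec B n) a b → zip (v ∷ʳ a) (w ∷ʳ b) ≡ zip v w ∷ʳ (a , b)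
  zip-∷ʳ []      []      a b = refl
  zip-∷ʳ (x ∷ v) (y ∷ w) a b = cong ((x , y) ∷_) (zip-∷ʳ v w a b)

  zip-reverse : ∀ {A B : Set} {n} (v : Vec A n) (w : Vec B n) → zip (reverse v) (reverse w) ≡ reverse (zip v w)
  zip-reverse []      []      = refl
  zip-reverse (x ∷ v) (y ∷ w) = trans (cong₂ zip (reverse-∷ x v) (reverse-∷ y w))
    (trans (zip-∷ʳ (reverse v) (reverse w) x y)
    (trans (cong (_∷ʳ (x , y)) (zip-reverse v w)) (sym (reverse-∷ (x , y) (zip v w)))))

  sum-∷ʳ : ∀ {n} (v : Vec ℕ n) a → Vec.sum (v ∷ʳ a) ≡ a + Vec.sum v
  sum-∷ʳ []      a = refl
  sum-∷ʳ (x ∷ v) a = trans (cong (x +_) (sum-∷ʳ v a))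
    (solve 3 (λ m n o → m :+ (n :+ o) := n :+ (m :+ o)) refl x a (Vec.sum v))

  sum-reverse : ∀ {n} (v : Vec ℕ n) → Vec.sum (reverse v) ≡ Vec.sum v
  sum-reverse []      = refl
  sum-reverse (x ∷ v) = trans (cong Vec.sum (reverse-∷ x v)) (trans (sum-∷ʳ (reverse v) x) (cong (x +_) (sum-reverse v)))

  module _ {A : Set} (C : A → A → Bool) where

    chain-∷ʳ : ∀ {n} (v : Vec A n) b a → chain C ((v ∷ʳ b) ∷ʳ a) ≡ chain C (v ∷ʳ b) ∧ C b a
    chain-∷ʳ []          b a = ∧-identityʳ _
    chain-∷ʳ (x ∷ [])    b a = trans (cong (C x b ∧_) (∧-identityʳ _)) (cong (_∧ C b a) (sym (∧-identityʳ _)))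
    chain-∷ʳ (x ∷ y ∷ v) b a = trans (cong (C x y ∧_) (chain-∷ʳ (y ∷ v) b a)) (sym (∧-assoc (C x y) _ _))

    descents-∷ʳ : ∀ {n} (v : Vec A n) b a →
      descents C ((v ∷ʳ b) ∷ʳ a) ≡ (if C b a then 1 else 0) + descents C (v ∷ʳ b)
    descents-∷ʳ []          b a = refl
    descents-∷ʳ (x ∷ [])    b a = solve 2 (λ m n → m :+ (n :+ con 0) := n :+ (m :+ con 0)) refl
      (if C x b then 1 else 0) (if C b a then 1 else 0)
    descents-∷ʳ (x ∷ y ∷ v) b a = trans (cong ((if C x y then 1 else 0) +_) (descents-∷ʳ (y ∷ v) b a))
      (solve 3 (λ m n o → m :+ (n :+ o) := n :+ (m :+ o)) refl
        (if C x y then 1 else 0) (if C b a then 1 else 0) (descents C ((y ∷ v) ∷ʳ b)))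

    -- An appended entry comes after every earlier descent and adds 1 to the weight of each. This is
    -- the recursion of `major`, run from the other end.
    comajor-∷ʳ : ∀ {n} (v : Vec A n) b a →
      comajor C ((v ∷ʳ b) ∷ʳ a) ≡ (if C b a then 1 else 0) + descents C (v ∷ʳ b) + comajor C (v ∷ʳ b)
    comajor-∷ʳ {n} []           b a = trans (+-identityʳ _) (sym (trans (+-identityʳ _) (+-identityʳ _)))
    comajor-∷ʳ {suc zero} (x ∷ []) b a = trans (cong (_+ _) (if-suc (C x b) 1))
      (solve 2 (λ m n → m :+ m :+ (n :+ con 0) := n :+ (m :+ con 0) :+ (m :+ con 0)) refl
        (if C x b then 1 else 0) (if C b a then 1 else 0))
    comajor-∷ʳ {suc (suc n)} (x ∷ y ∷ v) b a =
      trans (cong₂ _+_ (if-suc (C x y) (suc (suc n))) (comajor-∷ʳ (y ∷ v) b a))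
        (solve 5 (λ m l i d c → m :+ l :+ (i :+ d :+ c) := i :+ (m :+ d) :+ (l :+ c)) refl
          (if C x y then 1 else 0) (if C x y then suc (suc n) else 0) (if C b a then 1 else 0)
          (descents C ((y ∷ v) ∷ʳ b)) (comajor C ((y ∷ v) ∷ʳ b)))

  module _ {A : Set} (C : A → A → Bool) where

    chain-reverse : ∀ {n} (v : Vec A n) → chain (flip C) (reverse v) ≡ chain C v
    chain-reverse []          = refl
    chain-reverse (a ∷ [])    = refl
    chain-reverse (a ∷ b ∷ v) = begin
      chain (flip C) (reverse (a ∷ b ∷ v))
        ≡⟨ cong (chain (flip C)) (trans (reverse-∷ a (b ∷ v)) (cong (_∷ʳ a) (reverse-∷ b v))) ⟩
      chain (flip C) ((reverse v ∷ʳ b) ∷ʳ a)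
        ≡⟨ chain-∷ʳ (flip C) (reverse v) b a ⟩
      chain (flip C) (reverse v ∷ʳ b) ∧ C a b
        ≡⟨ cong (λ w → chain (flip C) w ∧ C a b) (reverse-∷ b v) ⟨
      chain (flip C) (reverse (b ∷ v)) ∧ C a b
        ≡⟨ ∧-comm _ (C a b) ⟩
      C a b ∧ chain (flip C) (reverse (b ∷ v))
        ≡⟨ cong (C a b ∧_) (chain-reverse (b ∷ v)) ⟩
      chain C (a ∷ b ∷ v) ∎

    descents-reverse : ∀ {n} (v : Vec A n) → descents (flip C) (reverse v) ≡ descents C v
    descents-reverse []          = refl
    descents-reverse (a ∷ [])    = refl
    descents-reverse (a ∷ b ∷ v) = begin
      descents (flip C) (reverse (a ∷ b ∷ v))
        ≡⟨ cong (descents (flip C)) (trans (reverse-∷ a (b ∷ v)) (cong (_∷ʳ a) (reverse-∷ b v))) ⟩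
      descents (flip C) ((reverse v ∷ʳ b) ∷ʳ a)
        ≡⟨ descents-∷ʳ (flip C) (reverse v) b a ⟩
      (if C a b then 1 else 0) + descents (flip C) (reverse v ∷ʳ b)
        ≡⟨ cong (λ w → (if C a b then 1 else 0) + descents (flip C) w) (reverse-∷ b v) ⟨
      (if C a b then 1 else 0) + descents (flip C) (reverse (b ∷ v))
        ≡⟨ cong ((if C a b then 1 else 0) +_) (descents-reverse (b ∷ v)) ⟩
      descents C (a ∷ b ∷ v) ∎

    -- The number of entries after a descent in the reversed word is its position in the original
    -- word.
    comajor-reverse : ∀ {n} (v : Vec A n) → comajor (flip C) (reverse v) ≡ major C v
    comajor-reverse []          = refl
    comajor-reverse (a ∷ [])    = refl
    comajor-reverse (a ∷ b ∷ v) = begin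
      comajor (flip C) (reverse (a ∷ b ∷ v))
        ≡⟨ cong (comajor (flip C)) (trans (reverse-∷ a (b ∷ v)) (cong (_∷ʳ a) (reverse-∷ b v))) ⟩
      comajor (flip C) ((reverse v ∷ʳ b) ∷ʳ a)
        ≡⟨ comajor-∷ʳ (flip C) (reverse v) b a ⟩
      (if C a b then 1 else 0) + descents (flip C) (reverse v ∷ʳ b) + comajor (flip C) (reverse v ∷ʳ b)
        ≡⟨ cong (λ w → (if C a b then 1 else 0) + descents (flip C) w + comajor (flip C) w) (reverse-∷ b v) ⟨
      (if C a b then 1 else 0) + descents (flip C) (reverse (b ∷ v)) + comajor (flip C) (reverse (b ∷ v))
        ≡⟨ cong₂ (λ d m → (if C a b then 1 else 0) + d + m) (descents-reverse (b ∷ v)) (comajor-reverse (b ∷ v)) ⟩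
      major C (a ∷ b ∷ v) ∎

  chain-cong : ∀ {A : Set} {C D : A → A → Bool} → (∀ a b → C a b ≡ D a b) → ∀ {n} (v : Vec A n) → chain C v ≡ chain D v
  chain-cong C≡D []          = refl
  chain-cong C≡D (a ∷ [])    = refl
  chain-cong C≡D (a ∷ b ∷ v) = cong₂ _∧_ (C≡D a b) (chain-cong C≡D (b ∷ v))

open ReversedVectors

module Reversal (R : CommutativeRing 0ℓ 0ℓ) where
  open CommutativeRing R
  open FiniteSums R

  ∑-vecs-∷ʳ : ∀ {I : Set} (as : List I) n (f : Vec I (suc n) → Carrier) →
    ∑ᴿ (vecs as (suc n)) f ≈ ∑ᴿ as (λ a → ∑ᴿ (vecs as n) (λ v → f (v ∷ʳ a)))
  ∑-vecs-∷ʳ as zero    f = ∑-vecs as 0 f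
  ∑-vecs-∷ʳ as (suc n) f = trans (∑-vecs as (suc n) f)
    (trans (∑-cong as λ a → ∑-vecs-∷ʳ as n _)
    (trans (∑-swap as as _) (∑-cong as λ b → sym (∑-vecs as n _))))

  ∑-reverse : ∀ {I : Set} (as : List I) n (f : Vec I n → Carrier) →
    ∑ᴿ (vecs as n) (λ v → f (reverse v)) ≈ ∑ᴿ (vecs as n) f
  ∑-reverse as zero    f = refl
  ∑-reverse as (suc n) f = trans (∑-vecs as n _)
    (trans (∑-cong as λ a → trans (∑-cong (vecs as n) λ v → reflexive (≡.cong f (reverse-∷ a v)))
                                       (∑-reverse as n (λ v → f (v ∷ʳ a))))
             (sym (∑-vecs-∷ʳ as n f)))

module DecreasingPPartitions (R : CommutativeRing 0ℓ 0ℓ) (q : CommutativeRing.Carrier R) where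
  open CommutativeRing R
  open FiniteSums R
  open Reversal R
  open PPartitions R q
  module _ {P : Set} (db : P → P → Bool) where

    F⁻ : ∀ {n} → ℕ → Vec P n → Carrier
    F⁻ {n} M ps = ∑ᴿ (vecs (upTo M) n) λ v → [ chain (compatible (flip _<ᵇ_) db) (zip ps v) ] q ^ Vec.sum v

    -- Read backwards, decreasing values increase. Swapping the two arguments of
    -- `compatible (flip _<ᵇ_) db` yields `compatible _<ᵇ_ (flip db)` by definition, so
    -- `chain-reverse` applies directly.
    F⁻-reverse : ∀ {n} M (ps : Vec P n) → F⁻ M ps ≈ F (flip db) M (reverse ps)
    F⁻-reverse {n} M ps = trans (∑-cong (vecs (upTo M) n) λ v → reflexive (≡.sym (≡.cong₂ (λ b k → [ b ] q ^ k)
        (≡.trans (≡.cong (chain (compatible _<ᵇ_ (flip db))) (zip-reverse ps v))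
          (chain-reverse (compatible (flip _<ᵇ_) db) (zip ps v)))
        (sum-reverse v))))
      (∑-reverse (upTo M) n λ v → [ chain (compatible _<ᵇ_ (flip db)) (zip (reverse ps) v) ] q ^ Vec.sum v)

    qPoch-F⁻ : ∀ M {n} (ps : Vec P n) → ∃[ h ] qPoch n * F⁻ M ps ≈ q ^ major db ps + q ^ M * h
    qPoch-F⁻ M ps = proj₁ r , trans (*-congˡ (F⁻-reverse M ps))
        (trans (proj₂ r) (reflexive (≡.cong (λ k → q ^ k + q ^ M * proj₁ r) (comajor-reverse db ps))))
      where r = qPoch-F (flip db) M (reverse ps)

≤→ᵇ : ∀ {m n} → m ≤ n → (m <ᵇ suc n) ≡ true
≤→ᵇ z≤n       = ≡.refl
≤→ᵇ (s≤s m≤n) = ≤→ᵇ m≤n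

ᵇ→≤ : ∀ m n → (m <ᵇ suc n) ≡ true → m ≤ n
ᵇ→≤ zero    n       e = z≤n
ᵇ→≤ (suc m) (suc n) e = s≤s (ᵇ→≤ m n e)

ᵇ→< : ∀ m n → (m <ᵇ n) ≡ true → m < n
ᵇ→< m (suc n) e = s≤s (ᵇ→≤ m n e)

∧-true : ∀ {b c} → b ∧ c ≡ true → b ≡ true × c ≡ true
∧-true {true} {true} _ = ≡.refl , ≡.refl

true-∧ : ∀ {b c} → b ≡ true → c ≡ true → b ∧ c ≡ true
true-∧ ≡.refl ≡.refl = ≡.refl

true⇔→≡ : ∀ {b c} → (b ≡ true → c ≡ true) → (c ≡ true → b ≡ true) → b ≡ c
true⇔→≡ {true}          f g = ≡.sym (f ≡.refl)
true⇔→≡ {false} {false} f g = ≡.refl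
true⇔→≡ {false} {true}  f g = g ≡.refl

-- Operators on functions of shapes

-- Shapes are the row lengths of a partition, and c bounds the first row;
-- step d r c f μ is f of μ with a cell added in row r, or d if this is not a shape.
step : ∀ {A : Set} {ℓ} → A → Fin ℓ → ℕ → (Vec ℕ ℓ → A) → Vec ℕ ℓ → A
step d zero    c f (m ∷ μ) = if m <ᵇ c then f (suc m ∷ μ) else d
step d (suc r) c f (m ∷ μ) = step d r m (f ∘ (m ∷_)) μ

Valid : ∀ {ℓ} → ℕ → Vec ℕ ℓ → Set
Valid c []      = ⊤
Valid c (m ∷ μ) = m ≤ c × Valid m μ

Valid-≤ : ∀ {ℓ c d} → c ≤ d → (μ : Vec ℕ ℓ) → Valid c μ → Valid d μ
Valid-≤ c≤d []      _           = tt
Valid-≤ c≤d (m ∷ μ) (m≤c , v) = ℕ.≤-trans m≤c c≤d , v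

-- Links the two ways in which the bound is consulted: the test `m <ᵇ c` of `step` and `E`, and the
-- number `c ∸ m` of free cells that drives `geo`.
gap : ∀ c m → (m < c × (m <ᵇ c) ≡ true × c ∸ m ≡ suc (c ∸ suc m)) ⊎ ((m <ᵇ c) ≡ false × c ∸ m ≡ 0)
gap zero    zero    = inj₂ (≡.refl , ≡.refl)
gap zero    (suc m) = inj₂ (≡.refl , ≡.refl)
gap (suc c) zero    = inj₁ (s≤s z≤n , ≡.refl , ≡.refl)
gap (suc c) (suc m) with gap c m
... | inj₁ (l , e , e′) = inj₁ (s≤s l , e , e′)
... | inj₂ e            = inj₂ e

module ShapeOperators (R : CommutativeRing 0ℓ 0ℓ) where
  open CommutativeRing R hiding (zero)
  open SetoidReasoning setoid
  open FiniteSums R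

  -x*y+x*y≈0 : ∀ x y → - x * y + x * y ≈ 0#
  -x*y+x*y≈0 x y = trans (sym (distribʳ y (- x) x)) (trans (*-congʳ (-‿inverseˡ x)) (zeroˡ y))

  -- The sum of `x ^ i * φ (m + i)` over the i from 0 to `g`, in Horner form.
  geo : Carrier → ℕ → (ℕ → Carrier) → ℕ → Carrier
  geo x zero    φ m = φ m
  geo x (suc g) φ m = φ m + x * geo x g φ (suc m)

  -- rep adds any number of cells in row r, non at most one.
  rep non : ∀ {ℓ} → Carrier → Fin ℓ → ℕ → (Vec ℕ ℓ → Carrier) → Vec ℕ ℓ → Carrier
  rep x zero    c f (m ∷ μ) = geo x (c ∸ m) (λ d → f (d ∷ μ)) m
  rep x (suc r) c f (m ∷ μ) = rep x r m (f ∘ (m ∷_)) μ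
  non y r c f μ = f μ + y * step 0# r c f μ

  geo-fix : ∀ x c m φ → geo x (c ∸ m) φ m ≈ φ m + x * [ m <ᵇ c ] geo x (c ∸ suc m) φ (suc m)
  geo-fix x c m φ = by (gap c m)
    where
    by : _ → geo x (c ∸ m) φ m ≈ φ m + x * [ m <ᵇ c ] geo x (c ∸ suc m) φ (suc m)
    by (inj₁ (_ , e , e′)) = reflexive (≡.trans (≡.cong (λ g → geo x g φ m) e′)
      (≡.cong (λ b → φ m + x * [ b ] geo x (c ∸ suc m) φ (suc m)) (≡.sym e)))
    by (inj₂ (e , e′)) = trans (reflexive (≡.cong (λ g → geo x g φ m) e′))
      (sym (trans (+-congˡ (trans (*-congˡ (reflexive (≡.cong (λ b → [ b ] geo x (c ∸ suc m) φ (suc m)) e))) (zeroʳ x))) (+-identityʳ _)))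

  -- If U adds one cell in row `r`, then `non y` is 1 + y U and `rep x` is the geometric series 1 /
  -- (1 - x U), given here by its fixed-point equation. The same equation describes a letter that
  -- may be repeated, see `words-Op`.
  rep-fix : ∀ {ℓ} x (r : Fin ℓ) c f μ → rep x r c f μ ≈ f μ + x * step 0# r c (rep x r c f) μ
  rep-fix x zero    c f (m ∷ μ) = geo-fix x c m (λ d → f (d ∷ μ))
  rep-fix x (suc r) c f (m ∷ μ) = rep-fix x r m (f ∘ (m ∷_)) μ

  non-rep : ∀ {ℓ} x (r : Fin ℓ) c f μ → non (- x) r c (rep x r c f) μ ≈ f μ
  non-rep x r c f μ = begin
    rep x r c f μ + - x * U          ≈⟨ +-congʳ (rep-fix x r c f μ) ⟩
    (f μ + x * U) + - x * U          ≈⟨ +-assoc _ _ _ ⟩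
    f μ + (x * U + - x * U)          ≈⟨ +-congˡ (trans (+-comm _ _) (-x*y+x*y≈0 x U)) ⟩
    f μ + 0#                         ≈⟨ +-identityʳ _ ⟩
    f μ                              ∎
    where U = step 0# r c (rep x r c f) μ

  -- Inversion in the order opposite to `non-rep`. The sum telescopes, and its last term has nothing
  -- to cancel because the bracket vanishes for a full row.
  geo-non : ∀ x c g m (φ : ℕ → Carrier) → c ∸ m ≡ g →
    geo x g (λ d → φ d + - x * [ d <ᵇ c ] φ (suc d)) m ≈ φ m
  geo-non x c g m φ e = by g (gap c m) e
    where
    by : ∀ g → _ → c ∸ m ≡ g → geo x g (λ d → φ d + - x * [ d <ᵇ c ] φ (suc d)) m ≈ φ m
    by zero (inj₁ (_ , _ , e)) e′ = contradiction (≡.trans (≡.sym e) e′) λ ()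
    by zero (inj₂ (e , _)) _ =
      trans (+-congˡ (trans (*-congˡ (reflexive (≡.cong (λ b → [ b ] φ (suc m)) e))) (zeroʳ _))) (+-identityʳ _)
    by (suc g) (inj₂ (_ , e)) e′ = contradiction (≡.trans (≡.sym e′) e) λ ()
    by (suc g) (inj₁ (_ , e , e′)) e″ = begin
      (φ m + - x * [ m <ᵇ c ] φ (suc m)) + x * geo x g _ (suc m)
        ≈⟨ +-cong (+-congˡ (*-congˡ (reflexive (≡.cong (λ b → [ b ] φ (suc m)) e))))
                  (*-congˡ (geo-non x c g (suc m) φ (ℕ.suc-injective (≡.trans (≡.sym e′) e″)))) ⟩
      (φ m + - x * φ (suc m)) + x * φ (suc m)
        ≈⟨ +-assoc _ _ _ ⟩
      φ m + (- x * φ (suc m) + x * φ (suc m))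
        ≈⟨ +-congˡ (-x*y+x*y≈0 x _) ⟩
      φ m + 0#
        ≈⟨ +-identityʳ _ ⟩
      φ m ∎

  -- The rows are filled from the bottom for a horizontal strip (H) and from the
  -- top for a vertical strip (E).
  H E : ∀ {ℓ} → Carrier → ℕ → (Vec ℕ ℓ → Carrier) → Vec ℕ ℓ → Carrier
  H x c f []      = f []
  H x c f (m ∷ μ) = H x m (λ ν → rep x zero c f (m ∷ ν)) μ
  E y c f []      = f []
  E y c f (m ∷ μ) = E y m (f ∘ (m ∷_)) μ + y * [ m <ᵇ c ] E y (suc m) (f ∘ (suc m ∷_)) μ

  geo-cong : ∀ x g {φ ψ} m → (∀ d → m ≤ d → d ≤ g ℕ.+ m → φ d ≈ ψ d) → geo x g φ m ≈ geo x g ψ m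
  geo-cong x zero    m φ≈ψ = φ≈ψ m ℕ.≤-refl ℕ.≤-refl
  geo-cong x (suc g) m φ≈ψ = +-cong (φ≈ψ m ℕ.≤-refl (ℕ.m≤n+m m (suc g)))
    (*-congˡ (geo-cong x g (suc m) λ d m<d d≤ → φ≈ψ d (ℕ.<⇒≤ m<d) (ℕ.≤-trans d≤ (ℕ.≤-reflexive (ℕ.+-suc g m)))))

  -- The laws below are stated for valid shapes. To rewrite under `H` and `E` with them, one needs
  -- that these operators evaluate their argument at valid shapes only.
  H-cong : ∀ {ℓ} x c {f g : Vec ℕ ℓ → Carrier} → (∀ ν → Valid c ν → f ν ≈ g ν) →
    ∀ μ → Valid c μ → H x c f μ ≈ H x c g μ
  H-cong x c f≈g []      v         = f≈g [] v
  H-cong x c f≈g (m ∷ μ) (m≤c , v) = H-cong x m (λ ν w → geo-cong x (c ∸ m) m λ d m≤d d≤ →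
    f≈g (d ∷ ν) (ℕ.≤-trans d≤ (ℕ.≤-reflexive (ℕ.m∸n+n≡m m≤c)) , Valid-≤ m≤d ν w)) μ v

  []-cong-on : ∀ b {x y} → (b ≡ true → x ≈ y) → [ b ] x ≈ [ b ] y
  []-cong-on true  x≈y = x≈y ≡.refl
  []-cong-on false x≈y = refl

  E-cong : ∀ {ℓ} y c {f g : Vec ℕ ℓ → Carrier} → (∀ ν → Valid c ν → f ν ≈ g ν) →
    ∀ μ → Valid c μ → E y c f μ ≈ E y c g μ
  E-cong y c f≈g []      v         = f≈g [] v
  E-cong y c f≈g (m ∷ μ) (m≤c , v) = +-cong (E-cong y m (λ ν w → f≈g (m ∷ ν) (m≤c , w)) μ v)
    (*-congˡ ([]-cong-on (m <ᵇ c) λ e →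
      E-cong y (suc m) (λ ν w → f≈g (suc m ∷ ν) (ᵇ→< m c e , w)) μ (Valid-≤ (ℕ.n≤1+n m) μ v)))

  -- The induction cancels the lower rows, once for each of the two lengths that `E` can give to the
  -- first row; `non-rep` then cancels the first row.
  E-H : ∀ {ℓ} x c (f : Vec ℕ ℓ → Carrier) μ → Valid c μ → E (- x) c (H x c f) μ ≈ f μ
  E-H x c f []      v         = refl
  E-H x c f (m ∷ μ) (m≤c , v) = trans
    (+-cong (E-H x m _ μ v) (*-congˡ ([]-cong (m <ᵇ c) (E-H x (suc m) _ μ (Valid-≤ (ℕ.n≤1+n m) μ v)))))
    (non-rep x zero c f (m ∷ μ))

  -- In this order the first row cancels before the others, by `geo-non`.
  H-E : ∀ {ℓ} x c (f : Vec ℕ ℓ → Carrier) μ → Valid c μ → H x c (E (- x) c f) μ ≈ f μ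
  H-E x c f []      v         = refl
  H-E x c f (m ∷ μ) (m≤c , v) = trans
    (H-cong x m (λ ν w → geo-non x c (c ∸ m) m (λ d → E (- x) d (f ∘ (d ∷_)) ν) ≡.refl) μ v)
    (H-E x m (f ∘ (m ∷_)) μ v)

-- Commutation of the strip operators

between : ℕ → ℕ → ℕ → Bool
between m n c = (m <ᵇ suc n) ∧ (n <ᵇ suc c)

between-≤ : ∀ m n c → between m n c ≡ true → m ≤ n × n ≤ c
between-≤ m n c e = ᵇ→≤ m n (proj₁ (∧-true e)) , ᵇ→≤ n c (proj₂ (∧-true {m <ᵇ suc n} e))

≤-between : ∀ {m n c} → m ≤ n → n ≤ c → between m n c ≡ true
≤-between m≤n n≤c = true-∧ (≤→ᵇ m≤n) (≤→ᵇ n≤c)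

-- The value 0 for no rows stands for the empty row below the last one.
top : ∀ {ℓ} → Vec ℕ ℓ → ℕ
top []      = 0
top (r ∷ ρ) = r

module Commutation (R : CommutativeRing 0ℓ 0ℓ) where
  open CommutativeRing R hiding (zero)
  open SetoidReasoning setoid
  open FiniteSums R
  open PowerSeries R using (conv; conv-comm; conv-scale)
  open RingIdentities R
  open ShapeOperators R
  open import Algebra.Properties.Semiring.Exp semiring using (_^_; ^-homo-*)
  open import Algebra.Properties.CommutativeSemigroup *-commutativeSemigroup using (x∙yz≈y∙xz; interchange)

  geo-shift : ∀ x g φ m → geo x g φ (suc m) ≈ geo x g (φ ∘ suc) m
  geo-shift x zero    φ m = refl
  geo-shift x (suc g) φ m = +-congˡ (*-congˡ (geo-shift x g φ (suc m)))

  -- The range up to `B` does not depend on `m` and `c`; with such a range the sums over the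
  -- different rows can be interchanged.
  geo-∑ : ∀ x B m c (φ : ℕ → Carrier) → m ≤ c → c ≤ B →
    ∑ᴿ (upTo (suc B)) (λ d → [ between m d c ] (x ^ (d ∸ m) * φ d)) ≈ geo x (c ∸ m) φ m
  geo-∑ x B zero zero φ _ _ = trans (∑-upTo B _)
    (trans (+-cong (*-identityˡ _) (∑-zero (upTo B) λ _ → refl)) (+-identityʳ _))
  geo-∑ x (suc B) zero (suc c) φ _ (s≤s c≤B) = trans (∑-upTo (suc B) _) (+-cong (*-identityˡ _)
    (trans (∑-cong (upTo (suc B)) λ d → trans ([]-cong (d <ᵇ suc c) (*-assoc x _ _)) (sym (*-[] (d <ᵇ suc c) x _)))
    (trans (sym (*-∑ (upTo (suc B)) x _))
           (*-congˡ (trans (geo-∑ x B zero c (φ ∘ suc) z≤n c≤B) (sym (geo-shift x c φ 0)))))))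
  geo-∑ x (suc B) (suc m) (suc c) φ (s≤s m≤c) (s≤s c≤B) = trans (∑-upTo (suc B) _)
    (trans (+-identityˡ _) (trans (geo-∑ x B m c (φ ∘ suc) m≤c c≤B) (sym (geo-shift x (c ∸ m) φ m))))

  -- h k is the complete homogeneous symmetric polynomial of degree k in x and y.
  h : Carrier → Carrier → ℕ → Carrier
  h x y = conv (x ^_) (y ^_)

  geo-h : ∀ x y g m → geo x g (λ n → y ^ ((g ℕ.+ m) ∸ n)) m ≈ h x y g
  geo-h x y zero    m = trans (reflexive (≡.cong (y ^_) (ℕ.n∸n≡0 m))) (sym (*-identityˡ 1#))
  geo-h x y (suc g) m = +-cong
    (trans (reflexive (≡.cong (y ^_) (ℕ.m+n∸n≡m (suc g) m))) (sym (*-identityˡ _)))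
    (trans (*-congˡ (trans (geo-cong x g (suc m) λ n _ _ → reflexive (≡.cong (λ k → y ^ (k ∸ n)) (≡.sym (ℕ.+-suc g m))))
                           (geo-h x y g (suc m))))
           (sym (conv-scale x (x ^_) (y ^_) g)))

  module _ (B : ℕ) where

    -- A box that also contains vectors that are no partitions; the brackets in `kernel` give them
    -- the weight 0.
    shapes : ∀ ℓ → List (Vec ℕ ℓ)
    shapes = vecs (upTo (suc B))

    -- The matrix of H x: the rows of μ and ν interlace.
    kernel : ∀ {ℓ} → Carrier → ℕ → Vec ℕ ℓ → Vec ℕ ℓ → Carrier
    kernel x c []      []      = 1#
    kernel x c (m ∷ μ) (d ∷ ν) = [ between m d c ] (x ^ (d ∸ m) * kernel x m μ ν)

    []-* : ∀ b x y → ([ b ] x) * y ≈ [ b ] (x * y)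
    []-* true  x y = refl
    []-* false x y = zeroˡ y

    H-kernel : ∀ {ℓ} x c (f : Vec ℕ ℓ → Carrier) μ → c ≤ B → Valid c μ →
      H x c f μ ≈ ∑ᴿ (shapes ℓ) (λ ν → kernel x c μ ν * f ν)
    H-kernel x c f [] c≤B v = sym (trans (+-identityʳ _) (*-identityˡ _))
    H-kernel {suc ℓ} x c f (m ∷ μ) c≤B (m≤c , v) = begin
      H x m (λ ν → geo x (c ∸ m) (λ d → f (d ∷ ν)) m) μ
        ≈⟨ H-kernel x m _ μ (ℕ.≤-trans m≤c c≤B) v ⟩
      ∑ᴿ (shapes ℓ) (λ ν → kernel x m μ ν * geo x (c ∸ m) (λ d → f (d ∷ ν)) m)
        ≈⟨ ∑-cong (shapes ℓ) (λ ν → *-congˡ (geo-∑ x B m c (λ d → f (d ∷ ν)) m≤c c≤B)) ⟨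
      ∑ᴿ (shapes ℓ) (λ ν → kernel x m μ ν * ∑ᴿ (upTo (suc B)) (λ d → [ between m d c ] (x ^ (d ∸ m) * f (d ∷ ν))))
        ≈⟨ ∑-cong (shapes ℓ) (λ ν → trans (*-∑ (upTo (suc B)) _ _) (∑-cong (upTo (suc B)) (term ν))) ⟩
      ∑ᴿ (shapes ℓ) (λ ν → ∑ᴿ (upTo (suc B)) (λ d → kernel x c (m ∷ μ) (d ∷ ν) * f (d ∷ ν)))
        ≈⟨ ∑-swap (shapes ℓ) (upTo (suc B)) _ ⟩
      ∑ᴿ (upTo (suc B)) (λ d → ∑ᴿ (shapes ℓ) (λ ν → kernel x c (m ∷ μ) (d ∷ ν) * f (d ∷ ν)))
        ≈⟨ ∑-vecs (upTo (suc B)) ℓ _ ⟨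
      ∑ᴿ (shapes (suc ℓ)) (λ ν → kernel x c (m ∷ μ) ν * f ν) ∎
      where
      term : ∀ ν d → kernel x m μ ν * [ between m d c ] (x ^ (d ∸ m) * f (d ∷ ν))
                   ≈ kernel x c (m ∷ μ) (d ∷ ν) * f (d ∷ ν)
      term ν d = trans (*-[] (between m d c) _ _) (trans
        ([]-cong (between m d c) (trans (x∙yz≈y∙xz _ _ _) (sym (*-assoc _ _ _)))) (sym ([]-* (between m d c) _ _)))

    -- Where the matrix entry does not vanish by its brackets, `ν` interlaces with `μ` and is
    -- therefore valid.
    kernel-Valid : ∀ {ℓ} x c (μ ν : Vec ℕ ℓ) {y z} → (Valid c ν → y ≈ z) → kernel x c μ ν * y ≈ kernel x c μ ν * z
    kernel-Valid x c []      []      y≈z = *-congˡ (y≈z tt)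
    kernel-Valid x c (m ∷ μ) (d ∷ ν) y≈z = trans ([]-* (between m d c) _ _) (trans
      ([]-cong-on (between m d c) λ e → let (m≤d , d≤c) = between-≤ m d c e in
        trans (*-assoc _ _ _) (trans (*-congˡ (kernel-Valid x m μ ν λ v → y≈z (d≤c , Valid-≤ m≤d ν v)))
                                     (sym (*-assoc _ _ _))))
      (sym ([]-* (between m d c) _ _)))

    -- The contribution of one row of the intermediate shape, of length `n`, when a row of length
    -- `m` grows to `r`. Here `c` is the row above in the old shape and `p` the row below in the new
    -- one.
    rowSum : Carrier → Carrier → (m c p r : ℕ) → Carrier
    rowSum x y m c p r = ∑ᴿ (upTo (suc B)) λ n → [ between m n c ] [ between p n r ] (x ^ (n ∸ m) * y ^ (r ∸ n))

    rows : ∀ {ℓ} → Carrier → Carrier → ℕ → Vec ℕ ℓ → Vec ℕ ℓ → Carrier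
    rows x y c []      []      = 1#
    rows x y c (m ∷ μ) (r ∷ ρ) = rowSum x y m c (top ρ) r * rows x y m μ ρ

    -- With `μ` and `ρ` fixed, the interlacing conditions bound each row of `ν` separately, so the
    -- sum over `ν` factors. The bounds `a` and `b` differ because further down they are the rows
    -- above in `μ` and in `ν`.
    kernel-kernel : ∀ {ℓ} x y a b (μ ρ : Vec ℕ ℓ) →
      ∑ᴿ (shapes ℓ) (λ ν → kernel x a μ ν * kernel y b ν ρ) ≈ [ top ρ <ᵇ suc b ] rows x y a μ ρ
    kernel-kernel x y a b [] [] = trans (+-identityʳ _) (*-identityˡ _)
    kernel-kernel {suc ℓ} x y a b (m ∷ μ) (r ∷ ρ) = begin
      ∑ᴿ (shapes (suc ℓ)) (λ ν → kernel x a (m ∷ μ) ν * kernel y b ν (r ∷ ρ))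
        ≈⟨ ∑-vecs (upTo (suc B)) ℓ _ ⟩
      ∑ᴿ (upTo (suc B)) (λ n → ∑ᴿ (shapes ℓ) (λ ν → kernel x a (m ∷ μ) (n ∷ ν) * kernel y b (n ∷ ν) (r ∷ ρ)))
        ≈⟨ ∑-cong (upTo (suc B)) (λ n → trans (∑-cong (shapes ℓ) (term n)) (trans (sym (*-∑ (shapes ℓ) _ _))
             (*-congˡ (kernel-kernel x y m n μ ρ)))) ⟩
      ∑ᴿ (upTo (suc B)) (λ n → ([ between m n a ] [ between n r b ] (x ^ (n ∸ m) * y ^ (r ∸ n))) * [ top ρ <ᵇ suc n ] rows x y m μ ρ)
        -- The condition `r ≤ b` does not involve `n` and leaves the sum. The condition `top ρ ≤ n`,
        -- handed up by the rows below, becomes the lower bound in its place.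
        ≈⟨ ∑-cong (upTo (suc B)) (λ n → regroup (m <ᵇ suc n) (n <ᵇ suc a) (n <ᵇ suc r) (r <ᵇ suc b) (top ρ <ᵇ suc n) _ _) ⟩
      ∑ᴿ (upTo (suc B)) (λ n → [ r <ᵇ suc b ] (([ between m n a ] [ between (top ρ) n r ] (x ^ (n ∸ m) * y ^ (r ∸ n))) * rows x y m μ ρ))
        ≈⟨ []-∑ (r <ᵇ suc b) (upTo (suc B)) _ ⟨
      [ r <ᵇ suc b ] ∑ᴿ (upTo (suc B)) (λ n → ([ between m n a ] [ between (top ρ) n r ] (x ^ (n ∸ m) * y ^ (r ∸ n))) * rows x y m μ ρ)
        ≈⟨ []-cong (r <ᵇ suc b) (∑-* (upTo (suc B)) _ _) ⟨
      [ r <ᵇ suc b ] rows x y a (m ∷ μ) (r ∷ ρ) ∎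
      where
      term : ∀ n ν → kernel x a (m ∷ μ) (n ∷ ν) * kernel y b (n ∷ ν) (r ∷ ρ)
           ≈ ([ between m n a ] [ between n r b ] (x ^ (n ∸ m) * y ^ (r ∸ n))) * (kernel x m μ ν * kernel y n ν ρ)
      term n ν = collectTerm (between m n a) (between n r b) _ _ _ _
        where
        collectTerm : ∀ b c p k q l → ([ b ] (p * k)) * ([ c ] (q * l)) ≈ ([ b ] [ c ] (p * q)) * (k * l)
        collectTerm true  true  p k q l = interchange p k q l
        collectTerm true  false p k q l = trans (zeroʳ _) (sym (zeroˡ _))
        collectTerm false c     p k q l = trans (zeroˡ _) (sym (zeroˡ _))
      regroup : ∀ b₁ b₂ b₃ b₄ b₅ u v →
        ([ b₁ ∧ b₂ ] [ b₃ ∧ b₄ ] u) * [ b₅ ] v ≈ [ b₄ ] (([ b₁ ∧ b₂ ] [ b₅ ∧ b₃ ] u) * v)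
      regroup true  true  true  true  true  u v = refl
      regroup true  true  true  true  false u v = trans (zeroʳ _) (sym (zeroˡ _))
      regroup true  true  true  false b₅    u v = zeroˡ _
      regroup true  true  false true  true  u v = trans (zeroˡ _) (sym (zeroˡ _))
      regroup true  true  false true  false u v = trans (zeroˡ _) (sym (zeroˡ _))
      regroup true  true  false false b₅    u v = zeroˡ _
      regroup true  false b₃    true  b₅    u v = trans (zeroˡ _) (sym (zeroˡ _))
      regroup true  false b₃    false b₅    u v = zeroˡ _
      regroup false b₂    b₃    true  b₅    u v = trans (zeroˡ _) (sym (zeroˡ _))
      regroup false b₂    b₃    false b₅    u v = zeroˡ _

    -- Apart from a symmetric factor, rowSum only depends on the two boundary
    -- exponents p ∸ m and r ∸ c; in a product over the rows these telescope.
    rowSum-h : ∀ x y m c p r → c ≤ B → let lo = m ⊔ p ; hi = c ⊓ r in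
      rowSum x y m c p r ≈ x ^ (p ∸ m) * (y ^ (r ∸ c) * [ lo <ᵇ suc hi ] h x y (hi ∸ lo))
    rowSum-h x y m c p r c≤B = begin
      rowSum x y m c p r
        ≈⟨ ∑-cong (upTo (suc B)) term ⟩
      ∑ᴿ (upTo (suc B)) (λ n → x ^ (p ∸ m) * (y ^ (r ∸ c) * [ between lo n hi ] (x ^ (n ∸ lo) * y ^ (hi ∸ n))))
        ≈⟨ *-∑ (upTo (suc B)) _ _ ⟨
      x ^ (p ∸ m) * ∑ᴿ (upTo (suc B)) (λ n → y ^ (r ∸ c) * [ between lo n hi ] (x ^ (n ∸ lo) * y ^ (hi ∸ n)))
        ≈⟨ *-congˡ (*-∑ (upTo (suc B)) _ _) ⟨
      x ^ (p ∸ m) * (y ^ (r ∸ c) * ∑ᴿ (upTo (suc B)) (λ n → [ between lo n hi ] (x ^ (n ∸ lo) * y ^ (hi ∸ n))))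
        ≈⟨ *-congˡ (*-congˡ (range (lo ≤? hi))) ⟩
      x ^ (p ∸ m) * (y ^ (r ∸ c) * [ lo <ᵇ suc hi ] h x y (hi ∸ lo)) ∎
      where
      lo = m ⊔ p
      hi = c ⊓ r
      merge : ∀ n → between m n c ∧ between p n r ≡ between lo n hi
      merge n = true⇔→≡
        (λ e → let (m≤n , n≤c) = between-≤ m n c (proj₁ (∧-true e))
                   (p≤n , n≤r) = between-≤ p n r (proj₂ (∧-true {between m n c} e))
               in ≤-between (ℕ.⊔-lub m≤n p≤n) (ℕ.⊓-glb n≤c n≤r))
        (λ e → let (lo≤n , n≤hi) = between-≤ lo n hi e
               in true-∧ (≤-between (ℕ.m⊔n≤o⇒m≤o m p lo≤n) (ℕ.m≤n⊓o⇒m≤n c r n≤hi))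
                         (≤-between (ℕ.m⊔n≤o⇒n≤o m p lo≤n) (ℕ.m≤n⊓o⇒m≤o c r n≤hi)))
      []-[] : ∀ b c u → [ b ] [ c ] u ≈ [ b ∧ c ] u
      []-[] true  c u = refl
      []-[] false c u = refl
      exponentˡ : ∀ n → lo ≤ n → n ∸ m ≡ (p ∸ m) ℕ.+ (n ∸ lo)
      exponentˡ n lo≤n = ≡.sym (≡.trans (≡.cong (ℕ._+ (n ∸ lo)) p∸m≡lo∸m)
        (≡.trans (≡.sym (ℕ.+-∸-comm (n ∸ lo) (ℕ.m≤m⊔n m p))) (≡.cong (_∸ m) (ℕ.m+[n∸m]≡n lo≤n))))
        where
        p∸m≡lo∸m : p ∸ m ≡ lo ∸ m
        p∸m≡lo∸m = ≡.sym (≡.trans (ℕ.∸-distribʳ-⊔ m m p) (≡.cong (_⊔ (p ∸ m)) (ℕ.n∸n≡0 m)))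
      exponentʳ : ∀ n → n ≤ hi → r ∸ n ≡ (r ∸ c) ℕ.+ (hi ∸ n)
      exponentʳ n n≤hi = ≡.sym (≡.trans (≡.sym (ℕ.+-∸-assoc (r ∸ c) n≤hi))
        (≡.cong (_∸ n) (≡.trans (ℕ.+-comm (r ∸ c) hi) (ℕ.m⊓n+n∸m≡n c r))))
      term : ∀ n → [ between m n c ] [ between p n r ] (x ^ (n ∸ m) * y ^ (r ∸ n))
                 ≈ x ^ (p ∸ m) * (y ^ (r ∸ c) * [ between lo n hi ] (x ^ (n ∸ lo) * y ^ (hi ∸ n)))
      term n = begin
        [ between m n c ] [ between p n r ] (x ^ (n ∸ m) * y ^ (r ∸ n))
          ≈⟨ []-[] (between m n c) (between p n r) _ ⟩
        [ between m n c ∧ between p n r ] (x ^ (n ∸ m) * y ^ (r ∸ n))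
          ≈⟨ reflexive (≡.cong (λ b → [ b ] (x ^ (n ∸ m) * y ^ (r ∸ n))) (merge n)) ⟩
        [ between lo n hi ] (x ^ (n ∸ m) * y ^ (r ∸ n))
          ≈⟨ []-cong-on (between lo n hi) (λ e → let (lo≤n , n≤hi) = between-≤ lo n hi e in
               trans (*-cong (trans (reflexive (≡.cong (x ^_) (exponentˡ n lo≤n))) (^-homo-* x (p ∸ m) (n ∸ lo)))
                             (trans (reflexive (≡.cong (y ^_) (exponentʳ n n≤hi))) (^-homo-* y (r ∸ c) (hi ∸ n))))
                     (trans (interchange _ _ _ _) (*-assoc _ _ _))) ⟩
        [ between lo n hi ] (x ^ (p ∸ m) * (y ^ (r ∸ c) * (x ^ (n ∸ lo) * y ^ (hi ∸ n))))
          ≈⟨ *-[] (between lo n hi) _ _ ⟨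
        x ^ (p ∸ m) * [ between lo n hi ] (y ^ (r ∸ c) * (x ^ (n ∸ lo) * y ^ (hi ∸ n)))
          ≈⟨ *-congˡ (*-[] (between lo n hi) _ _) ⟨
        x ^ (p ∸ m) * (y ^ (r ∸ c) * [ between lo n hi ] (x ^ (n ∸ lo) * y ^ (hi ∸ n))) ∎
      range : Dec (lo ≤ hi) → ∑ᴿ (upTo (suc B)) (λ n → [ between lo n hi ] (x ^ (n ∸ lo) * y ^ (hi ∸ n)))
                            ≈ [ lo <ᵇ suc hi ] h x y (hi ∸ lo)
      range (yes lo≤hi) = begin
        ∑ᴿ (upTo (suc B)) (λ n → [ between lo n hi ] (x ^ (n ∸ lo) * y ^ (hi ∸ n)))
          ≈⟨ geo-∑ x B lo hi (λ n → y ^ (hi ∸ n)) lo≤hi (ℕ.≤-trans (ℕ.m⊓n≤m c r) c≤B) ⟩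
        geo x (hi ∸ lo) (λ n → y ^ (hi ∸ n)) lo
          ≈⟨ geo-cong x (hi ∸ lo) lo (λ n _ _ → reflexive (≡.cong (λ k → y ^ (k ∸ n)) (≡.sym (ℕ.m∸n+n≡m lo≤hi)))) ⟩
        geo x (hi ∸ lo) (λ n → y ^ (((hi ∸ lo) ℕ.+ lo) ∸ n)) lo
          ≈⟨ geo-h x y (hi ∸ lo) lo ⟩
        h x y (hi ∸ lo)
          ≈⟨ reflexive (≡.cong (λ b → [ b ] h x y (hi ∸ lo)) (≡.sym (≤→ᵇ lo≤hi))) ⟩
        [ lo <ᵇ suc hi ] h x y (hi ∸ lo) ∎
      range (no lo≰hi) = trans
        (∑-zero (upTo (suc B)) λ n → []-false (between lo n hi) λ e →
          lo≰hi (ℕ.≤-trans (proj₁ (between-≤ lo n hi e)) (proj₂ (between-≤ lo n hi e))))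
        (sym ([]-false (lo <ᵇ suc hi) λ e → lo≰hi (ᵇ→≤ lo hi e)))
        where
        []-false : ∀ b {u} → ¬ (b ≡ true) → [ b ] u ≈ 0#
        []-false true  ¬e = contradiction ≡.refl ¬e
        []-false false ¬e = refl

    -- Of the two factors split off from the first row, `x ^ (p ∸ m)` is the boundary factor that
    -- the induction hypothesis needs, and `y ^ (r ∸ c)` completes the boundary factor `x ^ (r ∸ c)`
    -- to a symmetric product.
    rows-symmetric : ∀ {ℓ} x y c (μ ρ : Vec ℕ ℓ) → c ≤ B → Valid c μ →
      rows x y c μ ρ * x ^ (top ρ ∸ c) ≈ rows y x c μ ρ * y ^ (top ρ ∸ c)
    rows-symmetric x y c [] [] _ _ = *-congˡ (reflexive (≡.trans (≡.cong (x ^_) (ℕ.0∸n≡0 c)) (≡.cong (y ^_) (≡.sym (ℕ.0∸n≡0 c)))))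
    rows-symmetric x y c (m ∷ μ) (r ∷ ρ) c≤B (m≤c , v) = begin
      rowSum x y m c p r * rows x y m μ ρ * x ^ (r ∸ c)
        ≈⟨ *-congʳ (*-congʳ (rowSum-h x y m c p r c≤B)) ⟩
      x ^ (p ∸ m) * (y ^ (r ∸ c) * S x y) * rows x y m μ ρ * x ^ (r ∸ c)
        ≈⟨ regroup-boundary _ _ _ _ _ ⟩
      (y ^ (r ∸ c) * x ^ (r ∸ c)) * S x y * (rows x y m μ ρ * x ^ (p ∸ m))
        ≈⟨ *-cong (*-cong (*-comm _ _) ([]-cong (lo <ᵇ suc hi) (conv-comm (x ^_) (y ^_) (hi ∸ lo))))
                  (rows-symmetric x y m μ ρ (ℕ.≤-trans m≤c c≤B) v) ⟩
      (x ^ (r ∸ c) * y ^ (r ∸ c)) * S y x * (rows y x m μ ρ * y ^ (p ∸ m))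
        ≈⟨ regroup-boundary _ _ _ _ _ ⟨
      y ^ (p ∸ m) * (x ^ (r ∸ c) * S y x) * rows y x m μ ρ * y ^ (r ∸ c)
        ≈⟨ *-congʳ (*-congʳ (rowSum-h y x m c p r c≤B)) ⟨
      rowSum y x m c p r * rows y x m μ ρ * y ^ (r ∸ c) ∎
      where
      p  = top ρ
      lo = m ⊔ p
      hi = c ⊓ r
      S : Carrier → Carrier → Carrier
      S x y = [ lo <ᵇ suc hi ] h x y (hi ∸ lo)

    H-comm-≤ : ∀ {ℓ} x y c (f : Vec ℕ ℓ → Carrier) μ → c ≤ B → Valid c μ →
      H x c (H y c f) μ ≈ ∑ᴿ (shapes ℓ) (λ ρ → [ top ρ <ᵇ suc c ] (rows x y c μ ρ * f ρ))
    H-comm-≤ {ℓ} x y c f μ c≤B v = begin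
      H x c (H y c f) μ
        ≈⟨ H-kernel x c _ μ c≤B v ⟩
      ∑ᴿ (shapes ℓ) (λ ν → kernel x c μ ν * H y c f ν)
        ≈⟨ ∑-cong (shapes ℓ) (λ ν → kernel-Valid x c μ ν (H-kernel y c f ν c≤B)) ⟩
      ∑ᴿ (shapes ℓ) (λ ν → kernel x c μ ν * ∑ᴿ (shapes ℓ) (λ ρ → kernel y c ν ρ * f ρ))
        ≈⟨ ∑-cong (shapes ℓ) (λ ν → trans (*-∑ (shapes ℓ) _ _) (∑-cong (shapes ℓ) λ ρ → sym (*-assoc _ _ _))) ⟩
      ∑ᴿ (shapes ℓ) (λ ν → ∑ᴿ (shapes ℓ) (λ ρ → kernel x c μ ν * kernel y c ν ρ * f ρ))
        ≈⟨ ∑-swap (shapes ℓ) (shapes ℓ) _ ⟩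
      ∑ᴿ (shapes ℓ) (λ ρ → ∑ᴿ (shapes ℓ) (λ ν → kernel x c μ ν * kernel y c ν ρ * f ρ))
        ≈⟨ ∑-cong (shapes ℓ) (λ ρ → trans (sym (∑-* (shapes ℓ) _ _)) (*-congʳ (kernel-kernel x y c c μ ρ))) ⟩
      ∑ᴿ (shapes ℓ) (λ ρ → ([ top ρ <ᵇ suc c ] rows x y c μ ρ) * f ρ)
        ≈⟨ ∑-cong (shapes ℓ) (λ ρ → []-* (top ρ <ᵇ suc c) _ _) ⟩
      ∑ᴿ (shapes ℓ) (λ ρ → [ top ρ <ᵇ suc c ] (rows x y c μ ρ * f ρ)) ∎

  -- The bound `c` itself serves as the size of the box. As `top ρ ≤ c`, the remaining boundary
  -- factors have exponent 0.
  H-comm : ∀ {ℓ} x y c (f : Vec ℕ ℓ → Carrier) μ → Valid c μ → H x c (H y c f) μ ≈ H y c (H x c f) μ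
  H-comm {ℓ} x y c f μ v = trans (H-comm-≤ c x y c f μ ℕ.≤-refl v) (trans
    (∑-cong (shapes c ℓ) λ ρ → []-cong-on (top ρ <ᵇ suc c) λ e → *-congʳ (symmetric ρ (ᵇ→≤ (top ρ) c e)))
    (sym (H-comm-≤ c y x c f μ ℕ.≤-refl v)))
    where
    power0 : ∀ z {k} → k ≡ 0 → z ^ k ≈ 1#
    power0 z ≡.refl = refl
    symmetric : ∀ ρ → top ρ ≤ c → rows c x y c μ ρ ≈ rows c y x c μ ρ
    symmetric ρ le = begin
      rows c x y c μ ρ                     ≈⟨ *-identityʳ _ ⟨
      rows c x y c μ ρ * 1#                ≈⟨ *-congˡ (power0 x (ℕ.m≤n⇒m∸n≡0 le)) ⟨
      rows c x y c μ ρ * x ^ (top ρ ∸ c)   ≈⟨ rows-symmetric c x y c μ ρ ℕ.≤-refl v ⟩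
      rows c y x c μ ρ * y ^ (top ρ ∸ c)   ≈⟨ *-congˡ (power0 y (ℕ.m≤n⇒m∸n≡0 le)) ⟩
      rows c y x c μ ρ * 1#                ≈⟨ *-identityʳ _ ⟩
      rows c y x c μ ρ                     ∎

  -- An operator that commutes with `H y` commutes with its inverse `E (- y)`. Applied once more,
  -- this argument gives `E-comm`.
  E-H-comm : ∀ {ℓ} x y c (f : Vec ℕ ℓ → Carrier) μ → Valid c μ → E (- y) c (H x c f) μ ≈ H x c (E (- y) c f) μ
  E-H-comm x y c f μ v = begin
    E (- y) c (H x c f) μ
      ≈⟨ E-cong (- y) c (H-cong x c (λ ν w → H-E y c f ν w)) μ v ⟨
    E (- y) c (H x c (H y c (E (- y) c f))) μ
      ≈⟨ E-cong (- y) c (λ ν w → H-comm x y c _ ν w) μ v ⟩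
    E (- y) c (H y c (H x c (E (- y) c f))) μ
      ≈⟨ E-H y c _ μ v ⟩
    H x c (E (- y) c f) μ ∎

  E-comm : ∀ {ℓ} x y c (f : Vec ℕ ℓ → Carrier) μ → Valid c μ → E (- y) c (E (- x) c f) μ ≈ E (- x) c (E (- y) c f) μ
  E-comm x y c f μ v = begin
    E (- y) c (E (- x) c f) μ
      ≈⟨ E-H x c _ μ v ⟨
    E (- x) c (H x c (E (- y) c (E (- x) c f))) μ
      ≈⟨ E-cong (- x) c (λ ν w → E-H-comm x y c _ ν w) μ v ⟨
    E (- x) c (E (- y) c (H x c (E (- x) c f))) μ
      ≈⟨ E-cong (- x) c (E-cong (- y) c (λ ν w → H-E x c f ν w)) μ v ⟩
    E (- x) c (E (- y) c f) μ ∎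

-- Words in an ordered alphabet

module OrderedWords (R : CommutativeRing 0ℓ 0ℓ) where
  open CommutativeRing R hiding (zero)
  open SetoidReasoning setoid
  open FiniteSums R
  open ShapeOperators R

  module _ {S : Set} (C : S → S → Bool) where

    []-∧ : ∀ b c x → [ b ∧ c ] x ≈ [ b ] [ c ] x
    []-∧ true  c x = refl
    []-∧ false c x = refl

    ∑-chain-∷ : ∀ a τ n (f : Vec S (suc n) → Carrier) →
      ∑ᴿ (vecs τ (suc n)) (λ p → [ chain C (a ∷ p) ] f p)
        ≈ ∑ᴿ τ (λ b → [ C a b ] ∑ᴿ (vecs τ n) (λ p → [ chain C (b ∷ p) ] f (b ∷ p)))
    ∑-chain-∷ a τ n f = trans (∑-vecs τ n _) (∑-cong τ λ b →
      trans (∑-cong (vecs τ n) λ p → []-∧ (C a b) _ _) (sym ([]-∑ (C a b) (vecs τ n) _)))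

    -- The first occurrence of `s` would have to follow `a` or a letter of `ss`, and neither is
    -- allowed.
    ∑-drop : ∀ a s ss n (f : Vec S n → Carrier) → C a s ≡ false → All (λ s′ → C s′ s ≡ false) ss →
      ∑ᴿ (vecs (s ∷ ss) n) (λ p → [ chain C (a ∷ p) ] f p) ≈ ∑ᴿ (vecs ss n) (λ p → [ chain C (a ∷ p) ] f p)
    ∑-drop a s ss zero    f a≮s ss≮s = refl
    ∑-drop a s ss (suc n) f a≮s ss≮s = begin
      ∑ᴿ (vecs (s ∷ ss) (suc n)) (λ p → [ chain C (a ∷ p) ] f p)
        ≈⟨ ∑-chain-∷ a (s ∷ ss) n f ⟩
      [ C a s ] G s + ∑ᴿ ss (λ b → [ C a b ] G b)
        ≈⟨ +-congʳ (reflexive (≡.cong (λ b → [ b ] G s) a≮s)) ⟩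
      0# + ∑ᴿ ss (λ b → [ C a b ] G b)
        ≈⟨ +-identityˡ _ ⟩
      ∑ᴿ ss (λ b → [ C a b ] G b)
        ≈⟨ ∑-cong-∈ ss (λ b b∈ → []-cong (C a b) (∑-drop b s ss n (f ∘ (b ∷_)) (All.lookup ss≮s b∈) ss≮s)) ⟩
      ∑ᴿ ss (λ b → [ C a b ] ∑ᴿ (vecs ss n) (λ p → [ chain C (b ∷ p) ] f (b ∷ p)))
        ≈⟨ ∑-chain-∷ a ss n f ⟨
      ∑ᴿ (vecs ss (suc n)) (λ p → [ chain C (a ∷ p) ] f p) ∎
      where G = λ b → ∑ᴿ (vecs (s ∷ ss) n) (λ p → [ chain C (b ∷ p) ] f (b ∷ p))

    ∑-chain-tail : ∀ a τ n (f : Vec S n → Carrier) → All (λ b → C a b ≡ true) τ →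
      ∑ᴿ (vecs τ n) (λ p → [ chain C (a ∷ p) ] f p) ≈ ∑ᴿ (vecs τ n) (λ p → [ chain C p ] f p)
    ∑-chain-tail a τ zero    f a<τ = refl
    ∑-chain-tail a τ (suc n) f a<τ = trans (∑-chain-∷ a τ n f) (trans
      (∑-cong-∈ τ λ b b∈ → reflexive (≡.cong (λ d → [ d ] ∑ᴿ (vecs τ n) (λ p → [ chain C (b ∷ p) ] f (b ∷ p))) (All.lookup a<τ b∈)))
      (sym (∑-vecs τ n _)))

  step-cong : ∀ {ℓ} (r : Fin ℓ) c {f g : Vec ℕ ℓ → Carrier} μ →
    (∀ ν → Vec.sum ν ≡ suc (Vec.sum μ) → f ν ≈ g ν) → step 0# r c f μ ≈ step 0# r c g μ
  step-cong zero    c (m ∷ μ) f≈g = []-cong (m <ᵇ c) (f≈g (suc m ∷ μ) ≡.refl)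
  step-cong (suc r) c (m ∷ μ) f≈g =
    step-cong r m μ λ ν e → f≈g (m ∷ ν) (≡.trans (≡.cong (m ℕ.+_) e) (ℕ.+-suc m (Vec.sum μ)))

  step-zero : ∀ {ℓ} (r : Fin ℓ) c μ → step 0# r c (λ _ → 0#) μ ≈ 0#
  step-zero zero    c (m ∷ μ) = zeros (m <ᵇ c)
    where
    zeros : ∀ b → [ b ] 0# ≈ 0#
    zeros true  = refl
    zeros false = refl
  step-zero (suc r) c (m ∷ μ) = step-zero r m μ

  step-+ : ∀ {ℓ} (r : Fin ℓ) c f g μ → step 0# r c (λ ν → f ν + g ν) μ ≈ step 0# r c f μ + step 0# r c g μ
  step-+ zero    c f g (m ∷ μ) = split (m <ᵇ c)
    where
    split : ∀ b → [ b ] (f (suc m ∷ μ) + g (suc m ∷ μ)) ≈ [ b ] f (suc m ∷ μ) + [ b ] g (suc m ∷ μ)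
    split true  = refl
    split false = sym (+-identityˡ 0#)
  step-+ (suc r) c f g (m ∷ μ) = step-+ r m (f ∘ (m ∷_)) (g ∘ (m ∷_)) μ

  step-∑ : ∀ {ℓ} (r : Fin ℓ) c {I : Set} (is : List I) (f : I → Vec ℕ ℓ → Carrier) μ →
    step 0# r c (λ ν → ∑ᴿ is λ i → f i ν) μ ≈ ∑ᴿ is (λ i → step 0# r c (f i) μ)
  step-∑ r c []       f μ = step-zero r c μ
  step-∑ r c (i ∷ is) f μ = trans (step-+ r c (f i) _ μ) (+-congˡ (step-∑ r c is f μ))

  step-[] : ∀ {ℓ} (r : Fin ℓ) c (p : Vec ℕ ℓ → Bool) x μ →
    step 0# r c (λ ν → [ p ν ] x) μ ≈ [ step false r c p μ ] x
  step-[] zero    c p x (m ∷ μ) = split (m <ᵇ c)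
    where
    split : ∀ b → [ b ] [ p (suc m ∷ μ) ] x ≈ [ if b then p (suc m ∷ μ) else false ] x
    split true  = refl
    split false = refl
  step-[] (suc r) c p x (m ∷ μ) = step-[] r m (p ∘ (m ∷_)) x μ

  step-[]* : ∀ {ℓ} (r : Fin ℓ) c b f μ → step 0# r c (λ ν → [ b ] f ν) μ ≈ [ b ] step 0# r c f μ
  step-[]* r c true  f μ = refl
  step-[]* r c false f μ = step-zero r c μ

  geo-zero : ∀ x g φ m → (∀ d → m ≤ d → φ d ≈ 0#) → geo x g φ m ≈ 0#
  geo-zero x zero    φ m φ≈0 = φ≈0 m ℕ.≤-refl
  geo-zero x (suc g) φ m φ≈0 = trans
    (+-cong (φ≈0 m ℕ.≤-refl) (trans (*-congˡ (geo-zero x g φ (suc m) λ d m<d → φ≈0 d (ℕ.<⇒≤ m<d))) (zeroʳ x)))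
    (+-identityˡ 0#)

  rep-zero : ∀ {ℓ} x (r : Fin ℓ) c f μ → (∀ ν → Vec.sum μ ≤ Vec.sum ν → f ν ≈ 0#) → rep x r c f μ ≈ 0#
  rep-zero x zero    c f (m ∷ μ) f≈0 = geo-zero x (c ∸ m) _ m λ d m≤d → f≈0 (d ∷ μ) (ℕ.+-monoˡ-≤ (Vec.sum μ) m≤d)
  rep-zero x (suc r) c f (m ∷ μ) f≈0 = rep-zero x r m (f ∘ (m ∷_)) μ λ ν le → f≈0 (m ∷ ν) (ℕ.+-monoʳ-≤ m le)

  non-zero : ∀ {ℓ} y (r : Fin ℓ) c f μ → (∀ ν → Vec.sum μ ≤ Vec.sum ν → f ν ≈ 0#) → non y r c f μ ≈ 0#
  non-zero y r c f μ f≈0 = trans (+-cong (f≈0 μ ℕ.≤-refl) (trans (*-congˡ (trans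
    (step-cong r c μ λ ν e → f≈0 ν (ℕ.≤-trans (ℕ.n≤1+n _) (ℕ.≤-reflexive (≡.sym e)))) (step-zero r c μ))) (zeroʳ y)))
    (+-identityˡ 0#)

  Step : ℕ → Set
  Step ℓ = (Fin ℓ × Bool) × ℕ

  module _ (x y : ℕ → Carrier) where

    ζ : Bool → ℕ → Carrier
    ζ false = x
    ζ true  = y

    op : ∀ {ℓ} → Step ℓ → ℕ → (Vec ℕ ℓ → Carrier) → Vec ℕ ℓ → Carrier
    op ((r , false) , k) = rep (x k) r
    op ((r , true)  , k) = non (y k) r

    Op : ∀ {ℓ} → List (Step ℓ) → ℕ → (Vec ℕ ℓ → Carrier) → Vec ℕ ℓ → Carrier
    Op []       c f = f
    Op (s ∷ ss) c f = op s c (Op ss c f)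

    op-zero : ∀ {ℓ} (s : Step ℓ) c f μ → (∀ ν → Vec.sum μ ≤ Vec.sum ν → f ν ≈ 0#) → op s c f μ ≈ 0#
    op-zero ((r , false) , k) = rep-zero (x k) r
    op-zero ((r , true)  , k) = non-zero (y k) r

    module _ {ℓ : ℕ} (C : Step ℓ → Step ℓ → Bool) (c : ℕ) (N : ℕ) (K : Vec ℕ ℓ → Carrier)
             (K-support : ∀ (μ : Vec ℕ ℓ) → ¬ (Vec.sum μ ≡ N) → K μ ≈ 0#) where

      pathWeight : ∀ {n} → Vec (Step ℓ) n → Vec ℕ ℓ → Carrier
      pathWeight []                  μ = K μ
      pathWeight (((r , s) , k) ∷ p) μ = ζ s k * step 0# r c (pathWeight p) μ

      -- The operators only add cells, so they never lead from a larger shape back to the size `N`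
      -- that supports `K`.
      Op-zero : ∀ τ μ → N < Vec.sum μ → Op τ c K μ ≈ 0#
      Op-zero []       μ N<μ = K-support μ (ℕ.>⇒≢ N<μ)
      Op-zero (s ∷ ss) μ N<μ = op-zero s c _ μ λ ν μ≤ν → Op-zero ss ν (ℕ.<-≤-trans N<μ μ≤ν)

      op-top : ∀ s f (μ : Vec ℕ ℓ) → (∀ (ν : Vec ℕ ℓ) → Vec.sum μ < Vec.sum ν → f ν ≈ 0#) → op s c f μ ≈ f μ
      op-top s f μ f≈0 = by s
        where
        above : ∀ r {g} → (∀ (ν : Vec ℕ ℓ) → Vec.sum ν ≡ suc (Vec.sum μ) → g ν ≈ 0#) → ∀ z → f μ + z * step 0# r c g μ ≈ f μ
        above r g≈0 z = trans (+-congˡ (trans (*-congˡ (trans (step-cong r c μ g≈0) (step-zero r c μ))) (zeroʳ z))) (+-identityʳ _)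
        by : ∀ s → op s c f μ ≈ f μ
        by ((r , false) , k) = trans (rep-fix (x k) r c f μ) (above r (λ ν e →
          rep-zero (x k) r c f ν λ ρ le → f≈0 ρ (ℕ.≤-trans (ℕ.≤-reflexive (≡.sym e)) le)) (x k))
        by ((r , true)  , k) = above r (λ ν e → f≈0 ν (ℕ.≤-reflexive (≡.sym e))) (y k)

      Op-top : ∀ τ μ → Vec.sum μ ≡ N → Op τ c K μ ≈ K μ
      Op-top []       μ e = refl
      Op-top (s ∷ ss) μ e = trans
        (op-top s (Op ss c K) μ λ ν μ<ν → Op-zero ss ν (ℕ.≤-trans (ℕ.≤-reflexive (≡.cong suc (≡.sym e))) μ<ν)) (Op-top ss μ e)

      Sorted : List (Step ℓ) → Set
      Sorted τ = AllPairs (λ s s′ → C s s′ ≡ true × C s′ s ≡ false) τ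
               × All (λ s → C s s ≡ not (proj₂ (proj₁ s))) τ

      ∑-pathWeight : ∀ τ n (r : Fin ℓ) s k μ (b : Vec (Step ℓ) n → Bool) →
        ∑ᴿ (vecs τ n) (λ p → [ b p ] pathWeight (((r , s) , k) ∷ p) μ)
          ≈ ζ s k * step 0# r c (λ ν → ∑ᴿ (vecs τ n) λ p → [ b p ] pathWeight p ν) μ
      ∑-pathWeight τ n r s k μ b = trans
        (∑-cong (vecs τ n) λ p → trans (sym (*-[] (b p) _ _)) (*-congˡ (sym (step-[]* r c (b p) _ μ))))
        (trans (sym (*-∑ (vecs τ n) _ _)) (*-congˡ (sym (step-∑ r c (vecs τ n) _ μ))))

      -- `Op` puts no restriction on the number of letters; the support of `K` selects the words
      -- with `n` letters. Either the word avoids the first letter `s`, or it begins with `s`, since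
      -- `s` cannot follow any other letter. In the second case `s` stays available if it may be
      -- repeated, which is the fixed point of `rep`, and is dropped otherwise, which is `non`.
      words-Op : ∀ n τ μ → Sorted τ → n ℕ.+ Vec.sum μ ≡ N →
        ∑ᴿ (vecs τ n) (λ p → [ chain C p ] pathWeight p μ) ≈ Op τ c K μ
      words-Op zero    τ  μ _ e = trans (+-identityʳ _) (sym (Op-top τ μ e))
      -- No letters are left, but the size of `μ` is still less than `N`.
      words-Op (suc n) [] μ _ e = sym (K-support μ λ e′ → ℕ.<⇒≢ (s≤s (ℕ.m≤n+m (Vec.sum μ) n)) (≡.trans e′ (≡.sym e)))
      words-Op (suc n) (s ∷ ss) μ (s<ss ∷ sorted , s-rep ∷ reps) e = begin
        ∑ᴿ (vecs (s ∷ ss) (suc n)) (λ p → [ chain C p ] pathWeight p μ)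
          ≈⟨ ∑-vecs (s ∷ ss) n _ ⟩
        ∑ᴿ (vecs (s ∷ ss) n) (λ p → [ chain C (s ∷ p) ] pathWeight (s ∷ p) μ)
          + ∑ᴿ ss (λ b → ∑ᴿ (vecs (s ∷ ss) n) (λ p → [ chain C (b ∷ p) ] pathWeight (b ∷ p) μ))
          ≈⟨ +-comm _ _ ⟩
        ∑ᴿ ss (λ b → ∑ᴿ (vecs (s ∷ ss) n) (λ p → [ chain C (b ∷ p) ] pathWeight (b ∷ p) μ))
          + ∑ᴿ (vecs (s ∷ ss) n) (λ p → [ chain C (s ∷ p) ] pathWeight (s ∷ p) μ)
          ≈⟨ +-cong (rest (words-Op (suc n) ss μ (sorted , reps) e)) (first s ≡.refl) ⟩
        Op ss c K μ + ζ (proj₂ (proj₁ s)) (proj₂ s) * step 0# (proj₁ (proj₁ s)) c (after s) μ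
          ≈⟨ fixpoint s ⟨
        Op (s ∷ ss) c K μ ∎
        where
        ss≮s : All (λ s′ → C s′ s ≡ false) ss
        ss≮s = All.map proj₂ s<ss
        rest : ∑ᴿ (vecs ss (suc n)) (λ p → [ chain C p ] pathWeight p μ) ≈ Op ss c K μ → ∑ᴿ ss (λ b → ∑ᴿ (vecs (s ∷ ss) n) (λ p → [ chain C (b ∷ p) ] pathWeight (b ∷ p) μ)) ≈ Op ss c K μ
        rest IH = trans (∑-cong-∈ ss λ b b∈ → ∑-drop C b s ss n _ (All.lookup ss≮s b∈) ss≮s)
          (trans (sym (∑-vecs ss n _)) IH)
        after : Step ℓ → Vec ℕ ℓ → Carrier
        after ((r , false) , k) = Op (((r , false) , k) ∷ ss) c K
        after ((r , true)  , k) = Op ss c K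
        fixpoint : ∀ s → Op (s ∷ ss) c K μ
                       ≈ Op ss c K μ + ζ (proj₂ (proj₁ s)) (proj₂ s) * step 0# (proj₁ (proj₁ s)) c (after s) μ
        fixpoint ((r , false) , k) = rep-fix (x k) r c (Op ss c K) μ
        fixpoint ((r , true)  , k) = refl
        up : ∀ (ν : Vec ℕ ℓ) → Vec.sum ν ≡ suc (Vec.sum μ) → n ℕ.+ Vec.sum ν ≡ N
        up ν e′ = ≡.trans (≡.cong (n ℕ.+_) e′) (≡.trans (ℕ.+-suc n (Vec.sum μ)) e)
        first : ∀ s′ → s′ ≡ s → ∑ᴿ (vecs (s ∷ ss) n) (λ p → [ chain C (s′ ∷ p) ] pathWeight (s′ ∷ p) μ)
          ≈ ζ (proj₂ (proj₁ s′)) (proj₂ s′) * step 0# (proj₁ (proj₁ s′)) c (after s′) μ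
        first ((r , false) , k) ≡.refl = trans (∑-pathWeight (s ∷ ss) n r false k μ _) (*-congˡ (step-cong r c μ λ ν e′ →
          trans (∑-chain-tail C s (s ∷ ss) n _ (s-rep ∷ All.map proj₁ s<ss))
                (words-Op n (s ∷ ss) ν (s<ss ∷ sorted , s-rep ∷ reps) (up ν e′))))
        first ((r , true)  , k) ≡.refl = trans (∑-pathWeight (s ∷ ss) n r true k μ _) (*-congˡ (step-cong r c μ λ ν e′ →
          trans (∑-drop C s s ss n _ s-rep ss≮s)
          (trans (∑-chain-tail C s ss n _ (All.map proj₁ s<ss))
                (words-Op n ss ν (sorted , reps) (up ν e′)))))

-- The ordered alphabet of rows, signs and values

bools : List Bool
bools = false ∷ true ∷ []

rowsDown : ∀ ℓ → List (Fin ℓ)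
rowsDown zero    = []
rowsDown (suc ℓ) = map suc (rowsDown ℓ) ++ zero ∷ []

allFin-suc : ∀ ℓ → allFin (suc ℓ) ≡ zero ∷ map suc (allFin ℓ)
allFin-suc ℓ = ≡.cong (zero ∷_) (≡.sym (map-tabulate id suc))

isBelow : ∀ {ℓ} → Fin ℓ → Fin ℓ → Bool
isBelow r r′ = toℕ r <ᵇ toℕ r′

-- A sign is true for a barred letter; the arguments are the rows and signs of the
-- entries i and i + 1.
superDescent : ∀ {ℓ} → Fin ℓ × Bool → Fin ℓ × Bool → Bool
superDescent (r , s) (r′ , s′) = isBelow r r′ ∧ not s′ ∨ not (isBelow r r′) ∧ s

-- With equal values, one step may follow another only where there is no super descent: unbarred
-- letters with weakly falling row index, then barred letters with strictly rising row index. This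
-- dictates the order of the list.
block : ∀ {ℓ} → ℕ → List ((Fin ℓ × Bool) × ℕ)
block {ℓ} k = map (λ r → ((r , false) , k)) (rowsDown ℓ) ++ map (λ r → ((r , true) , k)) (allFin ℓ)

steps : ∀ {ℓ} → List ℕ → List ((Fin ℓ × Bool) × ℕ)
steps = concatMap block

reaches : ∀ {ℓ n} → ℕ → Vec ℕ ℓ → Vec (Fin ℓ) n → Vec ℕ ℓ → Bool
reaches c λ′ []      μ = does (Vec.≡-dec ℕ._≟_ μ λ′)
reaches c λ′ (r ∷ w) μ = step false r c (reaches c λ′ w) μ

<ᵇ-irrefl : ∀ m → (m <ᵇ m) ≡ false
<ᵇ-irrefl zero    = ≡.refl
<ᵇ-irrefl (suc m) = <ᵇ-irrefl m

<→ᵇ : ∀ {m n} → m < n → (m <ᵇ n) ≡ true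
<→ᵇ (s≤s m≤n) = ≤→ᵇ m≤n

≤→ᵇfalse : ∀ {m n} → n ≤ m → (m <ᵇ n) ≡ false
≤→ᵇfalse z≤n       = ≡.refl
≤→ᵇfalse (s≤s n≤m) = ≤→ᵇfalse n≤m

Ordered : (ℕ → ℕ → Bool) → List ℕ → Set
Ordered lt ks = AllPairs (λ k k′ → lt k k′ ≡ true × lt k′ k ≡ false) ks × All (λ k → lt k k ≡ false) ks

module _ {ℓ : ℕ} (lt : ℕ → ℕ → Bool) where

  private
    C = compatible lt (superDescent {ℓ})

  Before : (Fin ℓ × Bool) × ℕ → (Fin ℓ × Bool) × ℕ → Set
  Before s s′ = C s s′ ≡ true × C s′ s ≡ false

  Before-< : ∀ {k k′} → lt k k′ ≡ true → lt k′ k ≡ false → ∀ p p′ → Before (p , k) (p′ , k′)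
  Before-< {k} {k′} e e′ p p′ = ≡.trans (≡.cong₂ (λ a b → if superDescent p p′ then a else not b) e e′) (eq (superDescent p p′))
                  , ≡.trans (≡.cong₂ (λ a b → if superDescent p′ p then b else not a) e e′) (eq′ (superDescent p′ p))
    where
    eq : ∀ b → (if b then true else true) ≡ true
    eq true  = ≡.refl
    eq false = ≡.refl
    eq′ : ∀ b → (if b then false else false) ≡ false
    eq′ true  = ≡.refl
    eq′ false = ≡.refl

  module _ {k : ℕ} (e : lt k k ≡ false) where

    C-descent : ∀ p p′ → superDescent p p′ ≡ true → C (p , k) (p′ , k) ≡ false
    C-descent p p′ d = ≡.trans (≡.cong (λ b → if b then lt k k else not (lt k k)) d) e

    C-ascent : ∀ p p′ → superDescent p p′ ≡ false → C (p , k) (p′ , k) ≡ true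
    C-ascent p p′ d = ≡.trans (≡.cong (λ b → if b then lt k k else not (lt k k)) d) (≡.cong not e)

    pos-pos : ∀ {r r′ : Fin ℓ} → toℕ r′ < toℕ r → Before ((r , false) , k) ((r′ , false) , k)
    pos-pos {r} {r′} r′<r = C-ascent (r , false) (r′ , false) (descent r r′ (≤→ᵇfalse (ℕ.<⇒≤ r′<r)))
                          , C-descent (r′ , false) (r , false) (descent r′ r (<→ᵇ r′<r))
      where
      descent : ∀ (r r′ : Fin ℓ) {b} → isBelow r r′ ≡ b → superDescent (r , false) (r′ , false) ≡ b
      descent r r′ {true}  eq = ≡.cong (λ b → b ∧ true ∨ not b ∧ false) eq
      descent r r′ {false} eq = ≡.cong (λ b → b ∧ true ∨ not b ∧ false) eq

    neg-neg : ∀ {r r′ : Fin ℓ} → toℕ r < toℕ r′ → Before ((r , true) , k) ((r′ , true) , k)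
    neg-neg {r} {r′} r<r′ = C-ascent (r , true) (r′ , true) (≡.cong (λ b → b ∧ false ∨ not b ∧ true) (<→ᵇ r<r′))
                          , C-descent (r′ , true) (r , true) (≡.cong (λ b → b ∧ false ∨ not b ∧ true) (≤→ᵇfalse (ℕ.<⇒≤ r<r′)))

    pos-neg : ∀ (r r′ : Fin ℓ) → Before ((r , false) , k) ((r′ , true) , k)
    pos-neg r r′ = C-ascent (r , false) (r′ , true) (no-descent (isBelow r r′))
                 , C-descent (r′ , true) (r , false) (is-descent (isBelow r′ r))
      where
      no-descent : ∀ b → b ∧ false ∨ not b ∧ false ≡ false
      no-descent true  = ≡.refl
      no-descent false = ≡.refl
      is-descent : ∀ b → b ∧ true ∨ not b ∧ true ≡ true
      is-descent true  = ≡.refl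
      is-descent false = ≡.refl

    repeatable : ∀ (r : Fin ℓ) s → C ((r , s) , k) ((r , s) , k) ≡ not s
    repeatable r false = C-ascent (r , false) (r , false) (≡.cong (λ b → b ∧ true ∨ not b ∧ false) (<ᵇ-irrefl (toℕ r)))
    repeatable r true  = C-descent (r , true) (r , true) (≡.cong (λ b → b ∧ false ∨ not b ∧ true) (<ᵇ-irrefl (toℕ r)))

  rowsDown-sorted : ∀ ℓ → AllPairs (λ r r′ → toℕ r′ < toℕ r) (rowsDown ℓ)
  rowsDown-sorted zero    = []
  rowsDown-sorted (suc ℓ) = AllPairs.++⁺ (AllPairs.map⁺ (AllPairs.map s≤s (rowsDown-sorted ℓ))) ([] ∷ [])
    (All.map⁺ (All.universal (λ _ → s≤s z≤n ∷ []) (rowsDown ℓ)))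

  allFin-sorted : ∀ ℓ → AllPairs (λ r r′ → toℕ r < toℕ r′) (allFin ℓ)
  allFin-sorted zero    = []
  allFin-sorted (suc ℓ) = ≡.subst (AllPairs _) (≡.sym (allFin-suc ℓ))
    (All.map⁺ (All.universal (λ _ → s≤s z≤n) (allFin ℓ)) ∷ AllPairs.map⁺ (AllPairs.map s≤s (allFin-sorted ℓ)))

  block-sorted : ∀ {k} → lt k k ≡ false → AllPairs Before (block k)
  block-sorted e = AllPairs.++⁺
    (AllPairs.map⁺ (AllPairs.map (pos-pos e) (rowsDown-sorted ℓ)))
    (AllPairs.map⁺ (AllPairs.map (neg-neg e) (allFin-sorted ℓ)))
    (All.map⁺ (All.universal (λ r → All.map⁺ (All.universal (pos-neg e r) (allFin ℓ))) (rowsDown ℓ)))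

  block-all : ∀ {P : (Fin ℓ × Bool) × ℕ → Set} k → (∀ p → P (p , k)) → All P (block k)
  block-all k f = All.++⁺ (All.map⁺ (All.universal (λ r → f (r , false)) (rowsDown ℓ)))
                          (All.map⁺ (All.universal (λ r → f (r , true)) (allFin ℓ)))

  steps-all : ∀ {P : (Fin ℓ × Bool) × ℕ → Set} ks → All (λ k → ∀ p → P (p , k)) ks → All P (steps ks)
  steps-all []       []       = []
  steps-all (k ∷ ks) (f ∷ fs) = All.++⁺ (block-all k f) (steps-all ks fs)

  steps-sorted : ∀ ks → Ordered lt ks → AllPairs Before (steps ks) × All (λ s → C s s ≡ not (proj₂ (proj₁ s))) (steps ks)
  steps-sorted []       _ = [] , []
  steps-sorted (k ∷ ks) (k<ks ∷ ord , k≮k ∷ irr) =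
    AllPairs.++⁺ (block-sorted k≮k) (proj₁ rest)
      (block-all k λ p → steps-all ks (All.map (λ (e , e′) → Before-< e e′ p) k<ks))
    , All.++⁺ (block-all k λ (r , s) → repeatable k≮k r s) (proj₂ rest)
    where rest = steps-sorted ks (ord , irr)

-- Blocks of letters as products of strip operators

module LetterBlocks (R : CommutativeRing 0ℓ 0ℓ) where
  open CommutativeRing R hiding (zero)
  open SetoidReasoning setoid
  open FiniteSums R
  open ShapeOperators R
  open Commutation R
  open OrderedWords R
  open import Algebra.Properties.Ring ring using (-‿involutive)

  ∑-rowsDown : ∀ ℓ (f : Fin ℓ → Carrier) → ∑ᴿ (rowsDown ℓ) f ≈ ∑ᴿ (allFin ℓ) f
  ∑-rowsDown zero    f = refl
  ∑-rowsDown (suc ℓ) f = begin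
    ∑ᴿ (map suc (rowsDown ℓ) ++ zero ∷ []) f      ≈⟨ ∑-++ (map suc (rowsDown ℓ)) _ f ⟩
    ∑ᴿ (map suc (rowsDown ℓ)) f + (f zero + 0#)   ≈⟨ +-comm _ _ ⟩
    (f zero + 0#) + ∑ᴿ (map suc (rowsDown ℓ)) f   ≈⟨ +-cong (+-identityʳ _) (trans (∑-map (rowsDown ℓ) suc f)
                                                       (trans (∑-rowsDown ℓ (f ∘ suc)) (sym (∑-map (allFin ℓ) suc f)))) ⟩
    ∑ᴿ (zero ∷ map suc (allFin ℓ)) f              ≈⟨ reflexive (≡.cong (λ is → ∑ᴿ is f) (allFin-suc ℓ)) ⟨
    ∑ᴿ (allFin (suc ℓ)) f                         ∎

  ∑-steps : ∀ {ℓ} ks (f : Step ℓ → Carrier) →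
    ∑ᴿ (steps ks) f ≈ ∑ᴿ (allFin ℓ) (λ r → ∑ᴿ bools λ s → ∑ᴿ ks λ k → f ((r , s) , k))
  ∑-steps {ℓ} ks f = begin
    ∑ᴿ (steps ks) f
      ≈⟨ ∑-concatMap ks block f ⟩
    ∑ᴿ ks (λ k → ∑ᴿ (block k) f)
      ≈⟨ ∑-cong ks (λ k → trans (∑-++ (map (λ r → ((r , false) , k)) (rowsDown ℓ)) _ f)
           (+-cong (trans (∑-map (rowsDown ℓ) _ f) (∑-rowsDown ℓ _)) (∑-map (allFin ℓ) _ f))) ⟩
    ∑ᴿ ks (λ k → ∑ᴿ (allFin ℓ) (λ r → f ((r , false) , k)) + ∑ᴿ (allFin ℓ) (λ r → f ((r , true) , k)))
      ≈⟨ ∑-cong ks (λ k → trans (sym (∑-+ (allFin ℓ) _ _)) (∑-cong (allFin ℓ) λ r → +-congˡ (sym (+-identityʳ _)))) ⟩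
    ∑ᴿ ks (λ k → ∑ᴿ (allFin ℓ) (λ r → ∑ᴿ bools λ s → f ((r , s) , k)))
      ≈⟨ ∑-swap ks (allFin ℓ) _ ⟩
    ∑ᴿ (allFin ℓ) (λ r → ∑ᴿ ks λ k → ∑ᴿ bools λ s → f ((r , s) , k))
      ≈⟨ ∑-cong (allFin ℓ) (λ r → ∑-swap ks bools λ k s → f ((r , s) , k)) ⟩
    ∑ᴿ (allFin ℓ) (λ r → ∑ᴿ bools λ s → ∑ᴿ ks λ k → f ((r , s) , k)) ∎

  -- Separates the three ingredients of a word: its rows make up the tableau, its signs the power of
  -- t, and its values the P-partition.
  ∑-vecs-steps : ∀ {ℓ} ks n (f : Vec (Step ℓ) n → Carrier) →
    ∑ᴿ (vecs (steps ks) n) f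
      ≈ ∑ᴿ (vecs (allFin ℓ) n) (λ w → ∑ᴿ (vecs bools n) λ σ → ∑ᴿ (vecs ks n) λ v → f (zip (zip w σ) v))
  ∑-vecs-steps {ℓ} ks zero f = sym (trans (+-identityʳ _) (+-identityʳ _))
  ∑-vecs-steps {ℓ} ks (suc n) f = begin
    ∑ᴿ (vecs (steps ks) (suc n)) f
      ≈⟨ ∑-vecs (steps ks) n f ⟩
    ∑ᴿ (steps ks) (λ p → ∑ᴿ (vecs (steps ks) n) λ ps → f (p ∷ ps))
      ≈⟨ ∑-cong (steps ks) (λ p → ∑-vecs-steps ks n (f ∘ (p ∷_))) ⟩
    ∑ᴿ (steps ks) (λ p → ∑ᴿ W λ w → ∑ᴿ Σs λ σ → ∑ᴿ V λ v → f (p ∷ zip (zip w σ) v))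
      ≈⟨ ∑-steps ks _ ⟩
    ∑ᴿ (allFin ℓ) (λ r → ∑ᴿ bools λ s → ∑ᴿ ks λ k → ∑ᴿ W λ w → ∑ᴿ Σs λ σ → ∑ᴿ V λ v → f (((r , s) , k) ∷ zip (zip w σ) v))
      ≈⟨ ∑-cong (allFin ℓ) (λ r → trans
           (∑-cong bools λ s → trans (∑-swap ks W _) (∑-cong W λ w → ∑-swap ks Σs λ k σ → ∑ᴿ V λ v → f (((r , s) , k) ∷ zip (zip w σ) v)))
           (∑-swap bools W λ s w → ∑ᴿ Σs λ σ → ∑ᴿ ks λ k → ∑ᴿ V λ v → f (((r , s) , k) ∷ zip (zip w σ) v))) ⟩
    ∑ᴿ (allFin ℓ) (λ r → ∑ᴿ W λ w → ∑ᴿ bools λ s → ∑ᴿ Σs λ σ → ∑ᴿ ks λ k → ∑ᴿ V λ v → f (((r , s) , k) ∷ zip (zip w σ) v))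
      ≈⟨ ∑-cong (allFin ℓ) (λ r → ∑-cong W λ w → trans
           (∑-cong bools λ s → ∑-cong Σs λ σ → sym (∑-vecs ks n λ v → f (zip (zip (r ∷ w) (s ∷ σ)) v))) (sym (∑-vecs bools n _))) ⟩
    ∑ᴿ (allFin ℓ) (λ r → ∑ᴿ W λ w → ∑ᴿ (vecs bools (suc n)) λ σ → ∑ᴿ (vecs ks (suc n)) λ v → f (zip (zip (r ∷ w) σ) v))
      ≈⟨ ∑-vecs (allFin ℓ) n _ ⟨
    _ ∎
    where
    W  = vecs (allFin ℓ) n
    Σs = vecs bools n
    V  = vecs ks n

  rep-cong : ∀ {ℓ} x (r : Fin ℓ) c {f g} → (∀ ν → f ν ≈ g ν) → ∀ μ → rep x r c f μ ≈ rep x r c g μ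
  rep-cong x zero    c f≈g (m ∷ μ) = geo-cong x (c ∸ m) m λ d _ _ → f≈g (d ∷ μ)
  rep-cong x (suc r) c f≈g (m ∷ μ) = rep-cong x r m (λ ν → f≈g (m ∷ ν)) μ

  non-cong : ∀ {ℓ} y (r : Fin ℓ) c {f g} → (∀ ν → f ν ≈ g ν) → ∀ μ → non y r c f μ ≈ non y r c g μ
  non-cong y r c f≈g μ = +-cong (f≈g μ) (*-congˡ (step-cong r c μ λ ν _ → f≈g ν))

  E-scalar : ∀ {ℓ} {y y′} → y ≈ y′ → ∀ c (f : Vec ℕ ℓ → Carrier) μ → E y c f μ ≈ E y′ c f μ
  E-scalar e c f []      = refl
  E-scalar e c f (m ∷ μ) = +-cong (E-scalar e m _ μ) (*-cong e ([]-cong (m <ᵇ c) (E-scalar e (suc m) _ μ)))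

  module _ (x y : ℕ → Carrier) where

    Op-++ : ∀ {ℓ} (ss ss′ : List (Step ℓ)) c f → Op x y (ss ++ ss′) c f ≡ Op x y ss c (Op x y ss′ c f)
    Op-++ []       ss′ c f = ≡.refl
    Op-++ (s ∷ ss) ss′ c f = ≡.cong (op x y s c) (Op-++ ss ss′ c f)

    Op-suc : ∀ {ℓ} s k (rs : List (Fin ℓ)) c f m μ →
      Op x y (map (λ r → ((r , s) , k)) (map suc rs)) c f (m ∷ μ) ≈ Op x y (map (λ r → ((r , s) , k)) rs) m (f ∘ (m ∷_)) μ
    Op-suc s     k []       c f m μ = refl
    Op-suc false k (r ∷ rs) c f m μ = rep-cong (x k) r m (Op-suc false k rs c f m) μ
    Op-suc true  k (r ∷ rs) c f m μ = non-cong (y k) r m (Op-suc true k rs c f m) μ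

    Op-H : ∀ ℓ k c f (μ : Vec ℕ ℓ) → Op x y (map (λ r → ((r , false) , k)) (rowsDown ℓ)) c f μ ≈ H (x k) c f μ
    Op-H zero    k c f []      = refl
    Op-H (suc ℓ) k c f (m ∷ μ) = begin
      Op x y (map (λ r → ((r , false) , k)) (map suc (rowsDown ℓ) ++ zero ∷ [])) c f (m ∷ μ)
        ≈⟨ reflexive (≡.cong (λ ss → Op x y ss c f (m ∷ μ)) (map-++ _ (map suc (rowsDown ℓ)) _)) ⟩
      Op x y (map (λ r → ((r , false) , k)) (map suc (rowsDown ℓ)) ++ ((zero , false) , k) ∷ []) c f (m ∷ μ)
        ≈⟨ reflexive (≡.cong (λ F → F (m ∷ μ)) (Op-++ (map (λ r → ((r , false) , k)) (map suc (rowsDown ℓ))) _ c f)) ⟩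
      Op x y (map (λ r → ((r , false) , k)) (map suc (rowsDown ℓ))) c (rep (x k) zero c f) (m ∷ μ)
        ≈⟨ Op-suc false k (rowsDown ℓ) c _ m μ ⟩
      Op x y (map (λ r → ((r , false) , k)) (rowsDown ℓ)) m (λ ν → rep (x k) zero c f (m ∷ ν)) μ
        ≈⟨ Op-H ℓ k m _ μ ⟩
      H (x k) c f (m ∷ μ) ∎

    Op-E : ∀ ℓ k c f (μ : Vec ℕ ℓ) → Op x y (map (λ r → ((r , true) , k)) (allFin ℓ)) c f μ ≈ E (y k) c f μ
    Op-E zero    k c f []      = refl
    Op-E (suc ℓ) k c f (m ∷ μ) = trans
      (reflexive (≡.cong (λ rs → Op x y (map (λ r → ((r , true) , k)) rs) c f (m ∷ μ)) (allFin-suc ℓ)))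
      (+-cong (tail m) (*-congˡ ([]-cong (m <ᵇ c) (tail (suc m)))))
      where
      tail : ∀ m → Op x y (map (λ r → ((r , true) , k)) (map suc (allFin ℓ))) c f (m ∷ μ) ≈ E (y k) m (f ∘ (m ∷_)) μ
      tail m = trans (Op-suc true k (allFin ℓ) c f m μ) (Op-E ℓ k m (f ∘ (m ∷_)) μ)

    W : ∀ {ℓ} → List ℕ → ℕ → (Vec ℕ ℓ → Carrier) → Vec ℕ ℓ → Carrier
    W []       c f = f
    W (k ∷ ks) c f = H (x k) c (E (y k) c (W ks c f))

    Op-W : ∀ {ℓ} ks c f (μ : Vec ℕ ℓ) → Valid c μ → Op x y (steps ks) c f μ ≈ W ks c f μ
    Op-W         []       c f μ v = refl
    Op-W {ℓ} (k ∷ ks) c f μ v = begin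
      Op x y (block k ++ steps ks) c f μ
        ≈⟨ reflexive (≡.cong (λ F → F μ) (≡.trans (Op-++ (block k) (steps ks) c f)
             (Op-++ (map (λ r → ((r , false) , k)) (rowsDown ℓ)) _ c _))) ⟩
      Op x y (map (λ r → ((r , false) , k)) (rowsDown ℓ)) c (Op x y (map (λ r → ((r , true) , k)) (allFin ℓ)) c (Op x y (steps ks) c f)) μ
        ≈⟨ Op-H ℓ k c _ μ ⟩
      H (x k) c (Op x y (map (λ r → ((r , true) , k)) (allFin ℓ)) c (Op x y (steps ks) c f)) μ
        ≈⟨ H-cong (x k) c (λ ν w → trans (Op-E ℓ k c _ ν) (E-cong (y k) c (λ ρ u → Op-W ks c f ρ u) ν w)) μ v ⟩
      W (k ∷ ks) c f μ ∎

    -- The commutation laws were proved for `E (- y)`, the inverse of `H y`; a double negation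
    -- brings an arbitrary parameter into this form.
    E-as : ∀ {ℓ} k c (f : Vec ℕ ℓ → Carrier) μ → E (y k) c f μ ≈ E (- - y k) c f μ
    E-as k c f μ = E-scalar (sym (-‿involutive (y k))) c f μ

    E-H-comm′ : ∀ {ℓ} j k c (f : Vec ℕ ℓ → Carrier) μ → Valid c μ →
      E (y j) c (H (x k) c f) μ ≈ H (x k) c (E (y j) c f) μ
    E-H-comm′ j k c f μ v = trans (E-as j c _ μ) (trans (E-H-comm (x k) (- y j) c f μ v)
      (H-cong (x k) c (λ ν _ → sym (E-as j c f ν)) μ v))

    E-comm′ : ∀ {ℓ} j k c (f : Vec ℕ ℓ → Carrier) μ → Valid c μ →
      E (y j) c (E (y k) c f) μ ≈ E (y k) c (E (y j) c f) μ
    E-comm′ j k c f μ v = begin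
      E (y j) c (E (y k) c f) μ
        ≈⟨ trans (E-as j c _ μ) (E-cong _ c (λ ν _ → E-as k c f ν) μ v) ⟩
      E (- - y j) c (E (- - y k) c f) μ
        ≈⟨ E-comm (- y k) (- y j) c f μ v ⟩
      E (- - y k) c (E (- - y j) c f) μ
        ≈⟨ trans (E-as k c _ μ) (E-cong _ c (λ ν _ → E-as j c f ν) μ v) ⟨
      E (y k) c (E (y j) c f) μ ∎

    W-swap : ∀ {ℓ} j k c (f : Vec ℕ ℓ → Carrier) μ → Valid c μ →
      H (x j) c (E (y j) c (H (x k) c (E (y k) c f))) μ ≈ H (x k) c (E (y k) c (H (x j) c (E (y j) c f))) μ
    W-swap j k c f μ v = begin
      H (x j) c (E (y j) c (H (x k) c (E (y k) c f))) μ
        ≈⟨ H-cong (x j) c (λ ν w → E-H-comm′ j k c _ ν w) μ v ⟩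
      H (x j) c (H (x k) c (E (y j) c (E (y k) c f))) μ
        ≈⟨ H-comm (x j) (x k) c _ μ v ⟩
      H (x k) c (H (x j) c (E (y j) c (E (y k) c f))) μ
        ≈⟨ H-cong (x k) c (H-cong (x j) c (λ ν w → E-comm′ j k c f ν w)) μ v ⟩
      H (x k) c (H (x j) c (E (y k) c (E (y j) c f))) μ
        ≈⟨ H-cong (x k) c (λ ν w → E-H-comm′ k j c _ ν w) μ v ⟨
      H (x k) c (E (y k) c (H (x j) c (E (y j) c f))) μ ∎

    W-↭ : ∀ {ℓ ks ks′} c (f : Vec ℕ ℓ → Carrier) → ks ↭ ks′ → ∀ μ → Valid c μ → W ks c f μ ≈ W ks′ c f μ
    W-↭ c f ↭.refl         μ v = refl
    W-↭ c f (↭.prep k p)   μ v = H-cong (x k) c (E-cong (y k) c (W-↭ c f p)) μ v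
    W-↭ c f (↭.swap j k p) μ v = trans (W-swap j k c _ μ v)
      (H-cong (x k) c (E-cong (y k) c (H-cong (x j) c (E-cong (y j) c (W-↭ c f p)))) μ v)
    W-↭ c f (↭.trans p q)  μ v = trans (W-↭ c f p μ v) (W-↭ c f q μ v)

-- Generating functions for increasing and for decreasing values

upTo-ordered : ∀ M → Ordered _<ᵇ_ (upTo M)
upTo-ordered M = AllPairs.applyUpTo⁺₁ id M (λ i<j _ → <→ᵇ i<j , ≤→ᵇfalse (ℕ.<⇒≤ i<j))
               , All.applyUpTo⁺₂ id M <ᵇ-irrefl

downFrom-ordered : ∀ M → Ordered (flip _<ᵇ_) (downFrom M)
downFrom-ordered M = AllPairs.applyDownFrom⁺₁ id M (λ j<i _ → <→ᵇ j<i , ≤→ᵇfalse (ℕ.<⇒≤ j<i))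
                   , All.applyDownFrom⁺₂ id M <ᵇ-irrefl

upTo↭downFrom : ∀ M → upTo M ↭ downFrom M
upTo↭downFrom M = ≡.subst (_↭ downFrom M) (reverse-downFrom M) (↭-reverse (downFrom M))

zeros : ∀ ℓ → Vec ℕ ℓ
zeros ℓ = replicate ℓ 0

zeros-Valid : ∀ ℓ c → Valid c (zeros ℓ)
zeros-Valid zero    c = tt
zeros-Valid (suc ℓ) c = z≤n , zeros-Valid ℓ 0

sum-zeros : ∀ ℓ → Vec.sum (zeros ℓ) ≡ 0
sum-zeros zero    = ≡.refl
sum-zeros (suc ℓ) = sum-zeros ℓ

trues : ∀ {n} → Vec Bool n → ℕ
trues []          = 0
trues (true  ∷ σ) = suc (trues σ)
trues (false ∷ σ) = trues σ

module WordSums (R : CommutativeRing 0ℓ 0ℓ) {ℓ n : ℕ} (λ′ : Vec ℕ ℓ) (c : ℕ) (|λ′| : Vec.sum λ′ ≡ n) where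
  open CommutativeRing R hiding (zero)
  open SetoidReasoning setoid
  open FiniteSums R
  open OrderedWords R
  open LetterBlocks R
  open import Algebra.Properties.CommutativeSemigroup *-commutativeSemigroup using (x∙yz≈y∙xz; interchange)

  words : List (Vec (Fin ℓ) n)
  words = vecs (allFin ℓ) n

  isLattice : Vec (Fin ℓ) n → Bool
  isLattice w = reaches c λ′ w (zeros ℓ)

  δ : Vec ℕ ℓ → Carrier
  δ μ = [ does (Vec.≡-dec ℕ._≟_ μ λ′) ] 1#

  δ-support : ∀ μ → ¬ (Vec.sum μ ≡ n) → δ μ ≈ 0#
  δ-support μ |μ|≢n = by (Vec.≡-dec ℕ._≟_ μ λ′)
    where
    by : (d : Dec (μ ≡ λ′)) → [ does d ] 1# ≈ 0#
    by (yes ≡.refl) = contradiction |λ′| |μ|≢n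
    by (no _)       = refl

  module _ (x y : ℕ → Carrier) where

    monomialOf : ∀ {k} → Vec Bool k → Vec ℕ k → Carrier
    monomialOf []      []      = 1#
    monomialOf (s ∷ σ) (k ∷ v) = ζ x y s k * monomialOf σ v

    module _ (C : Step ℓ → Step ℓ → Bool) where

      pathWeight-zip : ∀ {k} (w : Vec (Fin ℓ) k) σ v μ →
        pathWeight x y C c n δ δ-support (zip (zip w σ) v) μ ≈ [ reaches c λ′ w μ ] monomialOf σ v
      pathWeight-zip []      []      []      μ = refl
      pathWeight-zip (r ∷ w) (s ∷ σ) (k ∷ v) μ = begin
        ζ x y s k * step 0# r c (pathWeight x y C c n δ δ-support (zip (zip w σ) v)) μ
          ≈⟨ *-congˡ (step-cong r c μ (λ ν _ → pathWeight-zip w σ v ν)) ⟩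
        ζ x y s k * step 0# r c (λ ν → [ reaches c λ′ w ν ] monomialOf σ v) μ
          ≈⟨ *-congˡ (step-[] r c (reaches c λ′ w) _ μ) ⟩
        ζ x y s k * [ step false r c (reaches c λ′ w) μ ] monomialOf σ v
          ≈⟨ *-[] (step false r c (reaches c λ′ w) μ) _ _ ⟩
        [ step false r c (reaches c λ′ w) μ ] (ζ x y s k * monomialOf σ v) ∎

    -- The super Schur function in the letters with values in ks.
    wordSum : (ℕ → ℕ → Bool) → List ℕ → Carrier
    wordSum lt ks = ∑ᴿ words λ w → ∑ᴿ (vecs bools n) λ σ → ∑ᴿ (vecs ks n) λ v →
      [ chain (compatible lt superDescent) (zip (zip w σ) v) ] [ isLattice w ] monomialOf σ v

    wordSum-W : ∀ lt ks → Ordered lt ks → wordSum lt ks ≈ W x y ks c δ (zeros ℓ)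
    wordSum-W lt ks ord = begin
      wordSum lt ks
        ≈⟨ ∑-cong words (λ w → ∑-cong (vecs bools n) λ σ → ∑-cong (vecs ks n) λ v →
             []-cong (chain C (zip (zip w σ) v)) (pathWeight-zip C w σ v (zeros ℓ))) ⟨
      _
        ≈⟨ ∑-vecs-steps ks n (λ p → [ chain C p ] pathWeight x y C c n δ δ-support p (zeros ℓ)) ⟨
      ∑ᴿ (vecs (steps ks) n) (λ p → [ chain C p ] pathWeight x y C c n δ δ-support p (zeros ℓ))
        ≈⟨ words-Op x y C c n δ δ-support n (steps ks) (zeros ℓ) (steps-sorted lt ks ord)
             (≡.trans (≡.cong (n ℕ.+_) (sum-zeros ℓ)) (ℕ.+-identityʳ n)) ⟩
      Op x y (steps ks) c δ (zeros ℓ)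
        ≈⟨ Op-W x y ks c δ (zeros ℓ) (zeros-Valid ℓ c) ⟩
      W x y ks c δ (zeros ℓ) ∎
      where C = compatible lt (superDescent {ℓ})

    ∑-vecs-↭ : ∀ {ks ks′ : List ℕ} m (f : Vec ℕ m → Carrier) → ks ↭ ks′ → ∑ᴿ (vecs ks m) f ≈ ∑ᴿ (vecs ks′ m) f
    ∑-vecs-↭ zero    f p = refl
    ∑-vecs-↭ {ks} {ks′} (suc m) f p = trans (∑-vecs ks m f) (trans (∑-cong ks λ k → ∑-vecs-↭ m (f ∘ (k ∷_)) p)
      (trans (∑-↭ _ p) (sym (∑-vecs ks′ m f))))

    -- In the decreasing alphabet the blocks of `W` occur in the opposite order, which `W-↭` undoes.
    -- The list must be ordered for `wordSum-W` only; as a sum, `wordSum` does not depend on how the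
    -- values are listed, hence the last step.
    wordSum-reversed : ∀ M → wordSum _<ᵇ_ (upTo M) ≈ wordSum (flip _<ᵇ_) (upTo M)
    wordSum-reversed M = begin
      wordSum _<ᵇ_ (upTo M)             ≈⟨ wordSum-W _<ᵇ_ (upTo M) (upTo-ordered M) ⟩
      W x y (upTo M) c δ (zeros ℓ)      ≈⟨ W-↭ x y c δ (upTo↭downFrom M) (zeros ℓ) (zeros-Valid ℓ c) ⟩
      W x y (downFrom M) c δ (zeros ℓ)  ≈⟨ wordSum-W (flip _<ᵇ_) (downFrom M) (downFrom-ordered M) ⟨
      wordSum (flip _<ᵇ_) (downFrom M)  ≈⟨ ∑-cong words (λ w → ∑-cong (vecs bools n) λ σ → ∑-vecs-↭ n _ (upTo↭downFrom M)) ⟨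
      wordSum (flip _<ᵇ_) (upTo M)      ∎

  module _ (q t : Carrier) where
    open PPartitions R q
    open DecreasingPPartitions R q

    x y : ℕ → Carrier
    x k = q ^ k
    y k = t * q ^ k

    monomialOf-power : ∀ {k} (σ : Vec Bool k) v → monomialOf x y σ v ≈ t ^ trues σ * q ^ Vec.sum v
    monomialOf-power []          []      = sym (*-identityˡ 1#)
    monomialOf-power (false ∷ σ) (k ∷ v) = trans (*-congˡ (monomialOf-power σ v))
      (trans (x∙yz≈y∙xz _ _ _) (*-congˡ (sym (^-homo-* q k (Vec.sum v)))))
    monomialOf-power (true  ∷ σ) (k ∷ v) = trans (*-congˡ (monomialOf-power σ v))
      (trans (interchange _ _ _ _) (*-congˡ (sym (^-homo-* q k (Vec.sum v)))))

    statisticSum : (∀ {k} → Vec (Fin ℓ × Bool) k → ℕ) → Carrier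
    statisticSum stat = ∑ᴿ words λ w → ∑ᴿ (vecs bools n) λ σ →
      [ isLattice w ] (t ^ trues σ * q ^ stat (zip w σ))

    -- With rows and signs fixed, the sum over the values is a P-partition generating function,
    -- evaluated by `pp`. The common factor `q ^ M` allows all the errors to be merged into one.
    qPoch-statistic : ∀ lt (stat : ∀ {k} → Vec (Fin ℓ × Bool) k → ℕ) M →
      (∀ (ps : Vec (Fin ℓ × Bool) n) → ∃[ h ]
        qPoch n * ∑ᴿ (vecs (upTo M) n) (λ v → [ chain (compatible lt superDescent) (zip ps v) ] q ^ Vec.sum v)
          ≈ q ^ stat ps + q ^ M * h) →
      ∃[ h ] qPoch n * wordSum x y lt (upTo M) ≈ statisticSum stat + q ^ M * h
    qPoch-statistic lt stat M pp = ∑ᴿ words (λ w → ∑ᴿ (vecs bools n) λ σ → error w σ) , (begin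
      qPoch n * wordSum x y lt (upTo M)
        ≈⟨ trans (*-∑ words _ _) (∑-cong words λ w → trans (*-∑ (vecs bools n) _ _) (∑-cong (vecs bools n) λ σ → term w σ)) ⟩
      ∑ᴿ words (λ w → ∑ᴿ (vecs bools n) λ σ → [ isLattice w ] (t ^ trues σ * q ^ stat (zip w σ)) + q ^ M * error w σ)
        ≈⟨ trans (∑-cong words λ w → ∑-+ (vecs bools n) _ _) (∑-+ words _ _) ⟩
      statisticSum stat + ∑ᴿ words (λ w → ∑ᴿ (vecs bools n) λ σ → q ^ M * error w σ)
        ≈⟨ +-congˡ (trans (*-∑ words _ _) (∑-cong words λ w → *-∑ (vecs bools n) _ _)) ⟨
      statisticSum stat + q ^ M * ∑ᴿ words (λ w → ∑ᴿ (vecs bools n) λ σ → error w σ) ∎)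
      where
      C = compatible lt (superDescent {ℓ})
      error : Vec (Fin ℓ) n → Vec Bool n → Carrier
      error w σ = [ isLattice w ] (t ^ trues σ * proj₁ (pp (zip w σ)))
      factor : ∀ b b′ u v → [ b ] [ b′ ] (u * v) ≈ [ b′ ] (u * [ b ] v)
      factor true  b′    u v = refl
      factor false true  u v = sym (zeroʳ u)
      factor false false u v = refl
      spread : ∀ b t′ u k h → [ b ] (t′ * (u + k * h)) ≈ [ b ] (t′ * u) + k * [ b ] (t′ * h)
      spread true  t′ u k h = trans (distribˡ t′ u _) (+-congˡ (x∙yz≈y∙xz t′ k h))
      spread false t′ u k h = sym (trans (+-identityˡ _) (zeroʳ k))
      exchange : ∀ b a t′ u → a * [ b ] (t′ * u) ≈ [ b ] (t′ * (a * u))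
      exchange true  a t′ u = x∙yz≈y∙xz a t′ u
      exchange false a t′ u = zeroʳ a
      V = vecs (upTo M) n
      term : ∀ w σ → qPoch n * ∑ᴿ V (λ v → [ chain C (zip (zip w σ) v) ] [ isLattice w ] monomialOf x y σ v)
        ≈ [ isLattice w ] (t ^ trues σ * q ^ stat (zip w σ)) + q ^ M * error w σ
      term w σ = begin
        qPoch n * ∑ᴿ V (λ v → [ chain C (zip (zip w σ) v) ] [ isLattice w ] monomialOf x y σ v)
          ≈⟨ *-congˡ (trans (∑-cong V λ v →
               trans ([]-cong (chain C (zip (zip w σ) v)) ([]-cong (isLattice w) (monomialOf-power σ v)))
                     (factor (chain C (zip (zip w σ) v)) (isLattice w) _ _))
               (trans (sym ([]-∑ (isLattice w) V _)) ([]-cong (isLattice w) (sym (*-∑ V _ _))))) ⟩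
        qPoch n * [ isLattice w ] (t ^ trues σ * ∑ᴿ V (λ v → [ chain C (zip (zip w σ) v) ] q ^ Vec.sum v))
          ≈⟨ exchange (isLattice w) _ _ _ ⟩
        [ isLattice w ] (t ^ trues σ * (qPoch n * ∑ᴿ V (λ v → [ chain C (zip (zip w σ) v) ] q ^ Vec.sum v)))
          ≈⟨ []-cong (isLattice w) (*-congˡ (proj₂ (pp (zip w σ)))) ⟩
        [ isLattice w ] (t ^ trues σ * (q ^ stat (zip w σ) + q ^ M * proj₁ (pp (zip w σ))))
          ≈⟨ spread (isLattice w) _ _ _ _ ⟩
        [ isLattice w ] (t ^ trues σ * q ^ stat (zip w σ)) + q ^ M * error w σ ∎

    qPoch-comajor : ∀ M → ∃[ h ] qPoch n * wordSum x y _<ᵇ_ (upTo M) ≈ statisticSum (comajor superDescent) + q ^ M * h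
    qPoch-comajor M = qPoch-statistic _<ᵇ_ (comajor superDescent) M (qPoch-F superDescent M)

    -- The sum is the one of `qPoch-comajor`, with increasing values; only after `wordSum-reversed`
    -- does the formula for decreasing values apply to it.
    qPoch-major : ∀ M → ∃[ h ] qPoch n * wordSum x y _<ᵇ_ (upTo M) ≈ statisticSum (major superDescent) + q ^ M * h
    qPoch-major M = let (h , e) = qPoch-statistic (flip _<ᵇ_) (major superDescent) M (qPoch-F⁻ superDescent M)
                    in h , trans (*-congˡ (wordSum-reversed x y M)) e

-- Tableaux and lattice words

module TableauxAndWords where
  open import Data.Nat using (_+_; _*_; _≥_; _≟_; _<?_)
  open import Data.Nat.Properties
  open import Data.Nat.ListAction using (sum)
  open import Defs
  open import Data.Vec using (lookup; tabulate; updateAt; zipWith)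
  open ≡ using (refl; sym; trans; cong; cong₂; subst; subst₂)

  true≢false : ∀ {A : Set} {b} → b ≡ true → b ≡ false → A
  true≢false refl ()

  inc : ∀ {ℓ} → Fin ℓ → Vec ℕ ℓ → Vec ℕ ℓ
  inc r μ = updateAt μ r suc

  step-true : ∀ {ℓ} (r : Fin ℓ) c f μ → Valid c μ → step false r c f μ ≡ true → Valid c (inc r μ) × f (inc r μ) ≡ true
  step-true zero    c f (m ∷ μ) (m≤c , v) e with m <ᵇ c in m<c
  ... | true = (ᵇ→≤ (suc m) c m<c , Valid-≤ (n≤1+n m) μ v) , e
  step-true (suc r) c f (m ∷ μ) (m≤c , v) e = let (v′ , e′) = step-true r m (f ∘ (m ∷_)) μ v e in (m≤c , v′) , e′

  true-step : ∀ {ℓ} (r : Fin ℓ) c f μ → Valid c (inc r μ) → f (inc r μ) ≡ true → step false r c f μ ≡ true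
  true-step zero    c f (m ∷ μ) (m<c , v) e = trans (cong (λ b → if b then f (suc m ∷ μ) else false) (<→ᵇ m<c)) e
  true-step (suc r) c f (m ∷ μ) (m≤c , v) e = true-step r m (f ∘ (m ∷_)) μ v e

  Valid-bound : ∀ {ℓ} c (μ : Vec ℕ ℓ) → Valid c μ → ∀ r → lookup μ r ≤ c
  Valid-bound c (m ∷ μ) (m≤c , v) zero    = m≤c
  Valid-bound c (m ∷ μ) (m≤c , v) (suc r) = ≤-trans (Valid-bound m μ v r) m≤c

  Valid-columns : ∀ {ℓ} c (μ : Vec ℕ ℓ) → Valid c μ → ∀ r r′ → r Fin.< r′ → lookup μ r′ ≤ lookup μ r
  Valid-columns c (m ∷ μ) (m≤c , v) zero    (suc r′) _         = Valid-bound m μ v r′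
  Valid-columns c (m ∷ μ) (m≤c , v) (suc r) (suc r′) (s≤s r<r′) = Valid-columns m μ v r r′ r<r′

  columns-Valid : ∀ {ℓ} c (μ : Vec ℕ ℓ) → (∀ r → lookup μ r ≤ c) →
    (∀ r r′ → r Fin.< r′ → lookup μ r′ ≤ lookup μ r) → Valid c μ
  columns-Valid c []      b d = tt
  columns-Valid c (m ∷ μ) b d = b zero ,
    columns-Valid m μ (λ r → d zero (suc r) (s≤s z≤n)) (λ r r′ lt → d (suc r) (suc r′) (s≤s lt))

  lookup-inc : ∀ {ℓ} (r : Fin ℓ) μ → lookup (inc r μ) r ≡ suc (lookup μ r)
  lookup-inc r μ = Vec.lookup∘updateAt r μ

  lookup-inc-≢ : ∀ {ℓ} (r r₀ : Fin ℓ) μ → ¬ (r ≡ r₀) → lookup (inc r₀ μ) r ≡ lookup μ r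
  lookup-inc-≢ r r₀ μ r≢ = Vec.lookup∘updateAt′ r r₀ r≢ μ

  lookup-≤-inc : ∀ {ℓ} (r r₀ : Fin ℓ) μ → lookup μ r ≤ lookup (inc r₀ μ) r
  lookup-≤-inc r r₀ μ with r Fin.≟ r₀
  ... | yes refl = ≤-trans (n≤1+n _) (≤-reflexive (sym (lookup-inc r μ)))
  ... | no r≢    = ≤-reflexive (sym (lookup-inc-≢ r r₀ μ r≢))

  -- Abstract, so that it stays intact when matched on by `with`.
  abstract
    isNext? : ∀ {ℓ} (μ : Vec ℕ ℓ) r₀ r a → Dec (r ≡ r₀ × a ≡ lookup μ r₀)
    isNext? μ r₀ r a = (r Fin.≟ r₀) ×-dec (a ≟ lookup μ r₀)

  later : ∀ {ℓ} (μ : Vec ℕ ℓ) r₀ {r a} → lookup μ r ≤ a → ¬ (r ≡ r₀ × a ≡ lookup μ r₀) → lookup (inc r₀ μ) r ≤ a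
  later μ r₀ {r} {a} le ¬next with r Fin.≟ r₀
  ... | yes refl = ≤-trans (≤-reflexive (lookup-inc r μ)) (≤∧≢⇒< le λ e → ¬next (refl , sym e))
  ... | no r≢    = ≤-trans (≤-reflexive (lookup-inc-≢ r r₀ μ r≢)) le

  -- The cells added by the word w to the shape μ are numbered from i + 1 on.
  label : ∀ {ℓ k} → ℕ → Vec ℕ ℓ → Vec (Fin ℓ) k → Fin ℓ → ℕ → ℕ
  label i μ []       r a = 0
  label i μ (r₀ ∷ w) r a = if does (isNext? μ r₀ r a) then suc i else label (suc i) (inc r₀ μ) w r a

  label-next : ∀ {ℓ k} i (μ : Vec ℕ ℓ) r₀ (w : Vec (Fin ℓ) k) → label i μ (r₀ ∷ w) r₀ (lookup μ r₀) ≡ suc i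
  label-next i μ r₀ w with isNext? μ r₀ r₀ (lookup μ r₀)
  ... | yes _  = refl
  ... | no ¬p  = contradiction (refl , refl) ¬p

  label-later : ∀ {ℓ k} i (μ : Vec ℕ ℓ) r₀ (w : Vec (Fin ℓ) k) r a → ¬ (r ≡ r₀ × a ≡ lookup μ r₀) →
    label i μ (r₀ ∷ w) r a ≡ label (suc i) (inc r₀ μ) w r a
  label-later i μ r₀ w r a ¬next with isNext? μ r₀ r a
  ... | yes p = contradiction p ¬next
  ... | no _  = refl

  module Labels {ℓ : ℕ} (c : ℕ) (λ′ : Vec ℕ ℓ) where

    record Reaches {k} (w : Vec (Fin ℓ) k) (μ : Vec ℕ ℓ) : Set where
      constructor reaching
      field
        valid : Valid c μ
        arrives : reaches c λ′ w μ ≡ true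
    open Reaches public

    advance : ∀ {k} {r₀} {w : Vec (Fin ℓ) k} {μ} → Reaches (r₀ ∷ w) μ → Reaches w (inc r₀ μ)
    advance {r₀ = r₀} {w} {μ} (reaching v e) = let (v′ , e′) = step-true r₀ c (reaches c λ′ w) μ v e in reaching v′ e′

    end : ∀ {μ} → Reaches [] μ → μ ≡ λ′
    end {μ} (reaching v e) with Vec.≡-dec _≟_ μ λ′
    ... | yes p = p

    within : ∀ {k} (w : Vec (Fin ℓ) k) μ → Reaches w μ → ∀ r → lookup μ r ≤ lookup λ′ r
    within []       μ R r = ≤-reflexive (cong (λ ν → lookup ν r) (end R))
    within (r₀ ∷ w) μ R r = ≤-trans (lookup-≤-inc r r₀ μ) (within w (inc r₀ μ) (advance R) r)

    InRange : Vec ℕ ℓ → Fin ℓ → ℕ → Set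
    InRange μ r a = lookup μ r ≤ a × a < lookup λ′ r

    -- Every cell of `λ′` outside `μ` is added before the word ends, so the default value 0 of
    -- `label` is never taken for such a cell.
    ¬InRange-end : ∀ {μ r a} → Reaches [] μ → ¬ InRange μ r a
    ¬InRange-end {r = r} R (le , lt) = <⇒≱ lt (≤-trans (≤-reflexive (cong (λ ν → lookup ν r) (sym (end R)))) le)

    label-bounds : ∀ {k} i (w : Vec (Fin ℓ) k) μ → Reaches w μ → ∀ r a → InRange μ r a →
      i < label i μ w r a × label i μ w r a ≤ i + k
    label-bounds i []       μ R r a p = ⊥-elim (¬InRange-end R p)
    label-bounds {suc k} i (r₀ ∷ w) μ R r a (le , lt) with isNext? μ r₀ r a
    ... | yes _    = ≤-refl , ≤-trans (s≤s (m≤m+n i k)) (≤-reflexive (sym (+-suc i k)))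
    ... | no ¬next = let (l , u) = label-bounds (suc i) w (inc r₀ μ) (advance R) r a (later μ r₀ le ¬next , lt)
                     in <-trans ≤-refl l , ≤-trans u (≤-reflexive (sym (+-suc i k)))

    label-injective : ∀ {k} i (w : Vec (Fin ℓ) k) μ → Reaches w μ → ∀ r a r′ a′ → InRange μ r a → InRange μ r′ a′ →
      label i μ w r a ≡ label i μ w r′ a′ → r ≡ r′ × a ≡ a′
    label-injective i []       μ R r a r′ a′ p _ _ = ⊥-elim (¬InRange-end R p)
    label-injective i (r₀ ∷ w) μ R r a r′ a′ (le , lt) (le′ , lt′) e with isNext? μ r₀ r a | isNext? μ r₀ r′ a′
    ... | yes (refl , refl) | yes (refl , refl) = refl , refl
    ... | yes _ | no ¬p  = contradiction e (<⇒≢ (proj₁ (label-bounds (suc i) w (inc r₀ μ) (advance R) r′ a′ (later μ r₀ le′ ¬p , lt′))))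
    ... | no ¬p | yes _  = contradiction (sym e) (<⇒≢ (proj₁ (label-bounds (suc i) w (inc r₀ μ) (advance R) r a (later μ r₀ le ¬p , lt))))
    ... | no ¬p | no ¬p′ = label-injective (suc i) w (inc r₀ μ) (advance R) r a r′ a′ (later μ r₀ le ¬p , lt) (later μ r₀ le′ ¬p′ , lt′) e

    label-row : ∀ {k} i (w : Vec (Fin ℓ) k) μ → Reaches w μ → ∀ r a b → a < b → InRange μ r a → InRange μ r b →
      label i μ w r a < label i μ w r b
    label-row i []       μ R r a b _ p _ = ⊥-elim (¬InRange-end R p)
    label-row i (r₀ ∷ w) μ R r a b a<b (le , lt) (le′ , lt′) with isNext? μ r₀ r a | isNext? μ r₀ r b
    ... | yes (refl , refl) | yes (refl , refl) = contradiction a<b (<-irrefl refl)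
    ... | yes _ | no ¬p  = proj₁ (label-bounds (suc i) w (inc r₀ μ) (advance R) r b (later μ r₀ le′ ¬p , lt′))
    ... | no ¬p | yes (refl , refl) = contradiction (<-≤-trans a<b le) (<-irrefl refl)
    ... | no ¬p | no ¬p′ = label-row (suc i) w (inc r₀ μ) (advance R) r a b a<b (later μ r₀ le ¬p , lt) (later μ r₀ le′ ¬p′ , lt′)

    label-column : ∀ {k} i (w : Vec (Fin ℓ) k) μ → Reaches w μ → ∀ r r′ a → r Fin.< r′ → lookup μ r ≤ a → a < lookup λ′ r′ →
      label i μ w r a < label i μ w r′ a
    label-column i []       μ R r r′ a r<r′ le lt =
      ⊥-elim (¬InRange-end R (≤-trans (Valid-columns c μ (valid R) r r′ r<r′) le , lt))
    label-column i (r₀ ∷ w) μ R r r′ a r<r′ le lt with isNext? μ r₀ r a | isNext? μ r₀ r′ a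
    ... | yes (refl , _) | yes (refl , _) = contradiction r<r′ (<-irrefl refl)
    ... | yes _ | no ¬p  = proj₁ (label-bounds (suc i) w (inc r₀ μ) (advance R) r′ a
                             (later μ r₀ (≤-trans (Valid-columns c μ (valid R) r r′ r<r′) le) ¬p , lt))
    -- The lower cell would be added while the cell above it in the same column is still missing,
    -- and the result would not be a partition.
    ... | no ¬p | yes (refl , refl) = contradiction
            (≤-trans (≤-reflexive (sym (lookup-inc r₀ μ)))
              (≤-trans (Valid-columns c (inc r₀ μ) (valid (advance R)) r r₀ r<r′)
                (later μ r₀ le ¬p))) (<-irrefl refl)
    ... | no ¬p | no _ = label-column (suc i) w (inc r₀ μ) (advance R) r r′ a r<r′ (later μ r₀ le ¬p) lt

    label-exists : ∀ {k} i (w : Vec (Fin ℓ) k) μ → Reaches w μ → ∀ j →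
      ∃[ a ] InRange μ (lookup w j) a × label i μ w (lookup w j) a ≡ suc (i + toℕ j)
    label-exists i (r₀ ∷ w) μ R zero = lookup μ r₀ ,
      (≤-refl , ≤-trans (≤-reflexive (sym (lookup-inc r₀ μ))) (within w (inc r₀ μ) (advance R) r₀)) ,
      trans (label-next i μ r₀ w) (cong suc (sym (+-identityʳ i)))
    label-exists i (r₀ ∷ w) μ R (suc j) with label-exists (suc i) w (inc r₀ μ) (advance R) j
    ... | a , (le , lt) , e = a , (≤-trans (lookup-≤-inc (lookup w j) r₀ μ) le , lt) ,
      trans (label-later i μ r₀ w (lookup w j) a λ { (p , q) →
        <-irrefl refl (≤-trans (≤-reflexive (trans (cong suc q) (sym (trans (cong (lookup (inc r₀ μ)) p) (lookup-inc r₀ μ))))) le) })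
        (trans e (cong suc (sym (+-suc i (toℕ j)))))

  Vec-ext : ∀ {A : Set} {n} {v w : Vec A n} → (∀ i → lookup v i ≡ lookup w i) → v ≡ w
  Vec-ext {v = v} {w} e = trans (sym (Vec.tabulate∘lookup v)) (trans (Vec.tabulate-cong e) (Vec.tabulate∘lookup w))

  vecs-∈ : ∀ {A : Set} {as : List A} {k} (v : Vec A k) → (∀ i → lookup v i ∈ˡ as) → v ∈ˡ vecs as k
  vecs-∈ []      _ = here refl
  vecs-∈ (a ∷ v) e = ∈-cartesianProductWith⁺ _∷_ (e zero) (vecs-∈ v (e ∘ suc))

  ∈-vecs : ∀ {A : Set} {as : List A} {k} (v : Vec A k) → v ∈ˡ vecs as k → ∀ i → lookup v i ∈ˡ as
  ∈-vecs {as = as} {suc k} v v∈ i with ∈-cartesianProductWith⁻ _∷_ as (vecs as k) v∈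
  ∈-vecs v v∈ zero    | a , w , a∈ , w∈ , refl = a∈
  ∈-vecs v v∈ (suc i) | a , w , a∈ , w∈ , refl = ∈-vecs w w∈ i

  vecs-unique : ∀ {A : Set} {as : List A} → Unique as → ∀ k → Unique (vecs as k)
  vecs-unique u zero    = [] ∷ []
  vecs-unique u (suc k) = Unique.cartesianProductWith⁺ _∷_ Vec.∷-injective u (vecs-unique u k)

  fillings-∈ : ∀ {A : Set} {as : List A} {s} (T : Filling A s) → (∀ c → entry T c ∈ˡ as) → T ∈ˡ fillings as s
  fillings-∈ []      _ = here refl
  fillings-∈ (v ∷ T) e =
    ∈-cartesianProductWith⁺ _∷_ (vecs-∈ v (λ c → e (zero , c))) (fillings-∈ T (λ (r , c) → e (suc r , c)))

  ∈-fillings : ∀ {A : Set} {as : List A} {s} (T : Filling A s) → T ∈ˡ fillings as s → ∀ c → entry T c ∈ˡ as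
  ∈-fillings {as = as} {k ∷ s} T T∈ c with ∈-cartesianProductWith⁻ _∷_ (vecs as k) (fillings as s) T∈
  ∈-fillings T T∈ (zero , c)  | v , T′ , v∈ , T′∈ , refl = ∈-vecs v v∈ c
  ∈-fillings T T∈ (suc r , c) | v , T′ , v∈ , T′∈ , refl = ∈-fillings T′ T′∈ (r , c)

  fillings-unique : ∀ {A : Set} {as : List A} → Unique as → ∀ s → Unique (fillings as s)
  fillings-unique u []      = [] ∷ []
  fillings-unique u (k ∷ s) = Unique.cartesianProductWith⁺ _∷_ (λ { refl → refl , refl }) (vecs-unique u k) (fillings-unique u s)

  tabulateFilling : ∀ {A : Set} s → (Cell s → A) → Filling A s
  tabulateFilling []      f = []
  tabulateFilling (k ∷ s) f = tabulate (λ c → f (zero , c)) ∷ tabulateFilling s (λ (r , c) → f (suc r , c))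

  entry-tabulate : ∀ {A : Set} s (f : Cell s → A) c → entry (tabulateFilling s f) c ≡ f c
  entry-tabulate (k ∷ s) f (zero  , c) = Vec.lookup∘tabulate _ c
  entry-tabulate (k ∷ s) f (suc r , c) = entry-tabulate s (λ (r , c) → f (suc r , c)) (r , c)

  Filling-ext : ∀ {A : Set} {s} {T T′ : Filling A s} → (∀ c → entry T c ≡ entry T′ c) → T ≡ T′
  Filling-ext {T = []}    {[]}      e = refl
  Filling-ext {T = v ∷ T} {v′ ∷ T′} e = cong₂ _∷_ (Vec-ext λ c → e (zero , c)) (Filling-ext λ (r , c) → e (suc r , c))

  entry-map : ∀ {A B : Set} {s} (f : A → B) (T : Filling A s) c → entry (mapFilling f T) c ≡ f (entry T c)
  entry-map f (v ∷ T) (zero  , c) = Vec.lookup-map c f v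
  entry-map f (v ∷ T) (suc r , c) = entry-map f T (r , c)

  lookup-fromList : ∀ {A : Set} (s : List A) r → lookup (Vec.fromList s) r ≡ List.lookup s r
  lookup-fromList (k ∷ s) zero    = refl
  lookup-fromList (k ∷ s) (suc r) = lookup-fromList s r

  lookup-≤-sum : ∀ s r → List.lookup s r ≤ sum s
  lookup-≤-sum (k ∷ s) zero    = m≤m+n k (sum s)
  lookup-≤-sum (k ∷ s) (suc r) = ≤-trans (lookup-≤-sum s r) (m≤n+m (sum s) k)

  AllPairs-lookup : ∀ {s} → AllPairs _≥_ s → ∀ r r′ → r Fin.< r′ → List.lookup s r′ ≤ List.lookup s r
  AllPairs-lookup (k≥s ∷ _) zero    (suc r′) _          = All.lookup k≥s (∈-lookup r′)
  AllPairs-lookup (_ ∷ d)   (suc r) (suc r′) (s≤s r<r′) = AllPairs-lookup d r r′ r<r′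

  fromList-sum : ∀ s → Vec.sum (Vec.fromList s) ≡ sum s
  fromList-sum []      = refl
  fromList-sum (k ∷ s) = cong (k +_) (fromList-sum s)

  module Tableaux {n : ℕ} (p : Partition n) where

    s : List ℕ
    s = parts p

    ℓ : ℕ
    ℓ = length s

    shape : Vec ℕ ℓ
    shape = Vec.fromList s

    -- A shape of size `n` has no row longer than `n`, so this bound on the first row excludes
    -- nothing.
    open Labels n shape

    Word : Set
    Word = Vec (Fin ℓ) n

    lattice : Word → Bool
    lattice w = reaches n shape w (zeros ℓ)

    rowLength : ∀ r → lookup shape r ≡ List.lookup s r
    rowLength = lookup-fromList s

    start : ∀ {w} → lattice w ≡ true → Reaches w (zeros ℓ)
    start e = reaching (zeros-Valid ℓ n) e

    lookup-zeros : ∀ r → lookup (zeros ℓ) r ≡ 0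
    lookup-zeros r = Vec.lookup-replicate r 0

    cell-range : ∀ ((r , a) : Cell s) → InRange (zeros ℓ) r (toℕ a)
    cell-range (r , a) = ≤-trans (≤-reflexive (lookup-zeros r)) z≤n , ≤-trans (Fin.toℕ<n a) (≤-reflexive (sym (rowLength r)))

    labelOf : Word → Cell s → ℕ
    labelOf w (r , a) = label 0 (zeros ℓ) w r (toℕ a)

    tableau : Word → Filling ℕ s
    tableau w = tabulateFilling s (labelOf w)

    entry-tableau : ∀ w c → entry (tableau w) c ≡ labelOf w c
    entry-tableau w = entry-tabulate s (labelOf w)

    labelOf-bounds : ∀ w → lattice w ≡ true → ∀ c → 0 < labelOf w c × labelOf w c ≤ n
    labelOf-bounds w e c@(r , a) = label-bounds 0 w (zeros ℓ) (start e) r (toℕ a) (cell-range c)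

    labelOf-injective : ∀ w → lattice w ≡ true → ∀ c d → labelOf w c ≡ labelOf w d → c ≡ d
    labelOf-injective w e c@(r , a) d@(r′ , a′) eq
      with label-injective 0 w (zeros ℓ) (start e) r (toℕ a) r′ (toℕ a′) (cell-range c) (cell-range d) eq
    ... | refl , a≡a′ = cong (r ,_) (Fin.toℕ-injective a≡a′)

    labelOf-exists : ∀ w → lattice w ≡ true → ∀ j → ∃[ a ] labelOf w (lookup w j , a) ≡ suc (toℕ j)
    labelOf-exists w e j with label-exists 0 w (zeros ℓ) (start e) j
    ... | a , (_ , a<) , eq = Fin.fromℕ< a<′ , trans (cong (label 0 (zeros ℓ) w (lookup w j)) (Fin.toℕ-fromℕ< a<′)) eq
      where a<′ = ≤-trans a< (≤-reflexive (rowLength (lookup w j)))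

    labelOf-row : ∀ w → lattice w ≡ true → ∀ r a b → a Fin.< b → labelOf w (r , a) < labelOf w (r , b)
    labelOf-row w e r a b a<b = label-row 0 w (zeros ℓ) (start e) r (toℕ a) (toℕ b) a<b (cell-range (r , a)) (cell-range (r , b))

    labelOf-column : ∀ w → lattice w ≡ true → ∀ (c d : Cell s) → proj₁ c Fin.< proj₁ d → toℕ (proj₂ c) ≡ toℕ (proj₂ d) →
      labelOf w c < labelOf w d
    labelOf-column w e (r , a) (r′ , a′) r<r′ a≡a′ = ≤-trans
      (label-column 0 w (zeros ℓ) (start e) r r′ (toℕ a) r<r′ (proj₁ (cell-range (r , a)))
        (≤-trans (s≤s (≤-reflexive a≡a′)) (proj₂ (cell-range (r′ , a′)))))
      (≤-reflexive (cong (label 0 (zeros ℓ) w r′) a≡a′))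

    -- Recovers the word from its tableau. Both the injectivity of `tableau` and the description of
    -- descents by the letters of the word rest on this.
    labelOf-row-of : ∀ w → lattice w ≡ true → ∀ j (c : Cell s) → labelOf w c ≡ suc (toℕ j) → proj₁ c ≡ lookup w j
    labelOf-row-of w e j c eq = let (a , eq′) = labelOf-exists w e j
      in cong proj₁ (labelOf-injective w e c (_ , a) (trans eq (sym eq′)))

    tableau-IsSYT : ∀ w → lattice w ≡ true → IsSYT n (tableau w)
    tableau-IsSYT w e =
      ( (λ r a b a<b → subst₂ _<_ (sym (entry-tableau w (r , a))) (sym (entry-tableau w (r , b))) (labelOf-row w e r a b a<b))
      , (λ c d r<r′ a≡a′ → subst₂ _<_ (sym (entry-tableau w c)) (sym (entry-tableau w d)) (labelOf-column w e c d r<r′ a≡a′)))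
      , λ i → let (a , eq) = labelOf-exists w e i in
          (lookup w i , a) , trans (entry-tableau w _) eq ,
          λ {c} eq′ → labelOf-injective w e _ c (trans eq (trans (sym eq′) (entry-tableau w c)))

    tableau-∈ : ∀ w → lattice w ≡ true → tableau w ∈ˡ SYT p
    tableau-∈ w e = ∈-filter⁺ (isSYT? n) (fillings-∈ (tableau w) λ c →
        subst (_∈ˡ ⟦1⋯ n ⟧) (sym (entry-tableau w c)) (in-range (labelOf-bounds w e c)))
      (tableau-IsSYT w e)
      where
      in-range : ∀ {m} → 0 < m × m ≤ n → m ∈ˡ ⟦1⋯ n ⟧
      in-range {suc m} (_ , m<n) = ∈-map⁺ suc (∈-upTo⁺ m<n)

    tableau-injective : ∀ w w′ → lattice w ≡ true → lattice w′ ≡ true → tableau w ≡ tableau w′ → w ≡ w′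
    tableau-injective w w′ e e′ eq = Vec-ext λ j → let (a , eq₁) = labelOf-exists w e j in
      labelOf-row-of w′ e′ j (lookup w j , a) (trans (sym (entry-tableau w′ _))
        (trans (cong (λ T → entry T (lookup w j , a)) (sym eq)) (trans (entry-tableau w _) eq₁)))

    -- The lattice word of a standard tableau

    module _ (T : Filling ℕ s) (T-SYT : IsSYT n T) (T-bounds : ∀ c → 0 < entry T c × entry T c ≤ n) where

      -- Expresses that the cells with entries at most `i` are exactly the cells of `μ`.
      record Invariant (i : ℕ) (μ : Vec ℕ ℓ) : Set where
        field
          valid   : Valid n μ
          fits    : ∀ r → lookup μ r ≤ List.lookup s r
          inside  : ∀ r a → entry T (r , a) ≤ i → toℕ a < lookup μ r
          outside : ∀ r a → toℕ a < lookup μ r → entry T (r , a) ≤ i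
      open Invariant

      module _ {i : ℕ} {μ : Vec ℕ ℓ} (I : Invariant i μ) (i<n : i < n) where

        next : ∃[ c ] entry T c ≡ suc i
        next = let (c , e , _) = proj₂ T-SYT (Fin.fromℕ< i<n) in c , trans e (cong suc (Fin.toℕ-fromℕ< i<n))

        r₀ : Fin ℓ
        r₀ = proj₁ (proj₁ next)

        a₀ : Fin (List.lookup s r₀)
        a₀ = proj₂ (proj₁ next)

        entry₀ : entry T (r₀ , a₀) ≡ suc i
        entry₀ = proj₂ next

        only : ∀ c → entry T c ≡ suc i → c ≡ (r₀ , a₀)
        only c e = let (d , _ , u) = proj₂ T-SYT (Fin.fromℕ< i<n)
                       e′ = λ {c} (e : entry T c ≡ suc i) → trans e (cong suc (sym (Fin.toℕ-fromℕ< i<n)))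
                   in trans (sym (u {c} (e′ e))) (u {r₀ , a₀} (e′ entry₀))

        -- The cells to the left of `suc i` have smaller entries and so already belong to `μ`, while
        -- the cell of `suc i` itself does not.
        a₀≡ : toℕ a₀ ≡ lookup μ r₀
        a₀≡ = ≤-antisym (≮⇒≥ λ μ<a₀ →
            let a = Fin.fromℕ< (<-trans μ<a₀ (Fin.toℕ<n a₀))
                a≡ = Fin.toℕ-fromℕ< (<-trans μ<a₀ (Fin.toℕ<n a₀))
                lt = proj₁ (proj₁ T-SYT) r₀ a a₀ (≤-trans (s≤s (≤-reflexive a≡)) μ<a₀)
            in <-irrefl a≡ (inside I r₀ a (≤-pred (≤-trans lt (≤-reflexive entry₀)))))
          (≮⇒≥ λ a₀<μ → <-irrefl refl (≤-trans (≤-reflexive (sym entry₀)) (outside I r₀ a₀ a₀<μ)))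

        -- The cell in row `r` above the one of `suc i` exists because the parts decrease weakly,
        -- and it lies in `μ` because its entry is smaller.
        above : ∀ r → r Fin.< r₀ → suc (lookup μ r₀) ≤ lookup μ r
        above r r<r₀ = ≤-trans (s≤s (≤-reflexive (trans (sym a₀≡) (sym a≡))))
            (inside I r a (≤-pred (≤-trans (proj₂ (proj₁ T-SYT) (r , a) (r₀ , a₀) r<r₀ a≡) (≤-reflexive entry₀))))
          where
          a₀< : toℕ a₀ < List.lookup s r
          a₀< = ≤-trans (Fin.toℕ<n a₀) (AllPairs-lookup (Linked⇒AllPairs (λ k≥l l≥m → ≤-trans l≥m k≥l) (decreasing p)) r r₀ r<r₀)
          a = Fin.fromℕ< a₀<
          a≡ : toℕ a ≡ toℕ a₀
          a≡ = Fin.toℕ-fromℕ< a₀<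

        advanceInvariant : Invariant (suc i) (inc r₀ μ)
        advanceInvariant = record
          { valid   = columns-Valid n (inc r₀ μ) (λ r → ≤-trans (fits′ r) (≤-trans (lookup-≤-sum s r) (≤-reflexive (size p)))) columns′
          ; fits    = fits′
          ; inside  = inside′
          ; outside = outside′
          }
          where
          fits′ : ∀ r → lookup (inc r₀ μ) r ≤ List.lookup s r
          fits′ r with r Fin.≟ r₀
          ... | yes refl = ≤-trans (≤-reflexive (trans (lookup-inc r₀ μ) (cong suc (sym a₀≡)))) (Fin.toℕ<n a₀)
          ... | no r≢    = ≤-trans (≤-reflexive (lookup-inc-≢ r r₀ μ r≢)) (fits I r)
          columns′ : ∀ r r′ → r Fin.< r′ → lookup (inc r₀ μ) r′ ≤ lookup (inc r₀ μ) r
          columns′ r r′ r<r′ with r′ Fin.≟ r₀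
          ... | yes refl = ≤-trans (≤-reflexive (lookup-inc r₀ μ)) (≤-trans (above r r<r′) (lookup-≤-inc r r₀ μ))
          ... | no r′≢   = ≤-trans (≤-reflexive (lookup-inc-≢ r′ r₀ μ r′≢))
                             (≤-trans (Valid-columns n μ (valid I) r r′ r<r′) (lookup-≤-inc r r₀ μ))
          inside′ : ∀ r a → entry T (r , a) ≤ suc i → toℕ a < lookup (inc r₀ μ) r
          inside′ r a le with entry T (r , a) ≟ suc i
          ... | no ≢ = ≤-trans (inside I r a (≤-pred (≤∧≢⇒< le ≢))) (lookup-≤-inc r r₀ μ)
          ... | yes e with only (r , a) e
          ...   | refl = ≤-reflexive (trans (cong suc a₀≡) (sym (lookup-inc r₀ μ)))
          outside′ : ∀ r a → toℕ a < lookup (inc r₀ μ) r → entry T (r , a) ≤ suc i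
          outside′ r a lt with toℕ a <? lookup μ r
          ... | yes a<μ = ≤-trans (outside I r a a<μ) (n≤1+n i)
          ... | no a≮μ with r Fin.≟ r₀
          ...   | no r≢    = contradiction (≤-trans lt (≤-reflexive (lookup-inc-≢ r r₀ μ r≢))) a≮μ
          ...   | yes refl with Fin.toℕ-injective {i = a} {a₀} (trans (≤-antisym (≤-pred (≤-trans lt (≤-reflexive (lookup-inc r₀ μ)))) (≮⇒≥ a≮μ)) (sym a₀≡))
          ...     | refl = ≤-reflexive entry₀

      -- Places the entries from `i + 1` to `n` one by one. Agreement with `T` is claimed for the
      -- cells outside `μ` only, since these are the ones that `label` numbers.
      readWord : ∀ k i μ → i + k ≡ n → Invariant i μ → Σ[ w ∈ Vec (Fin ℓ) k ]
        reaches n shape w μ ≡ true × (∀ r (a : Fin (List.lookup s r)) → lookup μ r ≤ toℕ a → label i μ w r (toℕ a) ≡ entry T (r , a))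
      readWord zero i μ e I = [] , full (Vec.≡-dec _≟_ μ shape) , λ r a le →
          contradiction (inside I r a (≤-trans (proj₂ (T-bounds (r , a))) (≤-reflexive (sym i≡n)))) (≤⇒≯ le)
        where
        i≡n : i ≡ n
        i≡n = trans (sym (+-identityʳ i)) e
        μ≡shape : μ ≡ shape
        μ≡shape = Vec-ext λ r → trans (≤-antisym (fits I r) (≮⇒≥ λ lt →
            <-irrefl (Fin.toℕ-fromℕ< lt) (inside I r (Fin.fromℕ< lt) (≤-trans (proj₂ (T-bounds (r , _))) (≤-reflexive (sym i≡n))))))
          (sym (rowLength r))
        full : (d : Dec (μ ≡ shape)) → does d ≡ true
        full (yes _) = refl
        full (no ≢)  = contradiction μ≡shape ≢
      readWord (suc k) i μ e I = prepend (readWord k (suc i) (inc (r₀ I i<n) μ) (trans (sym (+-suc i k)) e) (advanceInvariant I i<n))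
        where
        i<n : i < n
        i<n = ≤-trans (s≤s (m≤m+n i k)) (≤-reflexive (trans (sym (+-suc i k)) e))
        prepend : _ → _
        prepend (w , R , agree) = r₀ I i<n ∷ w ,
          true-step (r₀ I i<n) n (reaches n shape w) μ (valid (advanceInvariant I i<n)) R ,
          λ r a le → agree′ w agree r a le (isNext? μ (r₀ I i<n) r (toℕ a))
          where
          agree′ : ∀ w → (∀ r (a : Fin (List.lookup s r)) → lookup (inc (r₀ I i<n) μ) r ≤ toℕ a →
                     label (suc i) (inc (r₀ I i<n) μ) w r (toℕ a) ≡ entry T (r , a)) →
                   ∀ r (a : Fin (List.lookup s r)) → lookup μ r ≤ toℕ a → Dec (r ≡ r₀ I i<n × toℕ a ≡ lookup μ (r₀ I i<n)) →
                   label i μ (r₀ I i<n ∷ w) r (toℕ a) ≡ entry T (r , a)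
          agree′ w agree r a le (no ¬next) = trans (label-later i μ (r₀ I i<n) w r (toℕ a) ¬next) (agree r a (later μ (r₀ I i<n) le ¬next))
          agree′ w agree r a le (yes (refl , a≡)) with Fin.toℕ-injective {i = a} {a₀ I i<n} (trans a≡ (sym (a₀≡ I i<n)))
          ... | refl = trans (cong (label i μ (r₀ I i<n ∷ w) (r₀ I i<n)) a≡) (trans (label-next i μ (r₀ I i<n) w) (sym (entry₀ I i<n)))

      wordOf : ∃[ w ] lattice w ≡ true × T ≡ tableau w
      wordOf with readWord n 0 (zeros ℓ) refl record
        { valid   = zeros-Valid ℓ n
        ; fits    = λ r → ≤-trans (≤-reflexive (lookup-zeros r)) z≤n
        ; inside  = λ r a le → contradiction (≤-trans (proj₁ (T-bounds (r , a))) le) λ ()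
        ; outside = λ r a lt → contradiction (≤-trans lt (≤-reflexive (lookup-zeros r))) λ ()
        }
      ... | w , R , agree = w , R , Filling-ext λ c → trans (sym (agree (proj₁ c) (proj₂ c) (proj₁ (cell-range c)))) (sym (entry-tableau w c))

  does-≡ : ∀ {P : Set} (P? : Dec P) {b} → (P → b ≡ true) → (b ≡ true → P) → does P? ≡ b
  does-≡ (yes p) f g = sym (f p)
  does-≡ (no ¬p) {false} f g = refl
  does-≡ (no ¬p) {true}  f g = contradiction (g refl) ¬p

  unique-map : ∀ {A B : Set} {ys : List B} (f : B → A) → (∀ {y y′} → y ∈ˡ ys → y′ ∈ˡ ys → f y ≡ f y′ → y ≡ y′) →
    Unique ys → Unique (map f ys)
  unique-map f inj []        = []
  unique-map f inj (y∉ ∷ u) = All.map⁺ (All.tabulate λ y′∈ e → All.lookup y∉ y′∈ (inj (here refl) (there y′∈) e))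
    ∷ unique-map f (λ y∈ y′∈ → inj (there y∈) (there y′∈)) u

  -- Lists without repetitions and with the same members are permutations of each other. This
  -- transports the sums over tableaux to sums over words.
  unique-image-↭ : ∀ {A B : Set} {xs : List A} {ys : List B} (f : B → A) →
    (∀ {y y′} → y ∈ˡ ys → y′ ∈ˡ ys → f y ≡ f y′ → y ≡ y′) →
    Unique xs → Unique ys → (∀ {y} → y ∈ˡ ys → f y ∈ˡ xs) → (∀ {x} → x ∈ˡ xs → ∃[ y ] y ∈ˡ ys × x ≡ f y) →
    xs ↭ map f ys
  unique-image-↭ {xs = xs} {ys} f inj u u′ to from = ∼bag⇒↭ (unique∧set⇒bag u (unique-map f inj u′)
    (mk⇔ (λ x∈ → let (y , y∈ , e) = from x∈ in subst (_∈ˡ map f ys) (sym e) (∈-map⁺ f y∈))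
         (λ x∈ → let (y , y∈ , e) = ∈-map⁻ f x∈ in subst (_∈ˡ xs) (sym e) (to y∈))))

  -- Signed letters and signed tableaux

  mkLetter : Bool → ℕ → Letter
  mkLetter false = pos
  mkLetter true  = neg

  mkLetter-injective : ∀ {b b′ k k′} → mkLetter b k ≡ mkLetter b′ k′ → b ≡ b′ × k ≡ k′
  mkLetter-injective {false} {false} refl = refl , refl
  mkLetter-injective {true}  {true}  refl = refl , refl

  letter-view : ∀ a → ∃[ b ] ∃[ k ] a ≡ mkLetter b k
  letter-view (pos k) = false , k , refl
  letter-view (neg k) = true  , k , refl

  value-mk : ∀ b k → value (mkLetter b k) ≡ suc k
  value-mk false k = refl
  value-mk true  k = refl

  rank-mk-≤ : ∀ b k → rank (mkLetter b k) ≤ suc (2 * k)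
  rank-mk-≤ false k = n≤1+n _
  rank-mk-≤ true  k = ≤-refl

  rank-mk-≥ : ∀ b k → 2 * k ≤ rank (mkLetter b k)
  rank-mk-≥ false k = ≤-refl
  rank-mk-≥ true  k = n≤1+n _

  suc-2*-≤ : ∀ {k k′} → k < k′ → suc (suc (2 * k)) ≤ 2 * k′
  suc-2*-≤ {k} {k′} k<k′ = ≤-trans (≤-reflexive (sym (*-suc 2 k))) (*-monoʳ-≤ 2 k<k′)

  rank-< : ∀ b b′ {k k′} → k < k′ → rank (mkLetter b k) < rank (mkLetter b′ k′)
  rank-< b b′ {k} {k′} k<k′ = ≤-trans (s≤s (rank-mk-≤ b k)) (≤-trans (suc-2*-≤ k<k′) (rank-mk-≥ b′ k′))

  rank-≤⇒ : ∀ b b′ {k k′} → rank (mkLetter b k) ≤ rank (mkLetter b′ k′) → k ≤ k′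
  rank-≤⇒ b b′ {k} {k′} le = ≮⇒≥ λ k′<k → <-irrefl refl (≤-trans (rank-< b′ b k′<k) le)

  ∈-letters⁺ : ∀ {n} b {k} → k < n → mkLetter b k ∈ˡ letters n
  ∈-letters⁺ false k<n = ∈-concat⁺′ (here refl) (∈-map⁺ _ (∈-upTo⁺ k<n))
  ∈-letters⁺ true  k<n = ∈-concat⁺′ (there (here refl)) (∈-map⁺ _ (∈-upTo⁺ k<n))

  ∈-letters⁻ : ∀ {n a} → a ∈ˡ letters n → ∃[ b ] ∃[ k ] k < n × a ≡ mkLetter b k
  ∈-letters⁻ {n} a∈ with ∈-concat⁻′ (map (λ k → pos k ∷ neg k ∷ []) (upTo n)) a∈
  ... | _ , a∈ks , ks∈ with ∈-map⁻ (λ k → pos k ∷ neg k ∷ []) ks∈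
  ∈-letters⁻ a∈ | _ , here refl         , ks∈ | k , k∈ , refl = false , k , ∈-upTo⁻ k∈ , refl
  ∈-letters⁻ a∈ | _ , there (here refl) , ks∈ | k , k∈ , refl = true  , k , ∈-upTo⁻ k∈ , refl

  letters-unique : ∀ n → Unique (letters n)
  letters-unique n = Unique.concat⁺
    (All.map⁺ (All.universal (λ k → ((λ ()) ∷ []) ∷ [] ∷ []) (upTo n)))
    (AllPairs.map⁺ (AllPairs.map disjoint (Unique.upTo⁺ n)))
    where
    disjoint : ∀ {j k} → ¬ (j ≡ k) → ∀ {a} → ¬ (a ∈ˡ pos j ∷ neg j ∷ [] × a ∈ˡ pos k ∷ neg k ∷ [])
    disjoint j≢k (here refl         , here refl)         = j≢k refl
    disjoint j≢k (there (here refl) , there (here refl)) = j≢k refl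
    disjoint j≢k (here refl         , there (here ()))
    disjoint j≢k (there (here refl) , here ())
    disjoint j≢k (there (here refl) , there (there ()))

  cellIndex : ∀ s → Cell s → Fin (sum s)
  cellIndex (k ∷ s) (zero  , a) = a ↑ˡ sum s
  cellIndex (k ∷ s) (suc r , a) = k ↑ʳ cellIndex s (r , a)

  cellIndex-injective : ∀ s c d → cellIndex s c ≡ cellIndex s d → c ≡ d
  cellIndex-injective (k ∷ s) (zero  , a) (zero   , a′) e = cong (zero ,_) (Fin.↑ˡ-injective (sum s) a a′ e)
  cellIndex-injective (k ∷ s) (suc r , a) (suc r′ , a′) e
    with cellIndex-injective s (r , a) (r′ , a′) (Fin.↑ʳ-injective k _ _ e)
  ... | refl = refl
  cellIndex-injective (k ∷ s) (zero  , a) (suc r , a′) e =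
    contradiction (trans (sym (Fin.splitAt-↑ˡ k a (sum s))) (trans (cong (splitAt k) e) (Fin.splitAt-↑ʳ k (sum s) (cellIndex s (r , a′))))) λ ()
  cellIndex-injective (k ∷ s) (suc r , a) (zero  , a′) e =
    contradiction (trans (sym (Fin.splitAt-↑ˡ k a′ (sum s))) (trans (cong (splitAt k) (sym e)) (Fin.splitAt-↑ʳ k (sum s) (cellIndex s (r , a))))) λ ()

  -- Pigeonhole: if c and d carried the same value, the n values would occur on the
  -- cells other than d.
  onto⇒injective : ∀ {n} s → sum s ≡ n → (f : Cell s → Fin n) → (∀ i → ∃[ c ] f c ≡ i) → ∀ c d → f c ≡ f d → c ≡ d
  onto⇒injective {n} s refl f onto c d fc≡fd with _≟ᶜ_ {s} c d
  ... | yes c≡d = c≡d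
  ... | no c≢d  = ⊥-elim (collision (Fin.pigeonhole ≤-refl g))
    where
    choose : ∀ i → ∃[ e ] f e ≡ i × ¬ (e ≡ d)
    choose i with i Fin.≟ f c
    ... | yes refl = c , refl , c≢d
    ... | no i≢fc  = let (e , fe≡i) = onto i in e , fe≡i , λ e≡d → i≢fc (trans (sym fe≡i) (trans (cong f e≡d) (sym fc≡fd)))
    g : Fin (suc n) → Fin n
    g zero    = cellIndex s d
    g (suc i) = cellIndex s (proj₁ (choose i))
    collision : ¬ (∃[ i ] ∃[ j ] i Fin.< j × g i ≡ g j)
    collision (zero  , suc j , _       , e) = proj₂ (proj₂ (choose j)) (sym (cellIndex-injective s d _ e))
    collision (suc i , suc j , s≤s i<j , e) = <-irrefl (cong toℕ
      (trans (sym (proj₁ (proj₂ (choose i)))) (trans (cong f (cellIndex-injective s _ _ e)) (proj₁ (proj₂ (choose j)))))) i<j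

  signAt : ∀ {n} → Vec Bool n → ℕ → Bool
  signAt []      k       = false
  signAt (b ∷ σ) zero    = b
  signAt (b ∷ σ) (suc k) = signAt σ k

  signAt-lookup : ∀ {n} (σ : Vec Bool n) i → signAt σ (toℕ i) ≡ lookup σ i
  signAt-lookup (b ∷ σ) zero    = refl
  signAt-lookup (b ∷ σ) (suc i) = signAt-lookup σ i

  -- Entries of tableaux start at 1, letters at 0; the value at 0 is junk.
  signedLetter : ∀ {n} → Vec Bool n → ℕ → Letter
  signedLetter σ zero    = pos 0
  signedLetter σ (suc k) = mkLetter (signAt σ k) k

  module SignedTableaux {n : ℕ} (p : Partition n) where
    open Tableaux p public

    words : List Word
    words = vecs (allFin ℓ) n

    lattice? : Decidable (λ w → lattice w ≡ true)
    lattice? w = lattice w Data.Bool.≟ true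

    SYT-bounds : ∀ {T} → T ∈ˡ SYT p → ∀ c → 0 < entry T c × entry T c ≤ n
    SYT-bounds {T} T∈ c with ∈-map⁻ suc (∈-fillings T (proj₁ (∈-filter⁻ (isSYT? n) T∈)) c)
    ... | k , k∈ , e = subst (0 <_) (sym e) (s≤s z≤n) , subst (_≤ n) (sym e) (∈-upTo⁻ k∈)

    SYT-word : ∀ {T} → T ∈ˡ SYT p → ∃[ w ] lattice w ≡ true × T ≡ tableau w
    SYT-word {T} T∈ = wordOf T (proj₂ (∈-filter⁻ (isSYT? n) {xs = fillings ⟦1⋯ n ⟧ s} T∈)) (SYT-bounds T∈)

    words-unique : Unique words
    words-unique = vecs-unique (Unique.allFin⁺ ℓ) n

    ∈-words : ∀ w → w ∈ˡ words
    ∈-words w = vecs-∈ w (λ i → ∈-allFin _)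

    ∈-lattice : ∀ {w} → w ∈ˡ filter lattice? words → lattice w ≡ true
    ∈-lattice w∈ = proj₂ (∈-filter⁻ lattice? {xs = words} w∈)

    SYT-↭ : SYT p ↭ map tableau (filter lattice? words)
    SYT-↭ = unique-image-↭ tableau
      (λ {w} {w′} w∈ w′∈ → tableau-injective w w′ (∈-lattice w∈) (∈-lattice w′∈))
      (Unique.filter⁺ (isSYT? n) (fillings-unique (Unique.map⁺ suc-injective (Unique.upTo⁺ n)) s))
      (Unique.filter⁺ lattice? words-unique)
      (λ {w} w∈ → tableau-∈ w (∈-lattice w∈))
      (λ T∈ → let (w , e , eq) = SYT-word T∈ in w , ∈-filter⁺ lattice? (∈-words w) e , eq)

    signed : Word → Vec Bool n → Filling Letter s
    signed w σ = tabulateFilling s (λ c → signedLetter σ (labelOf w c))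

    entry-signed : ∀ w σ c → entry (signed w σ) c ≡ signedLetter σ (labelOf w c)
    entry-signed w σ = entry-tabulate s (λ c → signedLetter σ (labelOf w c))

    signed₊ : ∀ w σ → lattice w ≡ true → signed w σ ₊ ≡ tableau w
    signed₊ w σ e = Filling-ext λ c → trans (entry-map value (signed w σ) c)
        (trans (cong value (entry-signed w σ c)) (trans (value-label (proj₁ (labelOf-bounds w e c))) (sym (entry-tableau w c))))
      where
      value-label : ∀ {m} → 0 < m → value (signedLetter σ m) ≡ m
      value-label {suc k} _ = value-mk (signAt σ k) k

    signed-at : ∀ w σ → lattice w ≡ true → ∀ j → ∃[ c ] proj₁ c ≡ lookup w j × entry (signed w σ) c ≡ mkLetter (lookup σ j) (toℕ j)
    signed-at w σ e j = let (a , eq) = labelOf-exists w e j in (lookup w j , a) , refl ,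
      trans (entry-signed w σ _) (trans (cong (signedLetter σ) eq) (cong (λ b → mkLetter b (toℕ j)) (signAt-lookup σ j)))

    label-sign : ∀ w σ → lattice w ≡ true → ∀ c b k → entry (signed w σ) c ≡ mkLetter b k → labelOf w c ≡ suc k × b ≡ signAt σ k
    label-sign w σ e c b k eq = by (labelOf w c) (proj₁ (labelOf-bounds w e c)) (trans (sym (entry-signed w σ c)) eq)
      where
      by : ∀ m → 0 < m → signedLetter σ m ≡ mkLetter b k → m ≡ suc k × b ≡ signAt σ k
      by (suc m) _ eq with mkLetter-injective {signAt σ m} {b} eq
      ... | refl , refl = refl , refl

    occurs-sign : ∀ w σ → lattice w ≡ true → ∀ j b → mkLetter b (toℕ j) occursIn signed w σ → b ≡ lookup σ j
    occurs-sign w σ e j b (c , eq) = trans (proj₂ (label-sign w σ e c b (toℕ j) eq)) (signAt-lookup σ j)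

    sign-occurs : ∀ w σ → lattice w ≡ true → ∀ j → mkLetter (lookup σ j) (toℕ j) occursIn signed w σ
    sign-occurs w σ e j = let (c , _ , eq) = signed-at w σ e j in c , eq

    signed-IsSYT± : ∀ w σ → lattice w ≡ true → IsSYT± n (signed w σ)
    signed-IsSYT± w σ e =
      ( (λ r a b a<b → increase (r , a) (r , b) (labelOf-row w e r a b a<b))
      , (λ c d r<r′ a≡ → increase c d (labelOf-column w e c d r<r′ a≡)))
      , λ i → occurrence i (lookup σ i) refl
      where
      signedLetter-< : ∀ {m m′} → 0 < m → m < m′ → rank (signedLetter σ m) < rank (signedLetter σ m′)
      signedLetter-< {suc k} {suc k′} _ (s≤s k<k′) = rank-< (signAt σ k) (signAt σ k′) k<k′
      increase : ∀ c d → labelOf w c < labelOf w d → entry (signed w σ) c <ᴸ entry (signed w σ) d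
      increase c d lt = subst₂ _<ᴸ_ (sym (entry-signed w σ c)) (sym (entry-signed w σ d))
        (signedLetter-< (proj₁ (labelOf-bounds w e c)) lt)
      occurrence : ∀ i b → lookup σ i ≡ b →
          (pos (toℕ i) occursIn signed w σ × ¬ (neg (toℕ i) occursIn signed w σ))
        ⊎ (¬ (pos (toℕ i) occursIn signed w σ) × neg (toℕ i) occursIn signed w σ)
      occurrence i false eq = inj₁ (subst (λ b → mkLetter b (toℕ i) occursIn signed w σ) eq (sign-occurs w σ e i)
        , λ o → true≢false (sym (occurs-sign w σ e i true o)) eq)
      occurrence i true  eq = inj₂ ((λ o → true≢false eq (sym (occurs-sign w σ e i false o)))
        , subst (λ b → mkLetter b (toℕ i) occursIn signed w σ) eq (sign-occurs w σ e i))

    signed-∈ : ∀ w σ → lattice w ≡ true → signed w σ ∈ˡ SYT± p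
    signed-∈ w σ e = ∈-filter⁺ (isSYT±? n) (fillings-∈ (signed w σ) λ c →
        subst (_∈ˡ letters n) (sym (entry-signed w σ c)) (in-range (labelOf-bounds w e c)))
      (signed-IsSYT± w σ e)
      where
      in-range : ∀ {m} → 0 < m × m ≤ n → signedLetter σ m ∈ˡ letters n
      in-range {suc k} (_ , k<n) = ∈-letters⁺ (signAt σ k) k<n

    signed-injective : ∀ w σ w′ σ′ → lattice w ≡ true → lattice w′ ≡ true → signed w σ ≡ signed w′ σ′ → w ≡ w′ × σ ≡ σ′
    signed-injective w σ w′ σ′ e e′ eq =
      tableau-injective w w′ e e′ (trans (sym (signed₊ w σ e)) (trans (cong _₊ eq) (signed₊ w′ σ′ e′))) ,
      Vec-ext λ j → let (c , _ , at) = signed-at w σ e j in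
        trans (proj₂ (label-sign w′ σ′ e′ c (lookup σ j) (toℕ j) (trans (cong (λ T → entry T c) (sym eq)) at))) (signAt-lookup σ′ j)

    module _ {𝒯 : Filling Letter s} (𝒯∈ : 𝒯 ∈ˡ SYT± p) where

      private
        𝒯-SYT± : IsSYT± n 𝒯
        𝒯-SYT± = proj₂ (∈-filter⁻ (isSYT±? n) {xs = fillings (letters n) s} 𝒯∈)

      view : ∀ c → ∃[ b ] ∃[ k ] k < n × entry 𝒯 c ≡ mkLetter b k
      view c = ∈-letters⁻ (∈-fillings 𝒯 (proj₁ (∈-filter⁻ (isSYT±? n) {xs = fillings (letters n) s} 𝒯∈)) c)

      private
        number : ∀ c → Fin n
        number c = Fin.fromℕ< (proj₁ (proj₂ (proj₂ (view c))))

        number-value : ∀ c → suc (toℕ (number c)) ≡ value (entry 𝒯 c)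
        number-value c = let (b , k , k<n , eq) = view c in
          trans (cong suc (Fin.toℕ-fromℕ< k<n)) (trans (sym (value-mk b k)) (cong value (sym eq)))

        value-occurs : ∀ i → ∃[ c ] value (entry 𝒯 c) ≡ suc (toℕ i)
        value-occurs i with proj₂ 𝒯-SYT± i
        ... | inj₁ ((c , eq) , _) = c , cong value eq
        ... | inj₂ (_ , (c , eq)) = c , cong value eq

        -- `IsSYT±` says which letters occur, not how often. That no value is repeated follows by
        -- counting: there are `n` cells and all `n` values occur.
        value-injective : ∀ c d → value (entry 𝒯 c) ≡ value (entry 𝒯 d) → c ≡ d
        value-injective c d eq = onto⇒injective s (size p) number
          (λ i → let (c , e) = value-occurs i in c , Fin.toℕ-injective (suc-injective (trans (number-value c) e)))
          c d (Fin.toℕ-injective (suc-injective (trans (number-value c) (trans eq (sym (number-value d))))))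

        -- Strictly increasing letters may still be `pos k` and `neg k`, with equal values;
        -- injectivity of the values on the cells rules this out.
        value-< : ∀ c d → ¬ (c ≡ d) → entry 𝒯 c <ᴸ entry 𝒯 d → value (entry 𝒯 c) < value (entry 𝒯 d)
        value-< c d c≢d lt with view c | view d
        ... | b , k , _ , eq | b′ , k′ , _ , eq′ = ≤∧≢⇒< le (λ e → c≢d (value-injective c d e))
          where
          le : value (entry 𝒯 c) ≤ value (entry 𝒯 d)
          le = subst₂ _≤_ (sym (trans (cong value eq) (value-mk b k))) (sym (trans (cong value eq′) (value-mk b′ k′)))
            (s≤s (rank-≤⇒ b b′ (<⇒≤ (subst₂ _<_ (cong rank eq) (cong rank eq′) lt))))

      positive-∈ : 𝒯 ₊ ∈ˡ SYT p
      positive-∈ = ∈-filter⁺ (isSYT? n) (fillings-∈ (𝒯 ₊) λ c → subst (_∈ˡ ⟦1⋯ n ⟧)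
          (trans (number-value c) (sym (entry-map value 𝒯 c))) (∈-map⁺ suc (∈-upTo⁺ (Fin.toℕ<n (number c)))))
        ( ( (λ r a b a<b → transport (r , a) (r , b) (value-< (r , a) (r , b) (λ { refl → <-irrefl refl a<b }) (proj₁ (proj₁ 𝒯-SYT±) r a b a<b)))
          , (λ c d r<r′ a≡ → transport c d (value-< c d (λ { refl → <-irrefl refl r<r′ }) (proj₂ (proj₁ 𝒯-SYT±) c d r<r′ a≡))))
        , λ i → let (c , eq) = value-occurs i in c , trans (entry-map value 𝒯 c) eq ,
            λ {d} eq′ → value-injective c d (trans eq (sym (trans (sym (entry-map value 𝒯 d)) eq′))))
        where
        transport : ∀ c d → value (entry 𝒯 c) < value (entry 𝒯 d) → entry (𝒯 ₊) c < entry (𝒯 ₊) d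
        transport c d = subst₂ _<_ (sym (entry-map value 𝒯 c)) (sym (entry-map value 𝒯 d))

      signs : Vec Bool n
      signs = tabulate (λ i → does (occursIn? _≟ᴸ_ (neg (toℕ i)) 𝒯))

      private
        sign-of : ∀ c b k → k < n → entry 𝒯 c ≡ mkLetter b k → b ≡ signAt signs k
        sign-of c b k k<n eq = trans (by (occursIn? _≟ᴸ_ (neg (toℕ i)) 𝒯) b (trans eq (cong (mkLetter b) (sym i≡k))) (proj₂ 𝒯-SYT± i))
            (trans (sym (trans (signAt-lookup signs i) (Vec.lookup∘tabulate _ i))) (cong (signAt signs) i≡k))
          where
          i = Fin.fromℕ< k<n
          i≡k : toℕ i ≡ k
          i≡k = Fin.toℕ-fromℕ< k<n
          by : (d : Dec (neg (toℕ i) occursIn 𝒯)) → ∀ b → entry 𝒯 c ≡ mkLetter b (toℕ i) →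
            (pos (toℕ i) occursIn 𝒯 × ¬ (neg (toℕ i) occursIn 𝒯)) ⊎ (¬ (pos (toℕ i) occursIn 𝒯) × neg (toℕ i) occursIn 𝒯) →
            b ≡ does d
          by (yes _)  true  _  _               = refl
          by (no ¬o)  true  e  _               = contradiction (c , e) ¬o
          by (yes o)  false e  (inj₁ (_ , ¬o)) = contradiction o ¬o
          by (yes o)  false e  (inj₂ (¬o , _)) = contradiction (c , e) ¬o
          by (no _)   false _  _               = refl

        agrees : ∀ w → 𝒯 ₊ ≡ tableau w → ∀ c → entry 𝒯 c ≡ entry (signed w signs) c
        agrees w eq c = let (b , k , k<n , eq′) = view c in
          trans eq′ (trans (cong (λ b → mkLetter b k) (sign-of c b k k<n eq′))
            (trans (cong (signedLetter signs) (label-value b k eq′)) (sym (entry-signed w signs c))))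
          where
          label-value : ∀ b k → entry 𝒯 c ≡ mkLetter b k → suc k ≡ labelOf w c
          label-value b k eq′ = trans (sym (trans (cong value eq′) (value-mk b k))) (trans (sym (entry-map value 𝒯 c))
            (trans (cong (λ T → entry T c) eq) (entry-tableau w c)))

      SYT±-word : ∃[ w ] lattice w ≡ true × 𝒯 ≡ signed w signs
      SYT±-word = let (w , e , eq) = SYT-word positive-∈ in w , e , Filling-ext (agrees w eq)

    signedWords : List (Word × Vec Bool n)
    signedWords = cartesianProductWith _,_ (filter lattice? words) (vecs bools n)

    SYT±-↭ : SYT± p ↭ map (λ (w , σ) → signed w σ) signedWords
    SYT±-↭ = unique-image-↭ (λ (w , σ) → signed w σ)
      (λ {(w , σ)} {(w′ , σ′)} wσ∈ w′σ′∈ eq → let (e₁ , e₂) = signed-injective w σ w′ σ′ (is-lattice wσ∈) (is-lattice w′σ′∈) eq in cong₂ _,_ e₁ e₂)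
      (Unique.filter⁺ (isSYT±? n) (fillings-unique (letters-unique n) s))
      (Unique.cartesianProductWith⁺ _,_ (λ { refl → refl , refl }) (Unique.filter⁺ lattice? words-unique)
        (vecs-unique (((λ ()) ∷ []) ∷ [] ∷ []) n))
      (λ {(w , σ)} wσ∈ → signed-∈ w σ (is-lattice wσ∈))
      (λ 𝒯∈ → let (w , e , eq) = SYT±-word 𝒯∈ in (w , signs 𝒯∈) ,
        ∈-cartesianProductWith⁺ _,_ (∈-filter⁺ lattice? (∈-words w) e) (vecs-∈ (signs 𝒯∈) (λ i → ∈-bools _)) , eq)
      where
      ∈-bools : ∀ b → b ∈ˡ bools
      ∈-bools false = here refl
      ∈-bools true  = there (here refl)
      is-lattice : ∀ {wσ} → wσ ∈ˡ signedWords → lattice (proj₁ wσ) ≡ true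
      is-lattice wσ∈ with ∈-cartesianProductWith⁻ _,_ (filter lattice? words) (vecs bools n) wσ∈
      ... | w , σ , w∈ , _ , refl = ∈-lattice w∈

  -- Statistics and admissibility in terms of words and signs

  sumTo : ℕ → (ℕ → ℕ) → ℕ
  sumTo zero    f = 0
  sumTo (suc k) f = f 0 + sumTo k (f ∘ suc)

  sumTo-cong : ∀ k {f g : ℕ → ℕ} → (∀ i → i < k → f i ≡ g i) → sumTo k f ≡ sumTo k g
  sumTo-cong zero    e = refl
  sumTo-cong (suc k) e = cong₂ _+_ (e 0 (s≤s z≤n)) (sumTo-cong k λ i i<k → e (suc i) (s≤s i<k))

  sumTo-+ : ∀ k f g → sumTo k (λ i → f i + g i) ≡ sumTo k f + sumTo k g
  sumTo-+ zero    f g = refl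
  sumTo-+ (suc k) f g = trans (cong (f 0 + g 0 +_) (sumTo-+ k (f ∘ suc) (g ∘ suc)))
    (solve 4 (λ a b c d → a :+ b :+ (c :+ d) := a :+ c :+ (b :+ d)) refl (f 0) (g 0) (sumTo k (f ∘ suc)) (sumTo k (g ∘ suc)))
    where open +-*-Solver

  module _ {P : Pred ℕ 0ℓ} (P? : Decidable P) where

    sum-filter : ∀ (f g : ℕ → ℕ) k →
      sum (map f (filter P? (applyUpTo g k))) ≡ sumTo k (λ i → if does (P? (g i)) then f (g i) else 0)
    sum-filter f g zero    = refl
    sum-filter f g (suc k) with does (P? (g 0))
    ... | true  = cong (f (g 0) +_) (sum-filter f (g ∘ suc) k)
    ... | false = sum-filter f (g ∘ suc) k

    length-filter : ∀ (g : ℕ → ℕ) k →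
      length (filter P? (applyUpTo g k)) ≡ sumTo k (λ i → if does (P? (g i)) then 1 else 0)
    length-filter g zero    = refl
    length-filter g (suc k) with does (P? (g 0))
    ... | true  = cong suc (length-filter (g ∘ suc) k)
    ... | false = length-filter (g ∘ suc) k

  module _ {A : Set} (db : A → A → Bool) where

    -- Positions of a vector start at 0, so `Q i` is meant as the test whether `suc i` is a descent.
    -- The weights in the lemmas below are shifted accordingly.
    Adjacent : ∀ {n} → (ℕ → Bool) → Vec A n → Set
    Adjacent {n} Q v = ∀ (i j : Fin n) → toℕ j ≡ suc (toℕ i) → Q (toℕ i) ≡ db (lookup v i) (lookup v j)

    Adjacent-tail : ∀ {n} Q {a} {v : Vec A n} → Adjacent Q (a ∷ v) → Adjacent (Q ∘ suc) v
    Adjacent-tail Q adj i j e = adj (suc i) (suc j) (cong suc e)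

    comajor-sumTo : ∀ {n} Q (v : Vec A n) → Adjacent Q v →
      sumTo (n ∸ 1) (λ i → if Q i then n ∸ suc i else 0) ≡ comajor db v
    comajor-sumTo Q []           adj = refl
    comajor-sumTo Q (a ∷ [])     adj = refl
    comajor-sumTo Q (_∷_ {suc n} a (b ∷ v)) adj = cong₂ _+_
      (cong (λ q → if q then suc n else 0) (adj zero (suc zero) refl))
      (comajor-sumTo (Q ∘ suc) (b ∷ v) (Adjacent-tail Q adj))

    descents-sumTo : ∀ {n} Q (v : Vec A n) → Adjacent Q v → sumTo (n ∸ 1) (λ i → if Q i then 1 else 0) ≡ descents db v
    descents-sumTo Q []          adj = refl
    descents-sumTo Q (a ∷ [])    adj = refl
    descents-sumTo Q (a ∷ b ∷ v) adj = cong₂ _+_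
      (cong (λ q → if q then 1 else 0) (adj zero (suc zero) refl))
      (descents-sumTo (Q ∘ suc) (b ∷ v) (Adjacent-tail Q adj))

    major-sumTo : ∀ {n} Q (v : Vec A n) → Adjacent Q v → sumTo (n ∸ 1) (λ i → if Q i then suc i else 0) ≡ major db v
    major-sumTo Q []          adj = refl
    major-sumTo Q (a ∷ [])    adj = refl
    major-sumTo {suc (suc n)} Q (a ∷ b ∷ v) adj = trans
      (cong₂ _+_ (cong (λ q → if q then 1 else 0) (adj zero (suc zero) refl))
        (trans (sumTo-cong n (λ i _ → split (Q (suc i)) i))
        (trans (sumTo-+ n _ _) (cong₂ _+_ (descents-sumTo (Q ∘ suc) (b ∷ v) (Adjacent-tail Q adj))
                                           (major-sumTo (Q ∘ suc) (b ∷ v) (Adjacent-tail Q adj))))))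
      (sym (+-assoc (if db a b then 1 else 0) _ _))
      where
      split : ∀ q i → (if q then suc (suc i) else 0) ≡ (if q then 1 else 0) + (if q then suc i else 0)
      split true  i = refl
      split false i = refl

    chain⇒ : ∀ {n} (v : Vec A n) → chain db v ≡ true → ∀ (i j : Fin n) → toℕ j ≡ suc (toℕ i) → db (lookup v i) (lookup v j) ≡ true
    chain⇒ (a ∷ b ∷ v) e zero    (suc zero) _  = proj₁ (∧-true e)
    chain⇒ (a ∷ b ∷ v) e (suc i) (suc j)    eq = chain⇒ (b ∷ v) (proj₂ (∧-true {db a b} e)) i j (suc-injective eq)

    ⇒chain : ∀ {n} (v : Vec A n) → (∀ (i j : Fin n) → toℕ j ≡ suc (toℕ i) → db (lookup v i) (lookup v j) ≡ true) → chain db v ≡ true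
    ⇒chain []          f = refl
    ⇒chain (a ∷ [])    f = refl
    ⇒chain (a ∷ b ∷ v) f = true-∧ (f zero (suc zero) refl) (⇒chain (b ∷ v) λ i j e → f (suc i) (suc j) (cong suc e))

  trues-sumTo : ∀ {n} (σ : Vec Bool n) → sumTo n (λ i → if signAt σ i then 1 else 0) ≡ trues σ
  trues-sumTo []          = refl
  trues-sumTo (true  ∷ σ) = cong suc (trues-sumTo σ)
  trues-sumTo (false ∷ σ) = trues-sumTo σ

  -- D says that the positions of a and a′ form a descent of the tableau.
  AdmissiblePair : Set → Letter → Letter → Set
  AdmissiblePair D a a′ = a ≤ᴸ a′ × (a ≡ a′ → 𝒜₊ a → ¬ D) × (a ≡ a′ → 𝒜₋ a → D)

  -- Equal values are forbidden in three situations: two unbarred letters at a descent, two barred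
  -- letters where there is no descent, and a barred letter before an unbarred one, whose rank is
  -- smaller. These are exactly the super descents.
  admissible⇔compatible : ∀ d b b′ k k′ {D : Set} → (D → d ≡ true) → (d ≡ true → D) →
    let C = if d ∧ not b′ ∨ not d ∧ b then k <ᵇ k′ else not (k′ <ᵇ k)
        A = AdmissiblePair D (mkLetter b k) (mkLetter b′ k′)
    in (A → C ≡ true) × (C ≡ true → A)
  admissible⇔compatible d b b′ k k′ {D} D⇒ ⇒D = by d b b′ D⇒ ⇒D
    where
    weak : k ≤ k′ → not (k′ <ᵇ k) ≡ true
    weak k≤k′ = cong not (≤→ᵇfalse k≤k′)
    weak⁻ : not (k′ <ᵇ k) ≡ true → k ≤ k′
    weak⁻ e = ≮⇒≥ λ k′<k → true≢false e (cong not (<→ᵇ k′<k))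
    strict⁻ : (k <ᵇ k′) ≡ true → k < k′
    strict⁻ = ᵇ→< k k′
    by : ∀ d b b′ → (D → d ≡ true) → (d ≡ true → D) →
      let C = if d ∧ not b′ ∨ not d ∧ b then k <ᵇ k′ else not (k′ <ᵇ k)
          A = AdmissiblePair D (mkLetter b k) (mkLetter b′ k′)
      in (A → C ≡ true) × (C ≡ true → A)
    by true false false D⇒ ⇒D =
        (λ (le , ¬D , _) → <→ᵇ {k} {k′} (≤∧≢⇒< (*-cancelˡ-≤ 2 le) λ { refl → ¬D refl (k , refl) (⇒D refl) }))
      , (λ c → *-monoʳ-≤ 2 (<⇒≤ (strict⁻ c)) , (λ { refl → contradiction (strict⁻ c) (<-irrefl refl) }) , λ { _ (_ , ()) })
    by false false false D⇒ ⇒D =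
        (λ (le , _) → weak (*-cancelˡ-≤ 2 le))
      , (λ c → *-monoʳ-≤ 2 (weak⁻ c) , (λ _ _ D → contradiction (D⇒ D) λ ()) , λ { _ (_ , ()) })
    by true false true D⇒ ⇒D =
        (λ (le , _) → weak (rank-≤⇒ false true le))
      , (λ c → m≤n⇒m≤1+n (*-monoʳ-≤ 2 (weak⁻ c)) , (λ ()) , λ ())
    by false false true D⇒ ⇒D =
        (λ (le , _) → weak (rank-≤⇒ false true le))
      , (λ c → m≤n⇒m≤1+n (*-monoʳ-≤ 2 (weak⁻ c)) , (λ ()) , λ ())
    by true true false D⇒ ⇒D =
        (λ (le , _) → <→ᵇ (*-cancelˡ-< 2 k k′ le))
      , (λ c → *-monoʳ-< 2 (strict⁻ c) , (λ ()) , λ ())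
    by false true false D⇒ ⇒D =
        (λ (le , _) → <→ᵇ (*-cancelˡ-< 2 k k′ le))
      , (λ c → *-monoʳ-< 2 (strict⁻ c) , (λ ()) , λ ())
    by true true true D⇒ ⇒D =
        (λ (le , _) → weak (rank-≤⇒ true true le))
      , (λ c → s≤s (*-monoʳ-≤ 2 (weak⁻ c)) , (λ { _ (_ , ()) }) , λ _ _ → ⇒D refl)
    by false true true D⇒ ⇒D =
        (λ (le , _ , D) → <→ᵇ {k} {k′} (≤∧≢⇒< (rank-≤⇒ true true le) λ { refl → contradiction (D⇒ (D refl (k , refl))) λ () }))
      , (λ c → s≤s (*-monoʳ-≤ 2 (<⇒≤ (strict⁻ c))) , (λ { _ (_ , ()) }) , λ { refl → contradiction (strict⁻ c) (<-irrefl refl) })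

  -- Abstract, because its normal form is very large.
  abstract
    admissible? : ∀ {n} {D : Pred ℕ 0ℓ} → Decidable D → Decidable (Admissible {n} D)
    admissible? D? a = Fin.all? λ i → Fin.all? λ j → (toℕ j ≟ suc (toℕ i)) →-dec
      ((rank (lookup a i) ≤? rank (lookup a j))
      ×-dec ((lookup a i ≟ᴸ lookup a j) →-dec (pos? (lookup a i) →-dec ¬? (D? (suc (toℕ i)))))
      ×-dec ((lookup a i ≟ᴸ lookup a j) →-dec (neg?′ (lookup a i) →-dec D? (suc (toℕ i)))))
      where
      pos? : ∀ a → Dec (𝒜₊ a)
      pos? (pos k) = yes (k , refl)
      pos? (neg k) = no λ ()
      neg?′ : ∀ a → Dec (𝒜₋ a)
      neg?′ (neg k) = yes (k , refl)
      neg?′ (pos k) = no λ ()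

  module Statistics {n : ℕ} (p : Partition n) where
    open SignedTableaux p public

    module _ (w : Word) (e : lattice w ≡ true) where

      descent⇒below : ∀ (i j : Fin n) → toℕ j ≡ suc (toℕ i) → Des (tableau w) (suc (toℕ i)) → isBelow (lookup w i) (lookup w j) ≡ true
      descent⇒below i j j≡ (r , a , r′ , a′ , e₁ , e₂ , r<r′) =
        <→ᵇ (subst₂ (λ r r′ → toℕ r < toℕ r′)
          (labelOf-row-of w e i (r , a) (trans (sym (entry-tableau w (r , a))) e₁))
          (labelOf-row-of w e j (r′ , a′) (trans (sym (entry-tableau w (r′ , a′))) (trans e₂ (cong suc (sym j≡))))) r<r′)

      below⇒descent : ∀ (i j : Fin n) → toℕ j ≡ suc (toℕ i) → isBelow (lookup w i) (lookup w j) ≡ true → Des (tableau w) (suc (toℕ i))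
      below⇒descent i j j≡ b =
        let (a , e₁) = labelOf-exists w e i ; (a′ , e₂) = labelOf-exists w e j in
        lookup w i , a , lookup w j , a′ , trans (entry-tableau w _) e₁ ,
        trans (entry-tableau w _) (trans e₂ (cong suc j≡)) , ᵇ→< (toℕ (lookup w i)) (toℕ (lookup w j)) b

      admissible-chain : ∀ (σ : Vec Bool n) v →
        does (admissible? (des? (tableau w)) (zipWith mkLetter σ v)) ≡ chain (compatible _<ᵇ_ superDescent) (zip (zip w σ) v)
      admissible-chain σ v = does-≡ (admissible? (des? (tableau w)) (zipWith mkLetter σ v))
          (λ adm → ⇒chain _ (zip (zip w σ) v) λ i j j≡ → subst₂ (λ s s′ → compatible _<ᵇ_ superDescent s s′ ≡ true)
              (sym (lookup-zip³ i)) (sym (lookup-zip³ j))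
              (proj₁ (pair i j j≡) (subst₂ (AdmissiblePair _) (lookup-letter i) (lookup-letter j) (adm i j j≡))))
          (λ ch i j j≡ → subst₂ (AdmissiblePair _) (sym (lookup-letter i)) (sym (lookup-letter j))
              (proj₂ (pair i j j≡) (subst₂ (λ s s′ → compatible _<ᵇ_ superDescent s s′ ≡ true)
                (lookup-zip³ i) (lookup-zip³ j) (chain⇒ _ (zip (zip w σ) v) ch i j j≡))))
        where
        lookup-zip³ : ∀ i → lookup (zip (zip w σ) v) i ≡ ((lookup w i , lookup σ i) , lookup v i)
        lookup-zip³ i = trans (Vec.lookup-zip i (zip w σ) v) (cong (_, lookup v i) (Vec.lookup-zip i w σ))
        lookup-letter : ∀ i → lookup (zipWith mkLetter σ v) i ≡ mkLetter (lookup σ i) (lookup v i)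
        lookup-letter i = Vec.lookup-zipWith mkLetter i σ v
        pair : ∀ i j → toℕ j ≡ suc (toℕ i) → _
        pair i j j≡ = admissible⇔compatible (isBelow (lookup w i) (lookup w j)) (lookup σ i) (lookup σ j) (lookup v i) (lookup v j)
          (descent⇒below i j j≡) (below⇒descent i j j≡)

      module _ (σ : Vec Bool n) where

        neg-sign : ∀ i → does (neg? (signed w σ) (suc (toℕ i))) ≡ lookup σ i
        neg-sign i = does-≡ (neg? (signed w σ) (suc (toℕ i)))
          (λ o → sym (occurs-sign w σ e i true o))
          (λ eq → subst (λ b → mkLetter b (toℕ i) occursIn signed w σ) eq (sign-occurs w σ e i))

        des-below : ∀ (i j : Fin n) → toℕ j ≡ suc (toℕ i) → does (des? (signed w σ ₊) (suc (toℕ i))) ≡ isBelow (lookup w i) (lookup w j)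
        des-below i j j≡ = does-≡ (des? (signed w σ ₊) (suc (toℕ i)))
          (λ d → descent⇒below i j j≡ (subst (λ T → Des T (suc (toℕ i))) (signed₊ w σ e) d))
          (λ b → subst (λ T → Des T (suc (toℕ i))) (sym (signed₊ w σ e)) (below⇒descent i j j≡ b))

        des±-superDescent : Adjacent superDescent (λ i → does (des±? (signed w σ) (suc i))) (zip w σ)
        des±-superDescent i j j≡ = trans
          (cong₂ (λ b (c , d) → b ∧ not c ∨ not b ∧ d) (des-below i j j≡)
            (cong₂ _,_ (trans (cong (λ k → does (neg? (signed w σ) (suc k))) (sym j≡)) (neg-sign j)) (neg-sign i)))
          (sym (cong₂ superDescent (Vec.lookup-zip i w σ) (Vec.lookup-zip j w σ)))

        sum-desList : ∀ (f : ℕ → ℕ) → sum (map f (desList n (signed w σ)))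
          ≡ sumTo (n ∸ 1) (λ i → if does (des±? (signed w σ) (suc i)) then f (suc i) else 0)
        sum-desList f = trans (cong (λ xs → sum (map f (filter (des±? (signed w σ)) xs))) (map-upTo suc (n ∸ 1)))
          (sum-filter (des±? (signed w σ)) f suc (n ∸ 1))

        comaj-signed : comaj n (signed w σ) ≡ comajor superDescent (zip w σ)
        comaj-signed = trans (sum-desList (n ∸_)) (comajor-sumTo superDescent _ (zip w σ) des±-superDescent)

        maj-signed : maj n (signed w σ) ≡ major superDescent (zip w σ)
        maj-signed = trans (cong sum (sym (map-id (desList n (signed w σ)))))
          (trans (sum-desList (λ i → i)) (major-sumTo superDescent _ (zip w σ) des±-superDescent))

        #neg-signed : #neg n (signed w σ) ≡ trues σ
        #neg-signed = trans (cong (λ xs → length (filter (neg? (signed w σ)) xs)) (map-upTo suc n))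
          (trans (length-filter (neg? (signed w σ)) suc n)
          (trans (sumTo-cong n λ i i<n → cong (λ b → if b then 1 else 0) (sign i i<n)) (trues-sumTo σ)))
          where
          sign : ∀ i → i < n → does (neg? (signed w σ) (suc i)) ≡ signAt σ i
          sign i i<n = trans (cong (λ k → does (neg? (signed w σ) (suc k))) (sym (Fin.toℕ-fromℕ< i<n)))
            (trans (neg-sign (Fin.fromℕ< i<n)) (trans (sym (signAt-lookup σ _)) (cong (signAt σ) (Fin.toℕ-fromℕ< i<n))))

open TableauxAndWords

-- Power series in q and t

open import Defs
open ≡ using (refl; sym; trans; cong; cong₂; subst)
open import Data.Nat using (_≟_)
open import Data.Vec using (lookup; zipWith)
open import Data.Integer as ℤ using (ℤ; 0ℤ; 1ℤ)
import Data.Integer.Properties as ℤ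

ℤ[[t]] : CommutativeRing 0ℓ 0ℓ
ℤ[[t]] = PowerSeries.powerSeries ℤ.+-*-commutativeRing

-- With q as the outer variable, the carrier, the equality and the addition agree by definition with
-- those of `Series`; the two products are compared in `⊗-conv`.
𝕊 : CommutativeRing 0ℓ 0ℓ
𝕊 = PowerSeries.powerSeries ℤ[[t]]

module T = PowerSeries ℤ.+-*-commutativeRing
module Q = PowerSeries ℤ[[t]]
module S = CommutativeRing 𝕊
open S using (_*_; 1#)
open FiniteSums 𝕊
open import Algebra.Properties.Semiring.Exp S.semiring using (_^_; ^-homo-*)

∑ᵗ-coefficient : ∀ {I : Set} (is : List I) (f : I → ℕ → ℤ) k →
  FiniteSums.∑ᴿ ℤ[[t]] is f k ≡ sumℤ (map (λ i → f i k) is)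
∑ᵗ-coefficient []       f k = refl
∑ᵗ-coefficient (i ∷ is) f k = cong (ℤ._+_ (f i k)) (∑ᵗ-coefficient is f k)

∑-coefficient : ∀ {I : Set} (is : List I) (f : I → Series) m k → ∑ is f m k ≡ sumℤ (map (λ i → f i m k) is)
∑-coefficient []       f m k = refl
∑-coefficient (i ∷ is) f m k = cong (ℤ._+_ (f i m k)) (∑-coefficient is f m k)

⊗-conv : ∀ f g → f ⊗ g ≈ f * g
⊗-conv f g m k = sym (trans (Q.conv-∑ f g m k) (trans (∑ᵗ-coefficient (upTo (suc m)) (λ i → T.conv (f i) (g (m ∸ i))) k)
  (sumℤ-cong (upTo (suc m)) λ i → T.conv-∑ (f i) (g (m ∸ i)) k)))
  where
  sumℤ-cong : ∀ (is : List ℕ) {f g : ℕ → ℤ} → (∀ i → f i ≡ g i) → sumℤ (map f is) ≡ sumℤ (map g is)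
  sumℤ-cong []       e = refl
  sumℤ-cong (i ∷ is) e = cong₂ ℤ._+_ (e i) (sumℤ-cong is e)

mono : ℕ → ℕ → Series
mono a b = Q.monomial a (T.monomial b 1ℤ)

module _ (R : CommutativeRing 0ℓ 0ℓ) where
  open PowerSeries R
  open CommutativeRing R using (0#)

  monomial-≡ : ∀ a x → monomial a x a ≡ x
  monomial-≡ zero    x = refl
  monomial-≡ (suc a) x = monomial-≡ a x

  monomial-≢ : ∀ a x m → ¬ (a ≡ m) → monomial a x m ≡ 0#
  monomial-≢ zero    x zero    a≢m = contradiction refl a≢m
  monomial-≢ zero    x (suc m) a≢m = refl
  monomial-≢ (suc a) x zero    a≢m = refl
  monomial-≢ (suc a) x (suc m) a≢m = monomial-≢ a x m (a≢m ∘ cong suc)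

q^t^-mono : ∀ a b → q^ a t^ b ≈ mono a b
q^t^-mono a b m k with a ≟ m | b ≟ k
... | yes refl | yes refl = sym (trans (cong (λ f → f b) (monomial-≡ ℤ[[t]] a (T.monomial b 1ℤ))) (monomial-≡ ℤ.+-*-commutativeRing b 1ℤ))
... | yes refl | no b≢k     = sym (trans (cong (λ f → f k) (monomial-≡ ℤ[[t]] a (T.monomial b 1ℤ))) (monomial-≢ ℤ.+-*-commutativeRing b 1ℤ k b≢k))
... | no a≢m     | _          = sym (cong (λ f → f k) (monomial-≢ ℤ[[t]] a (T.monomial b 1ℤ) m a≢m))

q^t^-support : ∀ a b m k → ¬ ((q^ a t^ b) m k ≡ 0ℤ) → a ≡ m
q^t^-support a b m k ≢0 with a ≟ m | b ≟ k
... | yes e | _ = e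
... | no _  | _ = contradiction refl ≢0

mono-* : ∀ a b c d → mono a b * mono c d ≈ mono (a ℕ.+ c) (b ℕ.+ d)
mono-* a b c d = S.trans (Q.monomial-* a c (T.monomial b 1ℤ) (T.monomial d 1ℤ))
  (Q.monomial-cong (a ℕ.+ c) (T.monomial-* b d 1ℤ 1ℤ))

1-mono : 1# ≈ mono 0 0
1-mono zero    zero    = refl
1-mono zero    (suc k) = refl
1-mono (suc m) k       = refl

𝟙-one : 𝟙 ≈ 1#
𝟙-one = S.trans (q^t^-mono 0 0) (S.sym 1-mono)

q t : Series
q = mono 1 0
t = mono 0 1

q^-mono : ∀ a → q ^ a ≈ mono a 0
q^-mono zero    = 1-mono
q^-mono (suc a) = S.trans (S.*-congˡ (q^-mono a)) (mono-* 1 0 a 0)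

t^-mono : ∀ b → t ^ b ≈ mono 0 b
t^-mono zero    = 1-mono
t^-mono (suc b) = S.trans (S.*-congˡ (t^-mono b)) (mono-* 0 1 0 b)

t^*q^ : ∀ b a → t ^ b * q ^ a ≈ q^ a t^ b
t^*q^ b a = S.trans (S.*-cong (t^-mono b) (q^-mono a)) (S.trans (mono-* 0 b a 0)
  (S.trans (S.reflexive (cong (mono a) (ℕ.+-identityʳ b))) (S.sym (q^t^-mono a b))))

open PPartitions 𝕊 q using (qPoch)

product-∷ʳ : ∀ (fs : List Series) g → foldr _*_ 1# (fs ++ g ∷ []) ≈ foldr _*_ 1# fs * g
product-∷ʳ []       g = S.trans (S.*-identityʳ g) (S.sym (S.*-identityˡ g))
product-∷ʳ (f ∷ fs) g = S.trans (S.*-congˡ (product-∷ʳ fs g)) (S.sym (S.*-assoc f _ g))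

⊗-product : ∀ (fs : List Series) → foldr _⊗_ 𝟙 fs ≈ foldr _*_ 1# fs
⊗-product []       = 𝟙-one
⊗-product (f ∷ fs) = S.trans (⊗-conv f (foldr _⊗_ 𝟙 fs)) (S.*-congˡ (⊗-product fs))

qPochhammer-qPoch : ∀ n → qPochhammer n ≈ qPoch n
qPochhammer-qPoch n = S.trans (⊗-product (map factor ⟦1⋯ n ⟧))
  (S.trans (S.reflexive (cong (foldr _*_ 1#) (trans (cong (map factor) (map-upTo suc n)) (map-applyUpTo suc factor n)))) (go n))
  where
  factor : ℕ → Series
  factor i = 𝟙 ⊖ q^ i t^ 0
  go : ∀ n → foldr _*_ 1# (applyUpTo (factor ∘ suc) n) ≈ qPoch n
  go zero    = S.refl
  go (suc n) = S.trans (S.reflexive (cong (foldr _*_ 1#) (sym (applyUpTo-∷ʳ (factor ∘ suc) n))))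
    (S.trans (product-∷ʳ (applyUpTo (factor ∘ suc) n) (factor (suc n)))
      (S.*-cong (go n) (S.+-cong 𝟙-one (S.-‿cong (S.trans (q^t^-mono (suc n) 0) (S.sym (q^-mono (suc n))))))))

-- With 1 as its constant term in q, `qPoch n` is invertible over ℤ[[t]] by `conv-inverse`.
qPoch-constant : ∀ n → CommutativeRing._≈_ ℤ[[t]] (qPoch n 0) (CommutativeRing.1# ℤ[[t]])
qPoch-constant zero    = R.refl
  where module R = CommutativeRing ℤ[[t]]
qPoch-constant (suc n) = R.trans (R.*-cong (qPoch-constant n) constant) (R.*-identityˡ R.1#)
  where
  module R = CommutativeRing ℤ[[t]]
  constant : (1# S.- q ^ suc n) 0 R.≈ R.1#
  constant = R.trans (R.+-congˡ {R.1#} (R.-‿cong (q^-mono (suc n) 0))) (R.+-identityʳ R.1#)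

-- The specialized super Schur function

module Conclusion {n : ℕ} (p : Partition n) where
  open Statistics p

  |shape| : Vec.sum shape ≡ n
  |shape| = trans (fromList-sum s) (size p)

  open WordSums 𝕊 shape n |shape| hiding (words)

  ∑-lattice : ∀ (f : Word → Series) → ∑ᴿ (filter lattice? words) f ≈ ∑ᴿ words (λ w → [ lattice w ] f w)
  ∑-lattice f = S.trans (∑-filter lattice? words f)
    (∑-cong words λ w → S.reflexive (cong (λ b → [ b ] f w) (does-≡ (lattice? w) (λ e → e) (λ e → e))))

  ∑-SYT± : ∀ (f : Filling Letter s → Series) →
    ∑ (SYT± p) f ≈ ∑ᴿ words (λ w → ∑ᴿ (vecs bools n) λ σ → [ lattice w ] f (signed w σ))
  ∑-SYT± f = S.trans (∑-↭ f SYT±-↭) (S.trans (∑-map signedWords (λ (w , σ) → signed w σ) f)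
    (S.trans (∑-product _,_ (filter lattice? words) (vecs bools n) _)
    (S.trans (∑-lattice λ w → ∑ᴿ (vecs bools n) λ σ → f (signed w σ))
      (∑-cong words λ w → []-∑ (lattice w) (vecs bools n) _))))

  ∑-statistic : ∀ (stat : Filling Letter s → ℕ) (stat′ : ∀ {k} → Vec (Fin ℓ × Bool) k → ℕ) →
    (∀ w → lattice w ≡ true → ∀ σ → stat (signed w σ) ≡ stat′ (zip w σ)) →
    ∑ (SYT± p) (λ 𝒯 → q^ stat 𝒯 t^ #neg n 𝒯) ≈ statisticSum q t stat′
  ∑-statistic stat stat′ e = S.trans (∑-SYT± _) (∑-cong words λ w → ∑-cong (vecs bools n) λ σ →
    []-cong-on (lattice w) λ l → S.trans
      (S.reflexive (cong₂ q^_t^_ (e w l σ) (#neg-signed w l σ))) (S.sym (t^*q^ (trues σ) (stat′ (zip w σ)))))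
    where open ShapeOperators 𝕊 using ([]-cong-on)

  comajSum majSum : Series
  comajSum = ∑ (SYT± p) (λ 𝒯 → q^ comaj n 𝒯 t^ #neg n 𝒯)
  majSum   = ∑ (SYT± p) (λ 𝒯 → q^ maj n 𝒯 t^ #neg n 𝒯)

  X Y : ℕ → Series
  X i = q^ i t^ 0
  Y i = q^ i t^ 1

  weight : ∀ {k} → Vec Letter k → Series
  weight a = Vec.foldr′ _⊗_ 𝟙 (Vec.map (z X Y) a)

  weight-∷ : ∀ {k} a (as : Vec Letter k) → weight (a ∷ as) ≈ z X Y a * weight as
  weight-∷ a as = ⊗-conv (z X Y a) (weight as)

  weight-monomial : ∀ {k} (σ : Vec Bool k) v → weight (zipWith mkLetter σ v) ≈ monomialOf (x q t) (y q t) σ v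
  weight-monomial []          []      = 𝟙-one
  weight-monomial (false ∷ σ) (k ∷ v) = S.trans (weight-∷ (pos k) (zipWith mkLetter σ v)) (S.*-cong
    (S.trans (q^t^-mono k 0) (S.sym (q^-mono k))) (weight-monomial σ v))
  weight-monomial (true ∷ σ)  (k ∷ v) = S.trans (weight-∷ (neg k) (zipWith mkLetter σ v)) (S.*-cong
    (S.trans (S.sym (t^*q^ 1 k)) (S.*-congʳ (S.*-identityʳ t))) (weight-monomial σ v))

  index : Letter → ℕ
  index (pos k) = k
  index (neg k) = k

  isNeg : Letter → ℕ
  isNeg (pos k) = 0
  isNeg (neg k) = 1

  weight-power : ∀ {k} (a : Vec Letter k) → weight a ≈ q^ Vec.sum (Vec.map index a) t^ Vec.sum (Vec.map isNeg a)
  weight-power []      = S.refl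
  weight-power (a ∷ v) = S.trans (weight-∷ a v) (S.trans
    (S.*-cong (S.trans (letter a) (q^t^-mono (index a) (isNeg a))) (S.trans (weight-power v) (q^t^-mono (Vec.sum (Vec.map index v)) (Vec.sum (Vec.map isNeg v)))))
    (S.trans (mono-* (index a) (isNeg a) (Vec.sum (Vec.map index v)) (Vec.sum (Vec.map isNeg v)))
      (S.sym (q^t^-mono (Vec.sum (Vec.map index (a ∷ v))) (Vec.sum (Vec.map isNeg (a ∷ v)))))))
    where
    letter : ∀ a → z X Y a ≈ q^ index a t^ isNeg a
    letter (pos k) = S.refl
    letter (neg k) = S.refl

  lookup-≤-Vec-sum : ∀ {k} (v : Vec ℕ k) i → lookup v i ≤ Vec.sum v
  lookup-≤-Vec-sum (m ∷ v) zero    = ℕ.m≤m+n m (Vec.sum v)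
  lookup-≤-Vec-sum (m ∷ v) (suc i) = ℕ.≤-trans (lookup-≤-Vec-sum v i) (ℕ.m≤n+m (Vec.sum v) m)

  admissibleWords : Filling ℕ s → ℕ → List (Vec Letter n)
  admissibleWords T M = filter (admissible? (des? T)) (vecs (letters M) n)

  -- A word contributing to the coefficient of qᵐ has all its letters among the
  -- first m + 1 pairs.
  Q̃ : Filling ℕ s → Series
  Q̃ T m k = sumℤ (map (λ a → weight a m k) (admissibleWords T (suc m)))

  Q̃-HasSum : ∀ T → Q̃[ n , Des T ]⟨ X , Y ⟩⇓ Q̃ T
  Q̃-HasSum T m k = admissibleWords T (suc m)
    , Unique.filter⁺ (admissible? (des? T)) (vecs-unique (letters-unique (suc m)) n)
    , All.tabulate (λ a∈ → proj₂ (∈-filter⁻ (admissible? (des? T)) {xs = vecs (letters (suc m)) n} a∈))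
    , (λ {a} adm ≢0 → ∈-filter⁺ (admissible? (des? T)) (vecs-∈ a (small a ≢0)) adm)
    , refl
    where
    index-letter : ∀ a → a ≡ mkLetter (proj₁ (letter-view a)) (index a)
    index-letter (pos k) = refl
    index-letter (neg k) = refl
    small : ∀ a → ¬ (weight a m k ≡ 0ℤ) → ∀ i → lookup a i ∈ˡ letters (suc m)
    small a ≢0 i = subst (_∈ˡ letters (suc m)) (sym (index-letter (lookup a i))) (∈-letters⁺ _ (s≤s
      (ℕ.≤-trans (ℕ.≤-reflexive (sym (Vec.lookup-map i index a)))
      (ℕ.≤-trans (lookup-≤-Vec-sum (Vec.map index a) i) (ℕ.≤-reflexive sum≡m)))))
      where
      sum≡m : Vec.sum (Vec.map index a) ≡ m
      sum≡m = q^t^-support _ (Vec.sum (Vec.map isNeg a)) m k λ e → ≢0 (trans (weight-power a m k) e)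

  ∑-letters : ∀ M k (f : Vec Letter k → Series) →
    ∑ᴿ (vecs (letters M) k) f ≈ ∑ᴿ (vecs bools k) (λ σ → ∑ᴿ (vecs (upTo M) k) λ v → f (zipWith mkLetter σ v))
  ∑-letters M zero    f = S.sym (S.+-identityʳ _)
  ∑-letters M (suc k) f = begin
    ∑ᴿ (vecs (letters M) (suc k)) f
      ≈⟨ ∑-vecs (letters M) k f ⟩
    ∑ᴿ (letters M) (λ a → ∑ᴿ (vecs (letters M) k) λ as → f (a ∷ as))
      ≈⟨ ∑-concatMap (upTo M) (λ j → pos j ∷ neg j ∷ []) _ ⟩
    ∑ᴿ (upTo M) (λ j → ∑ᴿ bools λ b → ∑ᴿ (vecs (letters M) k) λ as → f (mkLetter b j ∷ as))
      ≈⟨ ∑-swap (upTo M) bools (λ j b → ∑ᴿ (vecs (letters M) k) λ as → f (mkLetter b j ∷ as)) ⟩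
    ∑ᴿ bools (λ b → ∑ᴿ (upTo M) λ j → ∑ᴿ (vecs (letters M) k) λ as → f (mkLetter b j ∷ as))
      ≈⟨ ∑-cong bools (λ b → ∑-cong (upTo M) λ j → ∑-letters M k (λ as → f (mkLetter b j ∷ as))) ⟩
    ∑ᴿ bools (λ b → ∑ᴿ (upTo M) λ j → ∑ᴿ (vecs bools k) λ σ → ∑ᴿ (vecs (upTo M) k) λ v → f (mkLetter b j ∷ zipWith mkLetter σ v))
      ≈⟨ ∑-cong bools (λ b → S.trans
           (∑-swap (upTo M) (vecs bools k) λ j σ → ∑ᴿ (vecs (upTo M) k) λ v → f (mkLetter b j ∷ zipWith mkLetter σ v))
           (∑-cong (vecs bools k) λ σ → S.sym (∑-vecs (upTo M) k λ v → f (zipWith mkLetter (b ∷ σ) v)))) ⟩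
    ∑ᴿ bools (λ b → ∑ᴿ (vecs bools k) λ σ → ∑ᴿ (vecs (upTo M) (suc k)) λ v → f (zipWith mkLetter (b ∷ σ) v))
      ≈⟨ ∑-vecs bools k (λ σ → ∑ᴿ (vecs (upTo M) (suc k)) λ v → f (zipWith mkLetter σ v)) ⟨
    ∑ᴿ (vecs bools (suc k)) (λ σ → ∑ᴿ (vecs (upTo M) (suc k)) λ v → f (zipWith mkLetter σ v)) ∎
    where open SetoidReasoning S.setoid

  wordSum≤ : ℕ → Series
  wordSum≤ M = wordSum (x q t) (y q t) _<ᵇ_ (upTo M)

  ∑-tableaux : ∀ M → ∑ (SYT p) (λ T → ∑ (admissibleWords T M) weight) ≈ wordSum≤ M
  ∑-tableaux M = begin
    ∑ (SYT p) (λ T → ∑ (admissibleWords T M) weight)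
      ≈⟨ S.trans (∑-↭ _ SYT-↭) (S.trans (∑-map (filter lattice? words) tableau _) (∑-lattice _)) ⟩
    ∑ᴿ words (λ w → [ lattice w ] ∑ (admissibleWords (tableau w) M) weight)
      ≈⟨ ∑-cong words (λ w → S.trans ([]-cong-on (lattice w) (term w))
           (S.trans ([]-∑ (lattice w) Σs _) (∑-cong Σs λ σ → []-∑ (lattice w) V _))) ⟩
    ∑ᴿ words (λ w → ∑ᴿ Σs λ σ → ∑ᴿ V λ v →
      [ lattice w ] [ chain C (zip (zip w σ) v) ] monomialOf (x q t) (y q t) σ v)
      ≈⟨ ∑-cong words (λ w → ∑-cong Σs λ σ → ∑-cong V λ v →
           exchange (lattice w) (chain C (zip (zip w σ) v)) _) ⟩
    wordSum≤ M ∎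
    where
    open SetoidReasoning S.setoid
    open ShapeOperators 𝕊 using ([]-cong-on)
    Σs = vecs bools n
    V = vecs (upTo M) n
    C = compatible _<ᵇ_ (superDescent {ℓ})
    exchange : ∀ b c u → [ b ] [ c ] u ≈ [ c ] [ b ] u
    exchange true  c     u = S.refl
    exchange false true  u = S.refl
    exchange false false u = S.refl
    term : ∀ w → lattice w ≡ true → ∑ (admissibleWords (tableau w) M) weight
      ≈ ∑ᴿ Σs (λ σ → ∑ᴿ V λ v → [ chain C (zip (zip w σ) v) ] monomialOf (x q t) (y q t) σ v)
    term w l = S.trans (∑-filter (admissible? (des? (tableau w))) (vecs (letters M) n) weight)
      (S.trans (∑-letters M n _) (∑-cong Σs λ σ → ∑-cong V λ v → S.trans
        (S.reflexive (cong (λ b → [ b ] weight (zipWith mkLetter σ v)) (admissible-chain w l σ v)))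
        ([]-cong (chain C (zip (zip w σ) v)) (weight-monomial σ v))))

  superSchur : Series
  superSchur = ∑ (SYT p) Q̃

  -- The truncation grows with the degree, so `superSchur` is no single `wordSum≤ M` and has to be
  -- compared with them coefficient by coefficient.
  superSchur-coefficient : ∀ m k → superSchur m k ≡ wordSum≤ (suc m) m k
  superSchur-coefficient m k = trans (∑-coefficient (SYT p) Q̃ m k) (trans
    (cong sumℤ (map-cong (λ T → sym (∑-coefficient (admissibleWords T (suc m)) weight m k)) (SYT p)))
    (trans (sym (∑-coefficient (SYT p) (λ T → ∑ (admissibleWords T (suc m)) weight) m k)) (∑-tableaux (suc m) m k)))

  qPoch⁻¹ : Series
  qPoch⁻¹ = Inverse.inverse ℤ[[t]] (qPoch n)

  qPoch-inverse : qPoch n * qPoch⁻¹ ≈ 1#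
  qPoch-inverse = Inverse.conv-inverse ℤ[[t]] (qPoch n) (qPoch-constant n)

  -- Multiplication by `qPoch⁻¹` keeps the error a multiple of `q ^ M`, so the coefficients below
  -- degree `M` are determined whatever `h` is.
  coefficient : ∀ X M → ∃[ h ] qPoch n * wordSum≤ M ≈ X ⊕ (q ^ M * h) →
    ∀ m k → m < M → wordSum≤ M m k ≡ (qPoch⁻¹ * X) m k
  coefficient X M (h , e) m k m<M = trans (expand m k)
    (trans (cong (ℤ._+_ ((qPoch⁻¹ * X) m k)) low) (ℤ.+-identityʳ _))
    where
    open SetoidReasoning S.setoid
    open import Algebra.Properties.CommutativeSemigroup S.*-commutativeSemigroup using (x∙yz≈y∙xz)
    expand : wordSum≤ M ≈ (qPoch⁻¹ * X) ⊕ (q ^ M * (qPoch⁻¹ * h))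
    expand = begin
      wordSum≤ M
        ≈⟨ S.*-identityˡ (wordSum≤ M) ⟨
      1# * wordSum≤ M
        ≈⟨ S.*-congʳ (S.trans (S.*-comm qPoch⁻¹ (qPoch n)) qPoch-inverse) ⟨
      qPoch⁻¹ * qPoch n * wordSum≤ M
        ≈⟨ S.*-assoc qPoch⁻¹ (qPoch n) (wordSum≤ M) ⟩
      qPoch⁻¹ * (qPoch n * wordSum≤ M)
        ≈⟨ S.*-congˡ e ⟩
      qPoch⁻¹ * (X ⊕ (q ^ M * h))
        ≈⟨ S.distribˡ qPoch⁻¹ X (q ^ M * h) ⟩
      (qPoch⁻¹ * X) ⊕ (qPoch⁻¹ * (q ^ M * h))
        ≈⟨ S.+-congˡ {qPoch⁻¹ * X} (x∙yz≈y∙xz qPoch⁻¹ (q ^ M) h) ⟩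
      (qPoch⁻¹ * X) ⊕ (q ^ M * (qPoch⁻¹ * h)) ∎
    low : (q ^ M * (qPoch⁻¹ * h)) m k ≡ 0ℤ
    low = trans (S.*-congʳ {qPoch⁻¹ * h} (q^-mono M) m k) (Q.monomial-low m<M (T.monomial 0 1ℤ) (qPoch⁻¹ * h) k)

  superSchur-comaj : superSchur ≈ qPoch⁻¹ * comajSum
  superSchur-comaj m k = trans (superSchur-coefficient m k) (trans
    (coefficient _ (suc m) (qPoch-comajor q t (suc m)) m k ℕ.≤-refl)
    (S.*-congˡ {qPoch⁻¹} (S.sym (∑-statistic (comaj n) (comajor superDescent) comaj-signed)) m k))

  superSchur-maj : superSchur ≈ qPoch⁻¹ * majSum
  superSchur-maj m k = trans (superSchur-coefficient m k) (trans
    (coefficient _ (suc m) (qPoch-major q t (suc m)) m k ℕ.≤-refl)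
    (S.*-congˡ {qPoch⁻¹} (S.sym (∑-statistic (maj n) (major superDescent) maj-signed)) m k))

theorem5p11 : ∀ {n : ℕ} (λ′ : Partition n) →
    ∃[ S ] ∃[ R ]
    s̃[ λ′ ]⟨ (λ i → q^ i t^ 0) , (λ i → q^ i t^ 1) ⟩⇓ S
    × qPochhammer n ⊗ R ≈ 𝟙
    × S ≈ R ⊗ ∑ (SYT± λ′) (λ 𝒯 → q^ comaj n 𝒯 t^ #neg n 𝒯)
    × R ⊗ ∑ (SYT± λ′) (λ 𝒯 → q^ comaj n 𝒯 t^ #neg n 𝒯)
    ≈ R ⊗ ∑ (SYT± λ′) (λ 𝒯 → q^ maj n 𝒯 t^ #neg n 𝒯)
theorem5p11 {n} λ′ = superSchur , qPoch⁻¹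
  , (Q̃ , (λ T _ → Q̃-HasSum T) , S.refl)
  , S.trans (⊗-conv (qPochhammer n) qPoch⁻¹) (S.trans (S.*-congʳ (qPochhammer-qPoch n)) (S.trans qPoch-inverse (S.sym 𝟙-one)))
  , S.trans superSchur-comaj (S.sym (⊗-conv qPoch⁻¹ comajSum))
  -- That the two statistics have the same distribution is seen through the super Schur function,
  -- which equals both sides.
  , S.trans (⊗-conv qPoch⁻¹ comajSum) (S.trans (S.sym superSchur-comaj)
      (S.trans superSchur-maj (S.sym (⊗-conv qPoch⁻¹ majSum))))
  where open Conclusion λ′
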